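{- Given any $\gamma>0$ and an integer $r\ge 3$ there exists $n_0\in\mathbb N$ such that the following holds. Suppose that $G$ is a digraph on $n\ge n_0$ vertices where $r$ divides $n$ and that for every $x\in V(G)$, $d^+(x)\ge(1-1/r)n$ or $d^-(x)\ge (1-1/r)n$. Further suppose that for any $x,y\in V(G)$, if $d^+(x)<(1-1/r)n$ and $d^-(y)<(1-1/r)n$ then $xy\notin E(G)$. Then at least one of the following holds: (i) $G$ contains a perfect $T_r$-packing; (ii) $G$ contains a $\gamma$-independent set of size at least $n/r$.
   Context: A digraph has no loops and at most one edge in each direction between any two vertices; $xy$ denotes the edge from $x$ to $y$; $d^\pm(x)$ are out-/indegree. $T_r$ is the transitive tournament on $r$ vertices. A perfect $T_r$-packing is a collection of vertex-disjoint (not necessarily induced) copies of $T_r$ covering all vertices. For $G$ on $n$ vertices, $S\subseteq V(G)$ is $\gamma$-independent if $G[S]$ has at most $\gamma n^2$ edges. -}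

module Defs where

open import Data.Nat using (ℕ; zero; suc; _+_; _*_)
open import Data.Bool using (Bool; true; false; if_then_else_; _∧_)
open import Data.Fin using (Fin; zero; suc; _<_)
open import Data.Integer using (+_)
open import Data.Rational using (ℚ; _/_)
import Data.Rational as ℚ
open import Data.Product using (Σ; ∃; _×_)
open import Relation.Binary.PropositionalEquality using (_≡_)
open import Function using (_∘_)

record Digraph (n : ℕ) : Set where
  field
    adj      : Fin n → Fin n → Bool
    loopless : ∀ x → adj x x ≡ false
open Digraph public

sumᶠ : ∀ {n} → (Fin n → ℕ) → ℕ
sumᶠ {zero}  f = 0
sumᶠ {suc n} f = f zero + sumᶠ (f ∘ suc)

countᶠ : ∀ {n} → (Fin n → Bool) → ℕ
countᶠ p = sumᶠ (λ x → if p x then 1 else 0)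

outdeg : ∀ {n} → Digraph n → Fin n → ℕ
outdeg G x = countᶠ (λ y → adj G x y)

indeg : ∀ {n} → Digraph n → Fin n → ℕ
indeg G x = countᶠ (λ y → adj G y x)

edgesIn : ∀ {n} → Digraph n → (Fin n → Bool) → ℕ
edgesIn G S = sumᶠ (λ x → countᶠ (λ y → S x ∧ S y ∧ adj G x y))

toℚ : ℕ → ℚ
toℚ m = (+ m) / 1

γ-Independent : ∀ {n} → ℚ → Digraph n → (Fin n → Bool) → Set
γ-Independent {n} γ G S = toℚ (edgesIn G S) ℚ.≤ (γ ℚ.* toℚ (n * n))

size : ∀ {n} → (Fin n → Bool) → ℕ
size S = countᶠ S

-- A perfect T_r-packing: k vertex-disjoint copies of T_r covering all vertices.
-- Copy i is the injective map j ↦ f i j from V(T_r) = Fin r (edges j→j' for j<j')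
-- into V(G), preserving edges (not necessarily induced).
PerfectTPacking : ∀ {n} → (r : ℕ) → Digraph n → Set
PerfectTPacking {n} r G =
  Σ ℕ λ k → Σ (Fin k → Fin r → Fin n) λ f →
    (∀ i j i' j' → f i j ≡ f i' j' → (i ≡ i' × j ≡ j'))
    × (∀ v → ∃ λ i → ∃ λ j → f i j ≡ v)
    × (∀ i j j' → j < j' → adj G (f i j) (f i j') ≡ true)

-- Give every vertex v a type: one of its neighbourhoods of size at least (1 - 1/r)n, called
-- N v. If each vertex of a sequence lies in N v for every earlier v, its vertices span a
-- transitive tournament: types given by out-neighbourhoods are placed from the front, the
-- others from the back. So only "chains" have to be found, and greedily this always works
-- up to the last vertex.
--
-- Assume that no set of size n/r is nearly independent. The common neighbourhood of two
-- vertices then contains many chains on r - 1 vertices, because the last two can be taken to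
-- be an edge of a set of size n/r. Hence every r-tuple has a positive proportion of
-- absorbers, and a potential argument picks disjoint absorbers such that every r-tuple is
-- absorbed by linearly many of them.
--
-- The remaining vertices are covered almost completely by tiles. For a weight w on the
-- uncovered set R, the greedy chain of heaviest vertices has weight at least
-- (r/|R|) w(R) up to a loss coming from the slightly too small degrees; if that loss matters,
-- then w drops markedly after some vertex of the chain, and an edge inside the
-- non-neighbourhood of that vertex gives a heavier chain. Choosing w from a quadratic
-- potential, the tiles use up all non-neighbourhoods, and the edges inside them, at the
-- proportional rate, so that the argument can be repeated until few vertices remain.

module Submission where

open import Defs
open import Data.Nat using (ℕ; zero; suc; _+_; _*_; _∸_; _^_; _≤_; _<_; _≤ᵇ_; _≤?_; z≤n; s≤s; NonZero; >-nonZero; >-nonZero⁻¹; s≤s⁻¹)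
open import Data.Nat.Properties hiding (_≟_)
open import Data.Nat.DivMod using (_/_; m/n*n≤m; m*n/n≡m; /-monoˡ-≤; m≡m%n+[m/n]*n; m%n<n)
open import Data.Nat.Tactic.RingSolver using (solve; solve-∀)
open import Data.Bool using (Bool; true; false; if_then_else_; _∧_; _∨_; not; T)
open import Data.List using (List; []; _∷_; _++_; length; map; concat; filterᵇ; [_]; cartesianProduct; allFin; tabulate; lookup)
open import Data.List.Properties using (length-++; ++-identityʳ; ++-assoc; concat-++; length-tabulate)
open import Data.List.Membership.Propositional using (_∈_)
open import Data.List.Membership.Propositional.Properties using (∈-++⁺ˡ; ∈-++⁺ʳ; ∈-++⁻; ∈-cartesianProduct⁺; ∈-allFin; ∈-lookup)
open import Data.List.Relation.Unary.Any using (here; there)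
open import Data.List.Relation.Unary.All as All using (All)
import Data.List.Relation.Unary.All.Properties as Allₚ
open import Data.List.Relation.Unary.AllPairs as AllPairs using (AllPairs)
import Data.List.Relation.Unary.AllPairs.Properties as AllPairsₚ
import Data.List.Relation.Unary.Any as Any
open import Data.List.Relation.Unary.Any.Properties using (lookup-index)
open import Data.Fin using (Fin; zero; suc)
import Data.Fin as Fin
open import Relation.Nullary.Decidable using (does)
open import Data.List.Relation.Binary.Permutation.Propositional using (_↭_; ↭-refl; ↭-sym; ↭-trans; prep; swap; ↭-reflexive)
import Data.List.Relation.Binary.Permutation.Propositional as Perm
open import Data.List.Relation.Binary.Permutation.Propositional.Properties using (∈-resp-↭; All-resp-↭; ↭-length; ++⁺; ++⁺ˡ; ++⁺ʳ; shift; ++-comm)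
open import Data.Product using (Σ; ∃; _×_; _,_; proj₁; proj₂)
open import Data.Sum using (_⊎_; inj₁; inj₂)
open import Data.Empty using (⊥; ⊥-elim)
open import Data.Unit using (⊤; tt)
open import Relation.Nullary using (yes; no)
open import Relation.Binary.PropositionalEquality using (_≡_; _≢_; refl; sym; trans; cong; cong₂; subst; subst₂)
open import Function using (_∘_; id)
open import Data.Nat.Divisibility using (_∣_; divides)
open import Data.Rational using (ℚ; 0ℚ; mkℚ)
import Data.Rational as ℚ
import Data.Rational.Properties as ℚₚ
open import Data.Rational.Unnormalised as ℚᵘ using (mkℚᵘ; *≤*)
import Data.Rational.Unnormalised.Properties as ℚᵘₚ
import Data.Integer as ℤ
import Data.Integer.Properties as ℤₚ
open import Data.Fin.Subset.Properties using (anySubset?)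
import Data.Vec as Vec
open import Data.Vec.Properties using (lookup∘tabulate)
open import Relation.Nullary.Decidable using (_×-dec_)

-- The obstacle is a small slack. Once the absorbing set is deleted, a non-neighbourhood may hold
-- slightly more than its share 1/r of what remains, so `r * b ≤ length R` fails for the bound `b`
-- on its size and a greedy chain may stay below the average weight. The slack is measured by `g` in
-- `8 * (r * b) ≤ 8 * length R + g`; a chain that beats the greedy bound by `g / 8` times the
-- largest weight makes up for it. The search for a drop in weight may descend through the whole
-- chain and the errors grow tenfold on each level, hence `10 ^ r`.
--
-- Tiles are placed in rounds, because this argument tolerates only few deletions. A round that
-- covers `y` vertices of a set of size `m` disturbs proportionality by the order of `y * y / m`.
-- Rounds that are short compared with the `K` vertices that may stay uncovered therefore do little
-- harm altogether. A vertex one of whose tests fails in a round is put aside; the potential bounds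
-- the number of these independently of n, and the invariants speak only of vertices that are still
-- to be covered, so nothing else is lost.

variable
  X Y : Set

-- Sums and counts over lists, sublists up to permutation

⟦_⟧ : Bool → ℕ
⟦ b ⟧ = if b then 1 else 0

∑ : List X → (X → ℕ) → ℕ
∑ []       f = 0
∑ (x ∷ xs) f = f x + ∑ xs f

# : (X → Bool) → List X → ℕ
# p xs = ∑ xs (λ x → ⟦ p x ⟧)

infixl 6 _⊕_
infixl 7 _⊗_

_⊕_ : ∀ {a b c d} → a ≤ b → c ≤ d → a + c ≤ b + d
_⊕_ = +-mono-≤

_⊗_ : ∀ c {a b} → a ≤ b → c * a ≤ c * b
c ⊗ p = *-monoʳ-≤ c p

-- A certificate for linear arithmetic: X ≤ Y is a combination of hypotheses
-- and d collects the slack.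
lin : ∀ {a b X Y} d → X ≤ Y → (a + Y) + d ≡ b + X → a ≤ b
lin {a} {b} {X} {Y} d h e = +-cancelʳ-≤ Y a b
  (≤-trans (m≤m+n (a + Y) d) (≤-trans (≤-reflexive e) (+-monoʳ-≤ b h)))

⟦⟧≤1 : ∀ b → ⟦ b ⟧ ≤ 1
⟦⟧≤1 true  = ≤-refl
⟦⟧≤1 false = z≤n

∑-mono : (xs : List X) {f g : X → ℕ} → (∀ {x} → x ∈ xs → f x ≤ g x) → ∑ xs f ≤ ∑ xs g
∑-mono []       h = z≤n
∑-mono (x ∷ xs) h = h (here refl) ⊕ ∑-mono xs (λ z → h (there z))

∑-cong : (xs : List X) {f g : X → ℕ} → (∀ x → f x ≡ g x) → ∑ xs f ≡ ∑ xs g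
∑-cong []       h = refl
∑-cong (x ∷ xs) h = cong₂ _+_ (h x) (∑-cong xs h)

∑-++ : (xs ys : List X) {f : X → ℕ} → ∑ (xs ++ ys) f ≡ ∑ xs f + ∑ ys f
∑-++ []       ys     = refl
∑-++ (x ∷ xs) ys {f} = trans (cong (f x +_) (∑-++ xs ys)) (sym (+-assoc (f x) _ _))

+-interchange : ∀ a b c d → (a + b) + (c + d) ≡ (a + c) + (b + d)
+-interchange = solve-∀

∑-+ : (xs : List X) (f g : X → ℕ) → ∑ xs (λ x → f x + g x) ≡ ∑ xs f + ∑ xs g
∑-+ []       f g = refl
∑-+ (x ∷ xs) f g = trans (cong (f x + g x +_) (∑-+ xs f g)) (+-interchange (f x) (g x) _ _)

∑-* : ∀ c (xs : List X) (f : X → ℕ) → ∑ xs (λ x → c * f x) ≡ c * ∑ xs f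
∑-* c []       f = sym (*-zeroʳ c)
∑-* c (x ∷ xs) f = trans (cong (c * f x +_) (∑-* c xs f)) (sym (*-distribˡ-+ c (f x) _))

∑-*ʳ : ∀ c (xs : List X) (f : X → ℕ) → ∑ xs (λ x → f x * c) ≡ ∑ xs f * c
∑-*ʳ c xs f = trans (∑-cong xs (λ x → *-comm (f x) c)) (trans (∑-* c xs f) (*-comm c _))

∑-const : ∀ c (xs : List X) → ∑ xs (λ _ → c) ≡ length xs * c
∑-const c []       = refl
∑-const c (x ∷ xs) = cong (c +_) (∑-const c xs)

∑-zero : (xs : List X) → ∑ xs (λ _ → 0) ≡ 0
∑-zero xs = trans (∑-const 0 xs) (*-zeroʳ (length xs))

∑-swap : (xs : List X) (ys : List Y) (f : X → Y → ℕ) →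
  ∑ xs (λ x → ∑ ys (f x)) ≡ ∑ ys (λ y → ∑ xs (λ x → f x y))
∑-swap []       ys f = sym (∑-zero ys)
∑-swap (x ∷ xs) ys f = trans (cong (∑ ys (f x) +_) (∑-swap xs ys f)) (sym (∑-+ ys (f x) _))

∑-↭ : {xs ys : List X} {f : X → ℕ} → xs ↭ ys → ∑ xs f ≡ ∑ ys f
∑-↭ Perm.refl = refl
∑-↭ {f = f} (prep x p) = cong (f x +_) (∑-↭ p)
∑-↭ {xs = x ∷ y ∷ xs} {ys = _ ∷ _ ∷ ys} {f = f} (swap x y p) =
  trans (cong (λ z → f x + (f y + z)) (∑-↭ p)) (exch (f x) (f y) (∑ ys f))
  where
  exch : ∀ a b c → a + (b + c) ≡ b + (a + c)
  exch = solve-∀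
∑-↭ (Perm.trans p q) = trans (∑-↭ p) (∑-↭ q)

∑-map : (g : X → Y) (xs : List X) {f : Y → ℕ} → ∑ (map g xs) f ≡ ∑ xs (f ∘ g)
∑-map g []           = refl
∑-map g (x ∷ xs) {f} = cong (f (g x) +_) (∑-map g xs)

∑-product : (xs : List X) (ys : List Y) {f : X × Y → ℕ} →
  ∑ (cartesianProduct xs ys) f ≡ ∑ xs (λ x → ∑ ys (λ y → f (x , y)))
∑-product []       ys     = refl
∑-product (x ∷ xs) ys {f} =
  trans (∑-++ (map (x ,_) ys) _) (cong₂ _+_ (∑-map (x ,_) ys) (∑-product xs ys))

∑-filter : (p : X → Bool) (xs : List X) (f : X → ℕ) →
  ∑ (filterᵇ p xs) f ≡ ∑ xs (λ x → ⟦ p x ⟧ * f x)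
∑-filter p []       f = refl
∑-filter p (x ∷ xs) f with p x
... | true  = cong₂ _+_ (sym (+-identityʳ (f x))) (∑-filter p xs f)
... | false = ∑-filter p xs f

#-filter : (p : X → Bool) (xs : List X) → length (filterᵇ p xs) ≡ # p xs
#-filter p []       = refl
#-filter p (x ∷ xs) with p x
... | true  = cong suc (#-filter p xs)
... | false = #-filter p xs

split-filter : (p : X → Bool) (xs : List X) → xs ↭ filterᵇ p xs ++ filterᵇ (not ∘ p) xs
split-filter p []       = ↭-refl
split-filter p (x ∷ xs) with p x
... | true  = prep x (split-filter p xs)
... | false = ↭-trans (prep x (split-filter p xs)) (↭-sym (shift x (filterᵇ p xs) _))

∈-filter⁻ : (p : X → Bool) (xs : List X) {x : X} → x ∈ filterᵇ p xs → x ∈ xs × p x ≡ true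
∈-filter⁻ p (y ∷ xs) h with p y in eq
∈-filter⁻ p (y ∷ xs) (here refl) | true = here refl , eq
∈-filter⁻ p (y ∷ xs) (there h)   | true = let a , b = ∈-filter⁻ p xs h in there a , b
∈-filter⁻ p (y ∷ xs) h           | false = let a , b = ∈-filter⁻ p xs h in there a , b

∈-filter⁺ : (p : X → Bool) (xs : List X) {x : X} → x ∈ xs → p x ≡ true → x ∈ filterᵇ p xs
∈-filter⁺ p (y ∷ xs) (here refl) e with p y | e
... | true | refl = here refl
∈-filter⁺ p (y ∷ xs) (there h)   e with p y
... | true  = there (∈-filter⁺ p xs h e)
... | false = ∈-filter⁺ p xs h e

not-true : ∀ {b} → not b ≡ true → b ≡ false
not-true {false} _ = refl

∑-split : (p : X → Bool) (xs : List X) (f : X → ℕ) →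
  ∑ xs f ≡ ∑ (filterᵇ p xs) f + ∑ (filterᵇ (not ∘ p) xs) f
∑-split p xs f = trans (∑-↭ (split-filter p xs)) (∑-++ (filterᵇ p xs) _)

length-∑ : (xs : List X) → length xs ≡ ∑ xs (λ _ → 1)
length-∑ xs = sym (trans (∑-const 1 xs) (*-identityʳ _))

length-split : (p : X → Bool) (xs : List X) →
  length xs ≡ length (filterᵇ p xs) + length (filterᵇ (not ∘ p) xs)
length-split p xs = trans (↭-length (split-filter p xs)) (length-++ (filterᵇ p xs))

#≤length : (p : X → Bool) (xs : List X) → # p xs ≤ length xs
#≤length p xs = ≤-trans (∑-mono xs (λ {x} _ → ⟦⟧≤1 (p x))) (≤-reflexive (sym (length-∑ xs)))

∑-≤-const : (xs : List X) {f : X → ℕ} {c : ℕ} → (∀ {x} → x ∈ xs → f x ≤ c) → ∑ xs f ≤ length xs * c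
∑-≤-const xs {c = c} h = ≤-trans (∑-mono xs h) (≤-reflexive (∑-const c xs))

∑-exists : (xs : List X) (f g : X → ℕ) → 0 < length xs → ∑ xs f ≤ ∑ xs g → ∃ λ x → x ∈ xs × f x ≤ g x
∑-exists (x ∷ xs) f g _ h = go x xs h
  where
  go : ∀ x xs → ∑ (x ∷ xs) f ≤ ∑ (x ∷ xs) g → ∃ λ z → z ∈ x ∷ xs × f z ≤ g z
  go x [] h = x , here refl , subst₂ _≤_ (+-identityʳ (f x)) (+-identityʳ (g x)) h
  go x (y ∷ xs) h with f x ≤? g x
  ... | yes p = x , here refl , p
  ... | no ¬p = let z , m , q = go y xs (+-cancelˡ-≤ (g x) _ _ (≤-trans (+-monoˡ-≤ _ (<⇒≤ (≰⇒> ¬p))) h))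
                in z , there m , q

argmax : (f : X → ℕ) (xs : List X) → 0 < length xs → ∃ λ x → x ∈ xs × (∀ {y} → y ∈ xs → f y ≤ f x)
argmax f (x ∷ []) _ = x , here refl , λ { (here refl) → ≤-refl }
argmax f (x ∷ y ∷ xs) _ with argmax f (y ∷ xs) (s≤s z≤n)
... | z , m , q with f z ≤? f x
...   | yes p = x , here refl , λ { (here refl) → ≤-refl ; (there i) → ≤-trans (q i) p }
...   | no ¬p = z , there m , λ { (here refl) → <⇒≤ (≰⇒> ¬p) ; (there i) → q i }

infix 4 _⊑_

-- Inclusion of multisets. The complement is part of the data, since later steps continue with what
-- is left over.
_⊑_ : List X → List X → Set
xs ⊑ ys = ∃ λ zs → ys ↭ xs ++ zs

⊑-trans : {xs ys zs : List X} → xs ⊑ ys → ys ⊑ zs → xs ⊑ zs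
⊑-trans {xs = xs} (us , p) (vs , q) =
  us ++ vs , ↭-trans q (↭-trans (++⁺ʳ vs p) (↭-reflexive (++-assoc xs us vs)))

filter-⊑ : (p : X → Bool) (xs : List X) → filterᵇ p xs ⊑ xs
filter-⊑ p xs = _ , split-filter p xs

∈-⊑ : {xs ys : List X} {x : X} → xs ⊑ ys → x ∈ xs → x ∈ ys
∈-⊑ (_ , p) h = ∈-resp-↭ (↭-sym p) (∈-++⁺ˡ h)

∑-⊑ : {xs ys : List X} {f : X → ℕ} → xs ⊑ ys → ∑ xs f ≤ ∑ ys f
∑-⊑ {xs = xs} {f = f} (zs , p) =
  ≤-trans (m≤m+n (∑ xs f) (∑ zs f)) (≤-reflexive (sym (trans (∑-↭ p) (∑-++ xs zs))))

length-⊑ : {xs ys : List X} → xs ⊑ ys → length xs ≤ length ys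
length-⊑ {xs = xs} {ys} h = subst₂ _≤_ (sym (length-∑ xs)) (sym (length-∑ ys)) (∑-⊑ h)

∈-split : {xs : List X} {x : X} → x ∈ xs → (x ∷ []) ⊑ xs
∈-split {xs = x ∷ xs} (here refl) = xs , ↭-refl
∈-split {xs = y ∷ xs} (there h) with ∈-split h
... | zs , p = y ∷ zs , ↭-trans (prep y p) (swap y _ ↭-refl)

++-⊑-split : (p : X → Bool) {xs us vs : List X} →
  us ⊑ filterᵇ p xs → vs ⊑ filterᵇ (not ∘ p) xs → (us ++ vs) ⊑ xs
++-⊑-split p {xs} {us} {vs} (ws , e) (zs , e′) = ws ++ zs ,
  ↭-trans (split-filter p xs) (↭-trans (++⁺ e e′)
    (↭-trans (↭-reflexive (++-assoc us ws (vs ++ zs)))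
      (↭-trans (++⁺ˡ us (↭-trans (↭-reflexive (sym (++-assoc ws vs zs)))
                 (↭-trans (++⁺ʳ zs (++-comm ws vs)) (↭-reflexive (++-assoc vs ws zs)))))
        (↭-reflexive (sym (++-assoc us vs (ws ++ zs)))))))

-- Heavy chains

pos : ℕ → Bool
pos zero    = false
pos (suc _) = true

≤-pos : ∀ {u U} → u ≤ U → u ≤ ⟦ pos u ⟧ * U
≤-pos {zero}      _ = z≤n
≤-pos {suc u} {U} h = ≤-trans h (≤-reflexive (sym (+-identityʳ U)))

∑-≤-pos : (xs : List X) (u : X → ℕ) (U : ℕ) → (∀ {x} → x ∈ xs → u x ≤ U) → ∑ xs u ≤ # (pos ∘ u) xs * U
∑-≤-pos xs u U h = ≤-trans (∑-mono xs (λ m → ≤-pos (h m))) (≤-reflexive (∑-*ʳ U xs _))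

overflow : ∀ p q l b o → p + q ≤ suc l * b + o → p ≤ b → p + (q ∸ l * b) ≤ b + o
overflow p q l b o h hp with q ≤? l * b
... | yes z = subst (λ t → p + t ≤ b + o) (sym (m≤n⇒m∸n≡0 z)) (subst (_≤ b + o) (sym (+-identityʳ p)) (≤-trans hp (m≤m+n b o)))
... | no ¬z = +-cancelʳ-≤ (l * b) _ _ (subst₂ _≤_
      (trans (cong (p +_) (sym (m∸n+n≡m (<⇒≤ (≰⇒> ¬z))))) (sym (+-assoc p _ _)))
      (arr b (l * b) o) h)
  where
  arr : ∀ b c o → b + c + o ≡ b + o + c
  arr = solve-∀

-- The same for two chain vertices at once, with weights counted in halves of the maximum: `q` of
-- the `p` charged vertices may weigh two halves, the others one, and the overflow two.
overflow₂ : ∀ p c q l b σ → p + c ≤ suc l * b + σ → p ≤ 2 * b → q ≤ b → q ≤ p →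
  p + q + 2 * (c ∸ l * b) ≤ 3 * b + 2 * σ
overflow₂ p c q l b σ h hp hq hqp with c ≤? l * b
... | yes z = subst (λ t → p + q + 2 * t ≤ 3 * b + 2 * σ) (sym (m≤n⇒m∸n≡0 z))
      (lin (2 * σ) (hp ⊕ hq) (solve (p ∷ q ∷ b ∷ σ ∷ [])))
... | no ¬z = go (c ∸ l * b) (l * b) (m∸n+n≡m (<⇒≤ (≰⇒> ¬z))) h
  where
  go : ∀ o e → o + e ≡ c → p + c ≤ b + e + σ → p + q + 2 * o ≤ 3 * b + 2 * σ
  go o e refl h = lin b (2 ⊗ h ⊕ hqp) (solve (p ∷ q ∷ b ∷ σ ∷ o ∷ e ∷ []))

nine : ∀ l → 9 ≤ 10 ^ suc l
nine l = ≤-trans (m≤m+n 9 1) (*-monoʳ-≤ 10 (m^n>0 10 l))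

∨-trueʳ : ∀ {a b} → b ≡ true → a ∨ b ≡ true
∨-trueʳ {true}  _ = refl
∨-trueʳ {false} e = e

∨-trueˡ : ∀ {a b} → a ≡ true → a ∨ b ≡ true
∨-trueˡ refl = refl

∧-true : ∀ {a b} → a ∧ b ≡ true → a ≡ true × b ≡ true
∧-true {true} e = refl , e

∨-false : ∀ {a b} → a ∨ b ≡ false → a ≡ false × b ≡ false
∨-false {false} e = refl , e

⟦∨⟧ : ∀ a b → ⟦ a ∨ b ⟧ ≤ ⟦ a ⟧ + ⟦ b ⟧
⟦∨⟧ true  b = s≤s z≤n
⟦∨⟧ false b = ≤-refl

two-⊑ : {xs : List X} {x y : X} → x ≢ y → x ∈ xs → y ∈ xs → (x ∷ y ∷ []) ⊑ xs
two-⊑ {x = x} x≢y x∈ y∈ with ∈-split x∈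
... | zs , p with ∈-resp-↭ p y∈
...   | here e  = ⊥-elim (x≢y (sym e))
...   | there m = let ws , q = ∈-split m in ws , ↭-trans p (prep x q)

true⇒T : ∀ {b} → b ≡ true → T b
true⇒T refl = tt

T⇒true : ∀ {b} → T b → b ≡ true
T⇒true {true} _ = refl

≤ᵇ-true : ∀ {m n} → m ≤ n → (m ≤ᵇ n) ≡ true
≤ᵇ-true h = T⇒true (≤⇒≤ᵇ h)

greedy-step : ∀ b sB sC pB u₁ t o o′ U →
  sB ≤ pB * u₁ → sC ≤ b * t + o′ * u₁ → pB + o′ ≤ b + o → u₁ ≤ U →
  sB + sC ≤ b * (u₁ + t) + o * U
greedy-step b sB sC pB u₁ t o o′ U h₁ h₂ h₃ h₄ =
  lin 0 (h₁ ⊕ h₂ ⊕ u₁ ⊗ h₃ ⊕ o ⊗ h₄)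
    (solve (sB ∷ sC ∷ pB ∷ u₁ ∷ t ∷ o ∷ o′ ∷ U ∷ b ∷ []))

gain-base : ∀ b s p w σ g → s ≤ p * w → p ≤ σ → g ≤ σ → 9 * σ ≤ b → 8 * s + g * w ≤ 8 * (b * (w + 0))
gain-base b s p w σ g h₁ h₂ h₃ h₄ =
  lin (7 * (b * w)) (8 ⊗ h₁ ⊕ (8 * w) ⊗ h₂ ⊕ w ⊗ h₃ ⊕ w ⊗ h₄) (solve (s ∷ p ∷ w ∷ σ ∷ g ∷ b ∷ []))

-- At least `9 * σ` of the `b` places are not taken by heavy vertices, and each saves an eighth of
-- `w`. Eight ninths of this pay for the overflow `σ * w`, the last ninth is the gain.
gain-light : ∀ b sB sC lB h w t σ g → 8 * sB ≤ (7 * lB + h) * w → sC ≤ b * t + σ * w → g ≤ σ →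
  lB ≤ b → h + 9 * σ ≤ b → 8 * (sB + sC) + g * w ≤ 8 * (b * (w + t))
gain-light b sB sC lB h w t σ g h₁ h₂ h₃ h₄ h₅ =
  lin 0 (h₁ ⊕ 8 ⊗ h₂ ⊕ w ⊗ h₃ ⊕ (7 * w) ⊗ h₄ ⊕ w ⊗ h₅)
    (solve (sB ∷ sC ∷ lB ∷ h ∷ w ∷ t ∷ σ ∷ g ∷ b ∷ []))

-- In halves of `w`, the two chosen vertices weigh at least 7/2 together, but at most
-- `3 * b + 2 * σ` halves are charged to them and to the overflow; half a unit for each of `b`
-- places is left over.
gain-pair : ∀ b sD sC p q o w x y t σ g → 2 * sD ≤ (p + q) * w → sC ≤ b * t + o * w →
  p + q + 2 * o ≤ 3 * b + 2 * σ → 7 * w ≤ 8 * x → 7 * w ≤ 8 * y → 9 * σ ≤ b → g ≤ σ →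
  8 * (sD + sC) + g * w ≤ 8 * (b * (x + (y + t)))
gain-pair b sD sC p q o w x y t σ g h₁ h₂ h₃ h₄ h₅ h₆ h₇ =
  lin (w * b) (4 ⊗ h₁ ⊕ 8 ⊗ h₂ ⊕ (4 * w) ⊗ h₃ ⊕ b ⊗ h₄ ⊕ b ⊗ h₅ ⊕ w ⊗ h₆ ⊕ w ⊗ h₇)
    (solve (sD ∷ sC ∷ p ∷ q ∷ o ∷ w ∷ x ∷ y ∷ t ∷ σ ∷ g ∷ b ∷ []))

-- The gain is measured by the largest weight of the current set, which may halve on passing to the
-- rest; demanding `2 * g` there compensates.
gain-rec : ∀ b sB sC w u₂ t g → sB ≤ b * w → 8 * sC + (2 * g) * u₂ ≤ 8 * (b * t) → w ≤ 2 * u₂ →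
  8 * (sB + sC) + g * w ≤ 8 * (b * (w + t))
gain-rec b sB sC w u₂ t g h₁ h₂ h₃ =
  lin 0 (8 ⊗ h₁ ⊕ h₂ ⊕ g ⊗ h₃) (solve (sB ∷ sC ∷ w ∷ u₂ ∷ t ∷ g ∷ b ∷ []))

-- Removing a set in which only `9 * σ` of `b` places lack positive weight turns the excess `σ` into
-- at most `10 * σ`. This is the origin of the powers of 10.
rec-size : ∀ b pB pC l h σ → pB + pC ≤ suc l * b + σ → h ≤ pB → b ≤ h + 9 * σ → pC ≤ l * b + 10 * σ
rec-size b pB pC l h σ = go (l * b)
  where
  go : ∀ e → pB + pC ≤ b + e + σ → h ≤ pB → b ≤ h + 9 * σ → pC ≤ e + 10 * σ
  go e h₁ h₂ h₃ = lin 0 (h₁ ⊕ h₂ ⊕ h₃) (solve (pB ∷ pC ∷ e ∷ h ∷ σ ∷ b ∷ []))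

-- Replacing `r * b` by `m` costs at most `g * t / 8`, and `t ≤ r * uv`, so the gain `g * uv / 8`,
-- taken `r` times, covers the cost. The constant part `a` of the weight is met exactly, by `r`
-- vertices of weight at least `a`.
robust-arith : ∀ b r m W hu a g uv t Tw → W ≤ hu + m * a → 8 * hu + g * uv ≤ 8 * (b * t) → t ≤ r * uv →
  8 * (r * b) ≤ 8 * m + g → t + r * a ≤ Tw → r * W ≤ m * Tw
robust-arith b r m W hu a g uv t Tw h₁ h₂ h₃ h₄ h₅ = *-cancelˡ-≤ 8
  (lin 0 ((8 * r) ⊗ h₁ ⊕ r ⊗ h₂ ⊕ g ⊗ h₃ ⊕ t ⊗ h₄ ⊕ (8 * m) ⊗ h₅)
    (solve (r ∷ m ∷ W ∷ hu ∷ a ∷ g ∷ uv ∷ t ∷ Tw ∷ b ∷ [])))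

module Chains {V : Set} (N : V × Bool → V → Bool) where

  M : V → V → Bool
  M x y = N (x , true) y ∨ N (x , false) y

  M⇒N : ∀ {x y} → M x y ≡ true → ∃ λ τ → N (x , τ) y ≡ true
  M⇒N {x} {y} e with N (x , true) y in eq
  ... | true  = true , eq
  ... | false = false , e

  data Chain : List V → Set where
    nil  : Chain []
    cons : ∀ {v xs} τ → All (λ y → N (v , τ) y ≡ true) xs → Chain xs → Chain (v ∷ xs)

  -- S i contains the vertices that may not follow the typed vertex i in a chain.
  module Greedy (S : V × Bool → V → Bool)
    (S-self : ∀ v τ → S (v , τ) v ≡ true)
    (S-compl : ∀ i y → S i y ≡ false → N i y ≡ true)
    (N-irr : ∀ v τ → N (v , τ) v ≡ false) where

    dominated : ∀ i (C : List V) {T : List V} → T ⊑ filterᵇ (not ∘ S i) C → All (λ y → N i y ≡ true) T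
    dominated i C T⊑ = All.tabulate λ {y} m →
      S-compl i y (not-true (proj₂ (∈-filter⁻ (not ∘ S i) C (∈-⊑ T⊑ m))))

    extend : ∀ v (C : List V) {T : List V} → v ∈ C → T ⊑ filterᵇ (not ∘ S (v , true)) C → Chain T →
      Chain (v ∷ T) × (v ∷ T) ⊑ C
    extend v C v∈ T⊑ ch = cons true (dominated (v , true) C T⊑) ch ,
      ++-⊑-split (S (v , true)) (∈-split (∈-filter⁺ _ C v∈ (S-self v true))) T⊑

    module _ (R : List V) (b : ℕ) (hb : ∀ v τ → v ∈ R → # (S (v , τ)) R ≤ b) where

      hb′ : ∀ {v C} τ → C ⊑ R → v ∈ C → # (S (v , τ)) C ≤ b
      hb′ τ C⊑ v∈ = ≤-trans (∑-⊑ C⊑) (hb _ τ (∈-⊑ C⊑ v∈))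

      -- The heaviest vertex `v` is taken first, so the at most `b` vertices that it excludes weigh
      -- at most `b * u v`. Vertices of positive weight in excess of `l * b` cost at most `U` each.
      -- The condition on the length keeps the set nonempty until the last choice, even when all
      -- weights are zero.
      greedy : (u : V → ℕ) → ∀ l o U (C : List V) → C ⊑ R → l * b < length C + b →
        (∀ {x} → x ∈ C → u x ≤ U) → # (pos ∘ u) C ≤ l * b + o →
        ∃ λ T → length T ≡ l × Chain T × T ⊑ C × ∑ C u ≤ b * ∑ T u + o * U
      greedy u zero o U C C⊑ len hU hP = [] , refl , nil , (C , ↭-refl) ,
        ≤-trans (∑-≤-pos C u U hU) (≤-trans (*-monoˡ-≤ U hP) (m≤n+m (o * U) (b * 0)))
      greedy u (suc l) o U C C⊑ len hU hP
        with argmax u C (≤-<-trans z≤n (+-cancelˡ-< b (l * b) (length C) (subst (b + l * b <_) (+-comm (length C) b) len)))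
      ... | v , v∈ , vmax =
        let i = (v , true)
            B = filterᵇ (S i) C
            C′ = filterᵇ (not ∘ S i) C
            P = pos ∘ u
            lb<C = +-cancelˡ-< b (l * b) (length C) (subst (b + l * b <_) (+-comm (length C) b) len)
            B≤b : length B ≤ b
            B≤b = ≤-trans (≤-reflexive (#-filter (S i) C)) (hb′ true C⊑ v∈)
            C≤ : length C ≤ length C′ + b
            C≤ = ≤-trans (≤-reflexive (trans (length-split (S i) C) (+-comm (length B) _))) (+-monoʳ-≤ (length C′) B≤b)
            o′ = # P C′ ∸ l * b
            hC′ : ∀ {x} → x ∈ C′ → u x ≤ u v
            hC′ m = vmax (proj₁ (∈-filter⁻ _ C m))
            hB : ∀ {x} → x ∈ B → u x ≤ u v
            hB m = vmax (proj₁ (∈-filter⁻ _ C m))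
            T , lenT , chT , T⊑ , sT = greedy u l o′ (u v) C′ (⊑-trans (filter-⊑ _ C) C⊑)
              (<-≤-trans lb<C C≤) hC′ (m≤n+m∸n (# P C′) (l * b))
            chvT , vT⊑ = extend v C v∈ T⊑ chT
        in v ∷ T , cong suc lenT , chvT , vT⊑ ,
           ≤-trans (≤-reflexive (∑-split (S i) C u))
             (greedy-step b (∑ B u) (∑ C′ u) (# P B) (u v) (∑ T u) o o′ U
               (∑-≤-pos B u (u v) hB) sT
               (overflow (# P B) (# P C′) l b o (subst (_≤ suc l * b + o) (∑-split (S i) C _) hP)
                 (≤-trans (#≤length P B) B≤b))
               (hU v∈))

      -- The greedy bound improved by `g / 8` times the weight of `v`, which is always the heaviest
      -- vertex of `C`.
      Gain : (V → ℕ) → ℕ → ℕ → List V → V → Set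
      Gain u l g C v = ∃ λ T → length T ≡ l × Chain T × T ⊑ C × 8 * ∑ C u + g * u v ≤ 8 * (b * ∑ T u)

      module _ (τ : ℕ) (τ≤b : τ ≤ b)
        (pairs : ∀ v → v ∈ R → (B : List V) → B ⊑ R → (∀ {x} → x ∈ B → S (v , true) x ≡ true) →
          b ≤ length B + τ → ∃ λ x → ∃ λ y → x ∈ B × y ∈ B × M x y ≡ true)
        (u : V → ℕ) where

        P : V → Bool
        P = pos ∘ u

        -- A chain of `l + 2` vertices is sought where hardly more than `suc l * b` vertices have
        -- positive weight. The chain thus has about one vertex to spare, which leaves room for a
        -- gain.
        module Step (l σ g : ℕ) (C : List V) (C⊑ : C ⊑ R) (len : suc l * b < length C) (g≤ : g ≤ σ)
          (σ≤ : 10 ^ suc (suc l) * σ ≤ τ) (hP : # P C ≤ suc l * b + σ)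
          (v : V) (v∈ : v ∈ C) (vmax : ∀ {x} → x ∈ C → u x ≤ u v) where

          i : V × Bool
          i = (v , true)

          B C′ B* : List V
          heavy : V → Bool
          heavy x = P x ∧ (7 * u v ≤ᵇ 8 * u x)
          B  = filterᵇ (S i) C
          C′ = filterᵇ (not ∘ S i) C
          B* = filterᵇ heavy B

          9σ≤τ : 9 * σ ≤ τ
          9σ≤τ = ≤-trans (*-monoˡ-≤ σ (nine (suc l))) σ≤

          9σ≤b : 9 * σ ≤ b
          9σ≤b = ≤-trans 9σ≤τ τ≤b

          B≤b : length B ≤ b
          B≤b = ≤-trans (≤-reflexive (#-filter (S i) C)) (hb′ true C⊑ v∈)

          C≤ : length C ≤ b + length C′
          C≤ = ≤-trans (≤-reflexive (length-split (S i) C)) (+-monoˡ-≤ (length C′) B≤b)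

          lenC′ : l * b < length C′
          lenC′ = +-cancelˡ-< b _ _ (<-≤-trans len C≤)

          ∈C′ : ∀ {x} → x ∈ C′ → x ∈ C
          ∈C′ = proj₁ ∘ ∈-filter⁻ _ C

          C′⊑ : C′ ⊑ R
          C′⊑ = ⊑-trans (filter-⊑ _ C) C⊑

          ∈B : ∀ {x} → x ∈ B → x ∈ C
          ∈B = proj₁ ∘ ∈-filter⁻ _ C

          PBC : # P B + # P C′ ≤ suc l * b + σ
          PBC = subst (_≤ suc l * b + σ) (∑-split (S i) C _) hP

          eqC : 8 * ∑ C u + g * u v ≡ 8 * (∑ B u + ∑ C′ u) + g * u v
          eqC = cong (λ z → 8 * z + g * u v) (∑-split (S i) C u)

          heavy-bound : ∀ {x} → x ∈ B → 8 * u x ≤ (7 + ⟦ heavy x ⟧) * u v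
          heavy-bound {x} m with u x | vmax (∈B m)
          ... | zero   | _ = z≤n
          ... | suc ux | h with 7 * u v ≤ᵇ 8 * suc ux in eq
          ...   | true  = *-monoʳ-≤ 8 h
          ...   | false = <⇒≤ (≰⇒> (λ z → case-false (trans (sym (≤ᵇ-true z)) eq)))
            where
            case-false : true ≡ false → ⊥
            case-false ()

          light : length B* + 9 * σ ≤ b → Gain u (suc (suc l)) g C v
          light few =
            let T , lenT , chT , T⊑ , sT = greedy u (suc l) σ (u v) C′ C′⊑
                  (subst (suc l * b <_) (+-comm b _) (<-≤-trans len C≤))
                  (λ m → vmax (∈C′ m)) (≤-trans (m≤n+m (# P C′) (# P B)) PBC)
                ch , vT⊑ = extend v C v∈ T⊑ chT
                sB : 8 * ∑ B u ≤ (7 * length B + length B*) * u v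
                sB = ≤-trans (≤-reflexive (sym (∑-* 8 B u))) (≤-trans (∑-mono B heavy-bound)
                  (≤-reflexive (trans (∑-*ʳ (u v) B _) (cong (_* u v)
                    (trans (∑-+ B _ _) (cong₂ _+_ (trans (∑-const 7 B) (*-comm (length B) 7)) (sym (#-filter heavy B))))))))
            in v ∷ T , cong suc lenT , ch , vT⊑ ,
               ≤-trans (≤-reflexive eqC)
                 (gain-light b (∑ B u) (∑ C′ u) (length B) (length B*) (u v) (∑ T u) σ g sB sT g≤ B≤b few)

          -- The chain avoids starting with `v`. A vertex outside `S i` weighs at most half as much
          -- as `v`, so `v` and a successor bring at most 3/2 of `u v`, whereas `x` and `y`, both in
          -- `S i` and heavy, bring at least 7/4. The type `κ` is whichever one puts `y` after `x`.
          module Pair (v₂max : ∀ {z} → z ∈ C′ → 2 * u z ≤ u v) (x y : V) (x∈* : x ∈ B*) (y∈* : y ∈ B*)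
            (κ : Bool) (Nxy : N (x , κ) y ≡ true) where

            x∈ : x ∈ C
            x∈ = ∈B (proj₁ (∈-filter⁻ heavy B x∈*))

            y∈ : y ∈ C
            y∈ = ∈B (proj₁ (∈-filter⁻ heavy B y∈*))

            p : V → Bool
            p z = S (x , κ) z ∨ S (y , true) z

            D C″ : List V
            D  = filterᵇ p C
            C″ = filterᵇ (not ∘ p) C

            x≢y : x ≢ y
            x≢y refl with trans (sym Nxy) (N-irr x κ)
            ... | ()

            D≤ : length D ≤ 2 * b
            D≤ = ≤-trans (≤-reflexive (#-filter p C)) (≤-trans (∑-mono C (λ {z} _ → ⟦∨⟧ (S (x , κ) z) _))
              (≤-trans (≤-reflexive (∑-+ C _ _))
                (≤-trans (hb′ κ C⊑ x∈ ⊕ hb′ true C⊑ y∈) (≤-reflexive (cong (b +_) (sym (+-identityʳ b)))))))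

            C≤″ : length C ≤ 2 * b + length C″
            C≤″ = ≤-trans (≤-reflexive (length-split p C)) (+-monoˡ-≤ (length C″) D≤)

            lenC″ : l * b < length C″ + b
            lenC″ = +-cancelˡ-< b _ _ (<-≤-trans len (≤-trans C≤″ (≤-reflexive (arr b (length C″)))))
              where
              arr : ∀ b c → 2 * b + c ≡ b + (c + b)
              arr = solve-∀

            q : V → Bool
            q z = S i z ∧ P z

            pointwise : ∀ {z} → z ∈ D → 2 * u z ≤ (⟦ P z ⟧ + ⟦ q z ⟧) * u v
            pointwise {z} m with u z | vmax {z} (proj₁ (∈-filter⁻ p C m)) | v₂max {z}
            ... | zero   | _ | _ = z≤n
            ... | suc uz | h | h₂ with S i z in eq
            ...   | true  = *-monoʳ-≤ 2 h
            ...   | false = ≤-trans (h₂ (∈-filter⁺ _ C (proj₁ (∈-filter⁻ p C m)) (cong not eq)))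
                              (≤-reflexive (sym (+-identityʳ (u v))))

            q≤p : ∀ z → ⟦ q z ⟧ ≤ ⟦ P z ⟧
            q≤p z with S i z
            ... | true  = ≤-refl
            ... | false = z≤n

            q≤S : ∀ z → ⟦ q z ⟧ ≤ ⟦ S i z ⟧
            q≤S z with S i z
            ... | true  = ⟦⟧≤1 (P z)
            ... | false = z≤n

            heavy-≥ : ∀ {z} → z ∈ B* → 7 * u v ≤ 8 * u z
            heavy-≥ m = ≤ᵇ⇒≤ _ _ (true⇒T (proj₂ (∧-true (proj₂ (∈-filter⁻ heavy B m)))))

            pair : Gain u (suc (suc l)) g C v
            pair =
              let o = # P C″ ∸ l * b
                  T , lenT , chT , T⊑ , sT = greedy u l o (u v) C″ (⊑-trans (filter-⊑ _ C) C⊑) lenC″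
                    (λ m → vmax (proj₁ (∈-filter⁻ _ C m))) (m≤n+m∸n (# P C″) (l * b))
                  out : ∀ {z} → z ∈ T → S (x , κ) z ≡ false × S (y , true) z ≡ false
                  out m = ∨-false (not-true (proj₂ (∈-filter⁻ (not ∘ p) C (∈-⊑ T⊑ m))))
                  ch = cons κ (Nxy All.∷ All.tabulate (λ m → S-compl _ _ (proj₁ (out m))))
                         (cons true (All.tabulate (λ m → S-compl _ _ (proj₂ (out m)))) chT)
                  sub = ++-⊑-split p (two-⊑ x≢y
                          (∈-filter⁺ p C x∈ (∨-trueˡ (S-self x κ)))
                          (∈-filter⁺ p C y∈ (∨-trueʳ {S (x , κ) y} (S-self y true)))) T⊑
                  sD : 2 * ∑ D u ≤ (# P D + # q D) * u v
                  sD = ≤-trans (≤-reflexive (sym (∑-* 2 D u))) (≤-trans (∑-mono D pointwise)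
                         (≤-reflexive (trans (∑-*ʳ (u v) D _) (cong (_* u v) (∑-+ D _ _)))))
                  counts = overflow₂ (# P D) (# P C″) (# q D) l b σ
                    (subst (_≤ suc l * b + σ) (∑-split p C _) hP)
                    (≤-trans (#≤length P D) D≤)
                    (≤-trans (∑-mono D (λ {z} _ → q≤S z)) (≤-trans (∑-⊑ (filter-⊑ p C)) (hb′ true C⊑ v∈)))
                    (∑-mono D (λ {z} _ → q≤p z))
              in x ∷ y ∷ T , cong (2 +_) lenT , ch , sub ,
                 ≤-trans (≤-reflexive (cong (λ z → 8 * z + g * u v) (∑-split p C u)))
                   (gain-pair b (∑ D u) (∑ C″ u) (# P D) (# q D) o (u v) (u x) (u y) (∑ T u) σ g
                     sD sT counts (heavy-≥ x∈*) (heavy-≥ y∈*) 9σ≤b g≤)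

          recurse : ∀ v₂ → b ≤ length B* + 9 * σ → u v ≤ 2 * u v₂ → Gain u (suc l) (2 * g) C′ v₂ → Gain u (suc (suc l)) g C v
          recurse v₂ many hv₂ (T , lenT , chT , T⊑ , sT) =
            let ch , vT⊑ = extend v C v∈ T⊑ chT
                sB : ∑ B u ≤ b * u v
                sB = ≤-trans (∑-≤-const B (λ m → vmax (∈B m))) (*-monoˡ-≤ (u v) B≤b)
            in v ∷ T , cong suc lenT , ch , vT⊑ ,
               ≤-trans (≤-reflexive eqC) (gain-rec b (∑ B u) (∑ C′ u) (u v) (u v₂) (∑ T u) g sB sT hv₂)

          B*≤PB : length B* ≤ # P B
          B*≤PB = ≤-trans (≤-reflexive (#-filter heavy B)) (∑-mono B (λ {z} _ → le z))
            where
            le : ∀ z → ⟦ heavy z ⟧ ≤ ⟦ P z ⟧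
            le z with P z
            ... | true  = ⟦⟧≤1 (7 * u v ≤ᵇ 8 * u z)
            ... | false = z≤n

        -- If the heavy part of S v ∩ C is small, or if it spans a pair of M while
        -- everything outside S v is at most half as heavy as v, then a chain beats
        -- the greedy bound; otherwise the problem is passed on to C ∖ S v.
        gain : ∀ l σ g (C : List V) → C ⊑ R → l * b < length C → g ≤ σ → 10 ^ suc l * σ ≤ τ →
          # P C ≤ l * b + σ → ∀ v → v ∈ C → (∀ {x} → x ∈ C → u x ≤ u v) → Gain u (suc l) g C v
        gain zero σ g C C⊑ len g≤ σ≤ hP v v∈ vmax =
          v ∷ [] , refl , cons true All.[] nil , ∈-split v∈ ,
          gain-base b (∑ C u) (# P C) (u v) σ g (∑-≤-pos C u (u v) vmax) hP g≤
            (≤-trans (*-monoˡ-≤ σ (nine 0)) (≤-trans σ≤ τ≤b))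
        gain (suc l) σ g C C⊑ len g≤ σ≤ hP v v∈ vmax = decide
          where
          open Step l σ g C C⊑ len g≤ σ≤ hP v v∈ vmax
          decide : Gain u (suc (suc l)) g C v
          decide with length B* + 9 * σ ≤? b
          ... | yes few = light few
          ... | no ¬few with argmax u C′ (≤-<-trans z≤n lenC′)
          ...   | v₂ , v₂∈ , v₂max with 2 * u v₂ ≤? u v
          ...     | yes half =
            let x , y , x∈ , y∈ , Mxy = pairs v (∈-⊑ C⊑ v∈) B*
                  (⊑-trans (filter-⊑ heavy B) (⊑-trans (filter-⊑ (S i) C) C⊑))
                  (λ m → proj₂ (∈-filter⁻ (S i) C (proj₁ (∈-filter⁻ heavy B m))))
                  (≤-trans (<⇒≤ (≰⇒> ¬few)) (+-monoʳ-≤ (length B*) 9σ≤τ))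
                κ , Nxy = M⇒N Mxy
            in Pair.pair (λ m → ≤-trans (*-monoʳ-≤ 2 (v₂max m)) half) x y x∈ y∈ κ Nxy
          ...     | no ¬half = recurse v₂ (<⇒≤ (≰⇒> ¬few)) (<⇒≤ (≰⇒> ¬half))
            (gain l (10 * σ) (2 * g) C′ C′⊑ lenC′
              (≤-trans (*-monoʳ-≤ 2 g≤) (*-monoˡ-≤ σ (m≤m+n 2 8)))
              (≤-trans (≤-reflexive (arr (10 ^ suc l) σ)) σ≤)
              (rec-size b (# P B) (# P C′) l (length B*) σ PBC B*≤PB (<⇒≤ (≰⇒> ¬few))) v₂ v₂∈ v₂max)
            where
            arr : ∀ a s → a * (10 * s) ≡ 10 * a * s
            arr = solve-∀

      module _ (w : V → ℕ) where

        -- The threshold rises until at most `c` weights exceed it. More than `c` vertices still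
        -- reach it, so a chain can be sought among them, and only the part of the weight above `a`
        -- has to be fought for.
        level : ∀ fuel a c → (∀ {x} → x ∈ R → w x ≤ a + fuel) → c < # (λ x → a ≤ᵇ w x) R →
          ∃ λ a → c < # (λ x → a ≤ᵇ w x) R × # (λ x → pos (w x ∸ a)) R ≤ c
        level zero a c top big = a , big , ≤-trans
          (∑-mono R {g = λ _ → 0} (λ {x} m → ≤-reflexive (cong (⟦_⟧ ∘ pos)
            (m≤n⇒m∸n≡0 (subst (w x ≤_) (+-identityʳ a) (top m))))))
          (≤-trans (≤-reflexive (∑-zero R)) z≤n)
        level (suc fuel) a c top big with # (λ x → pos (w x ∸ a)) R ≤? c
        ... | yes small = a , big , small
        ... | no ¬small = level fuel (suc a) c (λ {x} m → subst (w x ≤_) (+-suc a fuel) (top m))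
              (<-≤-trans (≰⇒> ¬small) (∑-mono R (λ {x} _ → up x)))
          where
          up : ∀ x → ⟦ pos (w x ∸ a) ⟧ ≤ ⟦ suc a ≤ᵇ w x ⟧
          up x with suc a ≤ᵇ w x in eq
          ... | true  = ⟦⟧≤1 (pos (w x ∸ a))
          ... | false with suc a ≤? w x
          ...   | yes h with trans (sym (≤ᵇ-true h)) eq
          ...     | ()
          up x | false | no ¬h = ≤-reflexive (cong (⟦_⟧ ∘ pos) (m≤n⇒m∸n≡0 (≮⇒≥ ¬h)))

        ≤-cut : ∀ a x → w x ≤ ⟦ a ≤ᵇ w x ⟧ * (w x ∸ a) + a
        ≤-cut a x with a ≤ᵇ w x in eq
        ... | true  = ≤-reflexive (sym (trans (cong (_+ a) (+-identityʳ _)) (m∸n+n≡m (≤ᵇ⇒≤ a (w x) (true⇒T eq)))))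
        ... | false with a ≤? w x
        ...   | no ¬h = <⇒≤ (≰⇒> ¬h)
        ...   | yes h with trans (sym (≤ᵇ-true h)) eq
        ...     | ()

        module Level (a : ℕ) where

          u : V → ℕ
          u x = w x ∸ a

          H : List V
          H = filterᵇ (λ x → a ≤ᵇ w x) R

          H⊑ : H ⊑ R
          H⊑ = filter-⊑ (λ x → a ≤ᵇ w x) R

          weight-above : ∑ R w ≤ ∑ H u + length R * a
          weight-above = ≤-trans (∑-mono R (λ {x} _ → ≤-cut a x)) (≤-reflexive
            (trans (∑-+ R (λ x → ⟦ a ≤ᵇ w x ⟧ * u x) (λ _ → a))
              (cong₂ _+_ (sym (∑-filter (λ x → a ≤ᵇ w x) R u)) (∑-const a R))))

          weight-chain : ∀ {T} → T ⊑ H → ∑ T u + length T * a ≤ ∑ T w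
          weight-chain {T} T⊑ = ≤-trans (≤-reflexive (trans (cong (∑ T u +_) (sym (∑-const a T))) (sym (∑-+ T u (λ _ → a)))))
            (∑-mono T (λ {x} m → ≤-reflexive (m∸n+n≡m (≤ᵇ⇒≤ a (w x) (true⇒T (proj₂ (∈-filter⁻ _ R (∈-⊑ T⊑ m))))))))

          conclude : ∀ {l g v} → (∀ {x} → x ∈ H → u x ≤ u v) → 8 * (suc l * b) ≤ 8 * length R + g → Gain u (suc l) g H v →
            ∃ λ T → length T ≡ suc l × Chain T × T ⊑ R × suc l * ∑ R w ≤ length R * ∑ T w
          conclude {l} {g} {v} vmax 8rb (T , lenT , chT , T⊑ , sT) = T , lenT , chT , ⊑-trans T⊑ H⊑ ,
            robust-arith b (suc l) (length R) (∑ R w) (∑ H u) a g (u v) (∑ T u) (∑ T w) weight-above sT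
              (subst (λ z → ∑ T u ≤ z * u v) lenT (∑-≤-const T (λ m → vmax (∈-⊑ T⊑ m)))) 8rb
              (subst (λ z → ∑ T u + z * a ≤ ∑ T w) lenT (weight-chain T⊑))

        -- With the threshold at `c = l * b`, at most `l * b` vertices of `H` have positive
        -- remaining weight, while the chain has `suc l` vertices. This surplus vertex is what
        -- `gain` needs.
        robust-chain : ∀ l τ g → τ ≤ b →
          (∀ v → v ∈ R → (B : List V) → B ⊑ R → (∀ {x} → x ∈ B → S (v , true) x ≡ true) →
            b ≤ length B + τ → ∃ λ x → ∃ λ y → x ∈ B × y ∈ B × M x y ≡ true) →
          10 ^ suc l * g ≤ τ → l * b < length R → 8 * (suc l * b) ≤ 8 * length R + g →
          ∃ λ T → length T ≡ suc l × Chain T × T ⊑ R × suc l * ∑ R w ≤ length R * ∑ T w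
        robust-chain l τ g τ≤b pairs Xg≤τ len 8rb = from-top (argmax w R (≤-<-trans z≤n len))
          where
          Goal : Set
          Goal = ∃ λ T → length T ≡ suc l × Chain T × T ⊑ R × suc l * ∑ R w ≤ length R * ∑ T w

          from-level : (∃ λ a → l * b < # (λ x → a ≤ᵇ w x) R × # (λ x → pos (w x ∸ a)) R ≤ l * b) → Goal
          from-level (a , big , small) = from-max (argmax u H (≤-<-trans z≤n lenH))
            where
            open Level a
            lenH : l * b < length H
            lenH = <-≤-trans big (≤-reflexive (sym (#-filter (λ x → a ≤ᵇ w x) R)))
            from-max : (∃ λ v → v ∈ H × (∀ {x} → x ∈ H → u x ≤ u v)) → Goal
            from-max (v , v∈ , vmax) = conclude vmax 8rb (gain τ τ≤b pairs u l g g H H⊑ lenH ≤-refl Xg≤τ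
              (≤-trans (∑-⊑ H⊑) (≤-trans small (m≤m+n (l * b) g))) v v∈ vmax)

          from-top : (∃ λ x → x ∈ R × (∀ {y} → y ∈ R → w y ≤ w x)) → Goal
          from-top (top , _ , topmax) = from-level (level (w top) 0 (l * b) topmax (<-≤-trans len (≤-reflexive (length-∑ R))))

-- Proportional covering

-- The square of `d + p - q` expanded, without its term `-2pq`. Truncation at zero does no harm: if
-- `q` exceeds `d + p`, then `d * d + q * q` already dominates `2 * (d * q)`.
sq-step : ∀ {d′ d p q} → d′ ≤ (d + p) ∸ q → d′ * d′ + 2 * (d * q) ≤ d * d + 2 * (d * p) + (p * p + q * q)
sq-step {d′} {d} {p} {q} h with q ≤? d + p
... | yes z = ≤-trans (+-monoˡ-≤ _ (*-mono-≤ h h)) (go ((d + p) ∸ q) (m∸n+n≡m z))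
  where
  go : ∀ e → e + q ≡ d + p → e * e + 2 * (d * q) ≤ d * d + 2 * (d * p) + (p * p + q * q)
  go e eq = lin (2 * (q * p))
    (*-mono-≤ (≤-reflexive eq) (≤-reflexive eq) ⊕ 2 ⊗ (q ⊗ ≤-reflexive (sym eq)))
    (solve (e ∷ d ∷ p ∷ q ∷ []))
... | no ¬z = ≤-trans (+-monoˡ-≤ _ (*-mono-≤ d′≤0 d′≤0)) (go (q ∸ d) (m∸n+n≡m (≤-trans (m≤m+n d p) (<⇒≤ (≰⇒> ¬z)))))
  where
  d′≤0 : d′ ≤ 0
  d′≤0 = ≤-trans h (≤-reflexive (m≤n⇒m∸n≡0 (<⇒≤ (≰⇒> ¬z))))
  go : ∀ k → k + d ≡ q → 0 + 2 * (d * q) ≤ d * d + 2 * (d * p) + (p * p + q * q)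
  go k refl = ≤-trans (m≤m+n _ (2 * (d * p) + p * p + k * k)) (≤-reflexive (solve (k ∷ d ∷ p ∷ [])))

module Epoch {V J : Set} (Tile : List V → Set) (r s D : ℕ) (R : List V)
  (pick : ∀ R′ → R′ ⊑ R → length R ≤ length R′ + r * s → (w : V → ℕ) →
    ∃ λ T → length T ≡ r × Tile T × T ⊑ R′ × r * ∑ R′ w ≤ length R′ * ∑ T w)
  (Js : List J) (a : J → V → ℕ) (a≤D : ∀ j x → a j x ≤ D) where

  m c : ℕ
  m = length R
  c = 2 * ((m * r * D) * (m * r * D))

  -- A lower bound, valid throughout the epoch, for `r` times the sum of `a j` over the uncovered
  -- vertices: at most `r * s` vertices disappear, and each carries at most `D`.
  p : J → ℕ
  p j = r * (∑ R (a j) ∸ r * s * D)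

  -- By how much t tiles covering U have failed to use up a j at the proportional rate.
  dev : ℕ → List V → J → ℕ
  dev t U j = t * p j ∸ m * ∑ U (a j)

  Tiles : ℕ → List (List V) → Set
  Tiles t ts = length ts ≡ t × All (λ T → length T ≡ r × Tile T) ts

  length-concat : ∀ {ts} → All (λ T → length T ≡ r × Tile T) ts → length (concat ts) ≡ r * length ts
  length-concat All.[] = sym (*-zeroʳ r)
  length-concat {T ∷ ts} ((e , _) All.∷ h) = trans (length-++ T)
    (trans (cong₂ _+_ e (length-concat h)) (sym (*-suc r (length ts))))

  Φ : ℕ → List V → ℕ
  Φ t U = ∑ Js (λ j → dev t U j * dev t U j)

  State : ℕ → Set
  State t = ∃ λ ts → ∃ λ R′ → Tiles t ts × R ↭ concat ts ++ R′ × Φ t (concat ts) ≤ t * (length Js * c)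

  p≤ : ∀ j → p j ≤ m * r * D
  p≤ j = ≤-trans (*-monoʳ-≤ r (≤-trans (m∸n≤m _ (r * s * D)) (∑-≤-const R (λ {x} _ → a≤D j x))))
    (≤-reflexive (arr r m D))
    where
    arr : ∀ r m D → r * (m * D) ≡ m * r * D
    arr = solve-∀

  -- The weight of a vertex is the sum of its test values, each multiplied by the current deviation.
  -- The tile chosen for this weight makes the first-order change of `Φ` nonpositive, so only the
  -- second-order terms, at most `c` for each test, accumulate.
  step : ∀ {t} → t < s → State t → State (suc t)
  step {t} t<s (ts , R′ , (refl , tiles) , perm , hΦ)
    with pick R′ (concat ts , ↭-trans perm (++-comm (concat ts) R′)) bound (λ x → ∑ Js (λ j → dev t (concat ts) j * a j x))
    where
    bound : length R ≤ length R′ + r * s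
    bound = ≤-trans (≤-reflexive (trans (↭-length perm) (trans (length-++ (concat ts))
      (trans (+-comm _ (length R′)) (cong (length R′ +_) (length-concat tiles))))))
      (+-monoʳ-≤ (length R′) (*-monoʳ-≤ r (<⇒≤ t<s)))
  ... | T , lenT , tileT , (R″ , permT) , hT =
    T ∷ ts , R″ , (refl , (lenT , tileT) All.∷ tiles) , perm′ ,
    ≤-trans (+-cancelʳ-≤ (2 * ∑ Js (λ j → d j * q j)) _ _ drift) (+-monoʳ-≤ (length Js * c) hΦ)
    where
    U : List V
    U = concat ts
    d q : J → ℕ
    d = dev t U
    q j = m * ∑ T (a j)

    perm′ : R ↭ (T ++ U) ++ R″
    perm′ = ↭-trans perm (↭-trans (++⁺ˡ U permT) (↭-trans (↭-reflexive (sym (++-assoc U T R″)))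
      (++⁺ʳ R″ (++-comm U T))))

    remaining : ∀ j → ∑ R (a j) ∸ r * s * D ≤ ∑ R′ (a j)
    remaining j = ≤-trans (∸-monoˡ-≤ (r * s * D) (≤-reflexive (trans (∑-↭ perm) (∑-++ U R′))))
      (m≤n+o⇒m∸n≤o (∑ U (a j) + ∑ R′ (a j)) (r * s * D) (+-monoˡ-≤ (∑ R′ (a j))
        (≤-trans (∑-≤-const U (λ {x} _ → a≤D j x)) (*-monoˡ-≤ D (≤-trans (≤-reflexive (length-concat tiles))
          (*-monoʳ-≤ r (<⇒≤ t<s)))))))

    ∑-weights : ∀ W → ∑ W (λ x → ∑ Js (λ j → d j * a j x)) ≡ ∑ Js (λ j → d j * ∑ W (a j))
    ∑-weights W = trans (∑-swap W Js _) (∑-cong Js (λ j → ∑-* (d j) W (a j)))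

    arr : ∀ a b c → a * (b * c) ≡ b * (a * c)
    arr = solve-∀

    dp≤dq : ∑ Js (λ j → d j * p j) ≤ ∑ Js (λ j → d j * q j)
    dp≤dq = begin
      ∑ Js (λ j → d j * p j)
        ≤⟨ ∑-mono Js (λ {j} _ → *-monoʳ-≤ (d j) (*-monoʳ-≤ r (remaining j))) ⟩
      ∑ Js (λ j → d j * (r * ∑ R′ (a j)))
        ≡⟨ trans (∑-cong Js (λ j → arr (d j) r _)) (∑-* r Js _) ⟩
      r * ∑ Js (λ j → d j * ∑ R′ (a j))
        ≡⟨ cong (r *_) (sym (∑-weights R′)) ⟩
      r * ∑ R′ (λ x → ∑ Js (λ j → d j * a j x))
        ≤⟨ hT ⟩
      length R′ * ∑ T (λ x → ∑ Js (λ j → d j * a j x))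
        ≤⟨ *-monoˡ-≤ _ (length-⊑ (U , ↭-trans perm (++-comm U R′))) ⟩
      m * ∑ T (λ x → ∑ Js (λ j → d j * a j x))
        ≡⟨ cong (m *_) (∑-weights T) ⟩
      m * ∑ Js (λ j → d j * ∑ T (a j))
        ≡⟨ sym (trans (∑-cong Js (λ j → arr (d j) m _)) (∑-* m Js _)) ⟩
      ∑ Js (λ j → d j * q j) ∎
      where open ≤-Reasoning

    q≤ : ∀ j → q j ≤ m * r * D
    q≤ j = ≤-trans (*-monoʳ-≤ m (≤-trans (∑-≤-const T (λ {x} _ → a≤D j x)) (≤-reflexive (cong (_* D) lenT))))
      (≤-reflexive (sym (*-assoc m r D)))

    dev-step : ∀ j → dev (suc t) (T ++ U) j ≤ (d j + p j) ∸ q j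
    dev-step j = begin
      (p j + t * p j) ∸ m * ∑ (T ++ U) (a j)
        ≡⟨ cong₂ _∸_ (+-comm (p j) _) (trans (cong (m *_) (∑-++ T U)) (trans (*-distribˡ-+ m _ _) (+-comm (q j) _))) ⟩
      (t * p j + p j) ∸ (m * ∑ U (a j) + q j)
        ≡⟨ sym (∸-+-assoc (t * p j + p j) (m * ∑ U (a j)) (q j)) ⟩
      ((t * p j + p j) ∸ m * ∑ U (a j)) ∸ q j
        ≤⟨ ∸-monoˡ-≤ (q j) (sub (t * p j) (p j) (m * ∑ U (a j))) ⟩
      (d j + p j) ∸ q j ∎
      where
      open ≤-Reasoning
      sub : ∀ x y z → (x + y) ∸ z ≤ (x ∸ z) + y
      sub x y z = m≤n+o⇒m∸n≤o (x + y) z (≤-trans (+-monoˡ-≤ y (m≤n+m∸n x z)) (≤-reflexive (+-assoc z (x ∸ z) y)))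

    pointwise : ∀ j → dev (suc t) (T ++ U) j * dev (suc t) (T ++ U) j + 2 * (d j * q j)
                    ≤ d j * d j + 2 * (d j * p j) + c
    pointwise j = ≤-trans (sq-step {_} {d j} {p j} {q j} (dev-step j)) (+-monoʳ-≤ (d j * d j + 2 * (d j * p j))
      (≤-trans (*-mono-≤ (p≤ j) (p≤ j) ⊕ *-mono-≤ (q≤ j) (q≤ j)) (≤-reflexive (dbl ((m * r * D) * (m * r * D))))))
      where
      dbl : ∀ x → x + x ≡ 2 * x
      dbl = solve-∀

    drift : Φ (suc t) (T ++ U) + 2 * ∑ Js (λ j → d j * q j) ≤ (length Js * c + Φ t U) + 2 * ∑ Js (λ j → d j * q j)
    drift = begin
      Φ (suc t) (T ++ U) + 2 * ∑ Js (λ j → d j * q j)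
        ≡⟨ trans (cong (Φ (suc t) (T ++ U) +_) (sym (∑-* 2 Js _))) (sym (∑-+ Js _ _)) ⟩
      ∑ Js (λ j → dev (suc t) (T ++ U) j * dev (suc t) (T ++ U) j + 2 * (d j * q j))
        ≤⟨ ∑-mono Js (λ {j} _ → pointwise j) ⟩
      ∑ Js (λ j → d j * d j + 2 * (d j * p j) + c)
        ≡⟨ trans (∑-+ Js _ _) (cong₂ _+_ (trans (∑-+ Js _ _) (cong (Φ t U +_) (∑-* 2 Js _))) (∑-const c Js)) ⟩
      (Φ t U + 2 * ∑ Js (λ j → d j * p j)) + length Js * c
        ≤⟨ +-monoˡ-≤ (length Js * c) (+-monoʳ-≤ (Φ t U) (*-monoʳ-≤ 2 dp≤dq)) ⟩
      (Φ t U + 2 * ∑ Js (λ j → d j * q j)) + length Js * c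
        ≡⟨ rot (Φ t U) (2 * ∑ Js (λ j → d j * q j)) (length Js * c) ⟩
      (length Js * c + Φ t U) + 2 * ∑ Js (λ j → d j * q j) ∎
      where
      open ≤-Reasoning
      rot : ∀ x y z → (x + y) + z ≡ (z + x) + y
      rot = solve-∀

  run : ∀ t → t ≤ s → State t
  run zero    _ = [] , R , (refl , All.[]) , ↭-refl ,
    ≤-reflexive (trans (∑-cong Js (λ j → cong (λ z → z * z) (0∸n≡0 (m * 0)))) (∑-zero Js))
  run (suc t) h = step h (run t (<⇒≤ h))

  Balanced : ℕ → Set
  Balanced Z = ∃ λ ts → ∃ λ R′ → Tiles s ts × R ↭ concat ts ++ R′ ×
    ∃ λ (bad : J → Bool) → # bad Js * (Z * Z) ≤ s * (length Js * c) ×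
      (∀ j → bad j ≡ false → s * p j ≤ m * ∑ (concat ts) (a j) + Z)

  -- As in Chebyshev's inequality, every test that deviates by `Z` or more contributes at least
  -- `Z * Z` to the potential.
  epoch : ∀ Z → Balanced Z
  epoch Z with run s ≤-refl
  ... | ts , R′ , tiles , perm , hΦ = ts , R′ , tiles , perm , (λ j → Z ≤ᵇ dev s (concat ts) j) ,
    ≤-trans (≤-trans (≤-reflexive (sym (∑-*ʳ (Z * Z) Js _))) (∑-mono Js (λ {j} _ → large (dev s (concat ts) j)))) hΦ ,
    λ j e → small j e
    where
    large : ∀ d → ⟦ Z ≤ᵇ d ⟧ * (Z * Z) ≤ d * d
    large d with Z ≤ᵇ d in eq
    ... | false = z≤n
    ... | true  = ≤-trans (≤-reflexive (+-identityʳ (Z * Z)))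
                    (let h = ≤ᵇ⇒≤ Z d (true⇒T eq) in *-mono-≤ h h)
    small : ∀ j → (Z ≤ᵇ dev s (concat ts) j) ≡ false → s * p j ≤ m * ∑ (concat ts) (a j) + Z
    small j e with Z ≤? dev s (concat ts) j
    ... | no ¬h = ≤-trans (m≤n+m∸n (s * p j) (m * ∑ (concat ts) (a j))) (+-monoʳ-≤ _ (<⇒≤ (≰⇒> ¬h)))
    ... | yes h with trans (sym (≤ᵇ-true h)) e
    ...   | ()

-- Counting pairs by a form

∑-pos : (xs : List X) (f : X → ℕ) → 0 < ∑ xs f → ∃ λ x → x ∈ xs × 0 < f x
∑-pos (x ∷ xs) f h with f x in eq
... | suc k = x , here refl , subst (0 <_) (sym eq) (s≤s z≤n)
... | zero  = let z , m , q = ∑-pos xs f h in z , there m , q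

⟦⟧-pos : ∀ {b} → 0 < ⟦ b ⟧ → b ≡ true
⟦⟧-pos {true} _ = refl

module Form {V : Set} (q : V → V → ℕ) where

  form : List V → ℕ
  form R = ∑ R (λ x → ∑ R (λ y → q x y))

  deg : List V → V → ℕ
  deg R x = ∑ R (λ y → q x y + q y x)

  -- A lost pair has an end in `U` and is counted in the degree of that end. Pairs inside `U` are
  -- counted twice, hence only an inequality.
  form-remove : ∀ R U R′ → R ↭ U ++ R′ → form R ≤ form R′ + ∑ U (deg R)
  form-remove R U R′ perm = begin
    form R
      ≡⟨ trans (∑-↭ perm) (∑-++ U R′) ⟩
    ∑ U (λ x → ∑ R (q x)) + ∑ R′ (λ x → ∑ R (q x))
      ≡⟨ cong (∑ U (λ x → ∑ R (q x)) +_) (trans (∑-cong R′ (λ x → trans (∑-↭ perm) (∑-++ U R′))) (∑-+ R′ _ _)) ⟩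
    ∑ U (λ x → ∑ R (q x)) + (∑ R′ (λ x → ∑ U (q x)) + form R′)
      ≡⟨ cong (λ z → ∑ U (λ x → ∑ R (q x)) + (z + form R′)) (∑-swap R′ U q) ⟩
    ∑ U (λ x → ∑ R (q x)) + (∑ U (λ x → ∑ R′ (λ y → q y x)) + form R′)
      ≤⟨ +-monoʳ-≤ (∑ U (λ x → ∑ R (q x))) (+-monoˡ-≤ (form R′) (∑-mono U (λ {x} _ → ∑-⊑ {f = λ y → q y x} (U , ↭-trans perm (++-comm U R′))))) ⟩
    ∑ U (λ x → ∑ R (q x)) + (∑ U (λ x → ∑ R (λ y → q y x)) + form R′)
      ≡⟨ trans (sym (+-assoc (∑ U (λ x → ∑ R (q x))) (∑ U (λ x → ∑ R (λ y → q y x))) (form R′))) (+-comm _ (form R′)) ⟩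
    form R′ + (∑ U (λ x → ∑ R (q x)) + ∑ U (λ x → ∑ R (λ y → q y x)))
      ≡⟨ cong (form R′ +_) (trans (sym (∑-+ U _ _)) (∑-cong U (λ x → sym (∑-+ R _ _)))) ⟩
    form R′ + ∑ U (deg R) ∎
    where open ≤-Reasoning

  deg-sum : ∀ R → ∑ R (deg R) ≡ 2 * form R
  deg-sum R = trans (trans (∑-cong R (λ x → ∑-+ R _ _)) (∑-+ R _ _))
    (cong (form R +_) (trans (∑-swap R R (λ x y → q y x)) (sym (+-identityʳ (form R)))))

-- Rounds of covering

dense-after : ∀ m y D A h k e e′ e″ t → y * A ≤ m * h + 2 * (D * (y * y)) → m * D ≤ A + 2 * e → h + k ≤ y * D →
  e ≤ e′ + k → e′ ≤ e″ + t → m * e ≤ m * e″ + m * t + 2 * (y * e) + 2 * (D * (y * y))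
dense-after m y D A h k e e′ e″ t h₁ h₂ h₃ h₄ h₅ = lin 0 (h₁ ⊕ y ⊗ h₂ ⊕ m ⊗ h₃ ⊕ m ⊗ h₄ ⊕ m ⊗ h₅)
  (solve (m ∷ y ∷ D ∷ A ∷ h ∷ k ∷ e ∷ e′ ∷ e″ ∷ t ∷ []))

sparse-after : ∀ f h f′ f″ y m → h + f′ ≤ f → f″ ≤ f′ → y * f ≤ m * h + 2 * (y * y) → m * f″ + y * f ≤ m * f + 2 * (y * y)
sparse-after f h f′ f″ y m k₁ k₂ k₃ = lin 0 (m ⊗ k₁ ⊕ m ⊗ k₂ ⊕ k₃) (solve (f ∷ h ∷ f′ ∷ f″ ∷ y ∷ m ∷ []))

-- A set that loses the fraction `y / m` of its members keeps its ratio to the `m - y` vertices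
-- left. Two errors remain: the trash `t` shrinks the ground set but perhaps not the set, which
-- costs `suc c * β`, and the deviation `2 * (y * y) / m` is absorbed in `ε` because `m` is at least
-- `K`.
sparse-round : ∀ c r m m″ t y D₁ E₁ ε K f f″ β → m ≡ y + (t + m″) → t ≤ β → K ≤ m →
  c * (r * f) ≤ suc c * m + D₁ → m * f″ + y * f ≤ m * f + 2 * (y * y) →
  suc c * β + ε ≤ E₁ → 2 * (c * (r * (y * y))) ≤ K * ε → m * (c * (r * f″)) ≤ m * (suc c * m″ + (D₁ + E₁))
sparse-round c r m m″ t y D₁ E₁ ε K f f″ β refl h₁ h₂ h₃ h₄ h₅ h₆ =
  lin (y * D₁) ((c * r) ⊗ h₄ ⊕ (t + m″) ⊗ h₃ ⊕ (suc c * (y + (t + m″))) ⊗ h₁ ⊕ (y + (t + m″)) ⊗ h₅ ⊕ h₆ ⊕ ε ⊗ h₂)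
    (arr c r m″ t y D₁ E₁ ε K f f″ β)
  where
  arr : ∀ c r m″ t y D₁ E₁ ε K f f″ β → (y + (t + m″)) * (c * (r * f″)) +
    ((c * r) * ((y + (t + m″)) * f + 2 * (y * y)) + (t + m″) * (suc c * (y + (t + m″)) + D₁)
      + (suc c * (y + (t + m″))) * β + (y + (t + m″)) * E₁ + K * ε + ε * (y + (t + m″))) + y * D₁
    ≡ (y + (t + m″)) * (suc c * m″ + (D₁ + E₁)) +
    ((c * r) * ((y + (t + m″)) * f″ + y * f) + (t + m″) * (c * (r * f)) + (suc c * (y + (t + m″))) * t
      + (y + (t + m″)) * (suc c * β + ε) + 2 * (c * (r * (y * y))) + ε * K)
  arr = solve-∀

-- Pairs disappear at the relative rate `2 * y / m`, and so does the square of the number of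
-- vertices, up to `y * y`. The error `E₂` collects this term, the pairs lost with the trash and the
-- deviation.
dense-round : ∀ e₁ m m″ n y D₂ E₂ a a″ β → 2 * y ≤ m → m″ + y ≤ m → m ≤ n →
  m * m ≤ e₁ * a + D₂ → m * a ≤ m * a″ + m * (β * (2 * m)) + 2 * (y * a) + 2 * ((2 * m) * (y * y)) →
  2 * (e₁ * (n * β)) + 4 * (e₁ * (y * y)) + y * y ≤ E₂ →
  m * (m″ * m″) ≤ m * (e₁ * a″ + (D₂ + E₂))
dense-round e₁ m m″ n y D₂ E₂ a a″ β h₁ h₂ h₃ h₄ h₅ h₆ = go (m ∸ 2 * y) (m+[n∸m]≡n h₁)
  where
  go : ∀ z → 2 * y + z ≡ m → m * (m″ * m″) ≤ m * (e₁ * a″ + (D₂ + E₂))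
  go z refl = lin (2 * y * D₂)
    (w ⊗ *-mono-≤ m″≤ m″≤ ⊕ z ⊗ h₄ ⊕ e₁ ⊗ h₅ ⊕ w ⊗ h₆ ⊕ (2 * (e₁ * (β * w))) ⊗ h₃)
    (arr e₁ z m″ n y D₂ E₂ a a″ β)
    where
    w : ℕ
    w = 2 * y + z
    m″≤ : m″ ≤ y + z
    m″≤ = +-cancelʳ-≤ y _ _ (≤-trans h₂ (≤-reflexive (rot y z)))
      where
      rot : ∀ y z → 2 * y + z ≡ y + z + y
      rot = solve-∀
    arr : ∀ e₁ z m″ n y D₂ E₂ a a″ β → (2 * y + z) * (m″ * m″) +
      ((2 * y + z) * ((y + z) * (y + z)) + z * (e₁ * a + D₂)
        + e₁ * ((2 * y + z) * a″ + (2 * y + z) * (β * (2 * (2 * y + z))) + 2 * (y * a) + 2 * ((2 * (2 * y + z)) * (y * y)))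
        + (2 * y + z) * E₂ + (2 * (e₁ * (β * (2 * y + z)))) * n) + 2 * y * D₂
      ≡ (2 * y + z) * (e₁ * a″ + (D₂ + E₂)) +
      ((2 * y + z) * (m″ * m″) + z * ((2 * y + z) * (2 * y + z)) + e₁ * ((2 * y + z) * a)
        + (2 * y + z) * (2 * (e₁ * (n * β)) + 4 * (e₁ * (y * y)) + y * y)
        + (2 * (e₁ * (β * (2 * y + z)))) * (2 * y + z))
    arr = solve-∀

few-bad-lhs : ∀ β D r s → β * (((D * r) * (D * r)) * ((s * s) * (s * s)) * (r * r))
  ≡ β * ((D * ((r * s) * (r * s))) * (D * ((r * s) * (r * s))))
few-bad-lhs = solve-∀

few-bad-mid : ∀ s m r D → s * ((m * 4) * (2 * ((m * r * D) * (m * r * D)))) ≡ 8 * (m * (m * m)) * (s * ((D * D) * (r * r)))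
few-bad-mid = solve-∀

few-bad-rhs : ∀ Λ s D r → 8 * ((Λ * s) * ((Λ * s) * (Λ * s))) * (s * ((D * D) * (r * r)))
  ≡ 8 * (Λ * (Λ * Λ)) * (((D * r) * (D * r)) * ((s * s) * (s * s)))
few-bad-rhs = solve-∀

few-from-sparse : ∀ c m D₁ y g f → c * f ≤ suc c * m + D₁ → 8 * m + 8 * D₁ + 8 * (c * y) ≤ c * g →
  c * (8 * f + 8 * y) ≤ c * (8 * m + g)
few-from-sparse c m D₁ y g f h₁ h₂ = lin 0 (8 ⊗ h₁ ⊕ h₂) (arr c m D₁ y g f)
  where
  arr : ∀ c m D₁ y g f → c * (8 * f + 8 * y) + (8 * (suc c * m + D₁) + c * g) + 0
    ≡ c * (8 * m + g) + (8 * (c * f) + (8 * m + 8 * D₁ + 8 * (c * y)))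
  arr = solve-∀

module Rounds {V : Set} (N S : V × Bool → V → Bool)
  (S-self : ∀ v τ → S (v , τ) v ≡ true)
  (S-compl : ∀ i y → S i y ≡ false → N i y ≡ true)
  (N-irr : ∀ v τ → N (v , τ) v ≡ false) (l : ℕ) where

  open Chains N

  r : ℕ
  r = suc l

  pairᵇ : V × Bool → V → V → Bool
  pairᵇ i x y = S i x ∧ (S i y ∧ M x y)

  q : V × Bool → V → V → ℕ
  q i x y = ⟦ pairᵇ i x y ⟧

  module F i = Form (q i)

  e : V × Bool → List V → ℕ
  e i R = F.form i R

  q≤S : ∀ i x y → q i x y ≤ ⟦ S i x ⟧
  q≤S i x y with S i x
  ... | true  = ⟦⟧≤1 (S i y ∧ M x y)
  ... | false = z≤n

  q≤S′ : ∀ i x y → q i y x ≤ ⟦ S i x ⟧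
  q≤S′ i x y with S i y | S i x
  ... | true  | true  = ⟦⟧≤1 (M y x)
  ... | true  | false = z≤n
  ... | false | _     = z≤n

  deg≤ : ∀ i R x → F.deg i R x ≤ ⟦ S i x ⟧ * (2 * length R)
  deg≤ i R x = ≤-trans (∑-≤-const R (λ {y} _ → q≤S i x y ⊕ q≤S′ i x y)) (≤-reflexive (arr (length R) ⟦ S i x ⟧))
    where
    arr : ∀ m s → m * (s + s) ≡ s * (2 * m)
    arr = solve-∀

  deg≤2 : ∀ i R x → F.deg i R x ≤ 2 * length R
  deg≤2 i R x = ≤-trans (deg≤ i R x) (≤-trans (*-monoˡ-≤ (2 * length R) (⟦⟧≤1 (S i x))) (≤-reflexive (*-identityˡ _)))

  e-remove : ∀ i R U R′ → R ↭ U ++ R′ → e i R ≤ e i R′ + # (S i) U * (2 * length R)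
  e-remove i R U R′ perm = ≤-trans (F.form-remove i R U R′ perm)
    (+-monoʳ-≤ (e i R′) (≤-trans (∑-mono U (λ {x} _ → deg≤ i R x)) (≤-reflexive (∑-*ʳ (2 * length R) U _))))

  e-remove′ : ∀ i R U R′ → R ↭ U ++ R′ → e i R ≤ e i R′ + length U * (2 * length R)
  e-remove′ i R U R′ perm = ≤-trans (e-remove i R U R′ perm) (+-monoʳ-≤ (e i R′) (*-monoˡ-≤ (2 * length R) (#≤length (S i) U)))

  e-pos : ∀ i B → 0 < e i B → ∃ λ x → ∃ λ y → x ∈ B × y ∈ B × M x y ≡ true
  e-pos i B h =
    let x , x∈ , h₁ = ∑-pos B _ h
        y , y∈ , h₂ = ∑-pos B _ h₁
    in x , y , x∈ , y∈ , proj₂ (∧-true {S i y} (proj₂ (∧-true {S i x} (⟦⟧-pos h₂))))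

  -- Conditions that survive the deletion of any `y` vertices. In `many`, a deleted vertex destroys
  -- at most `2 * length R` pairs; provision is made for `10 ^ r * g` members of the
  -- non-neighbourhood outside its heavy part, and for the `y` deleted vertices.
  record Robust (g y : ℕ) (R : List V) : Set where
    field
      few  : ∀ v τ → v ∈ R → 8 * (r * # (S (v , τ)) R) + 8 * y ≤ 8 * length R + g
      many : ∀ v → v ∈ R → 2 * ((10 ^ r * g) * length R) + 2 * (y * length R) < e (v , true) R
      room : r * (10 ^ r * g) + y ≤ length R
      big  : y < length R

  robust-pick : ∀ g y R → Robust g y R → ∀ R′ → R′ ⊑ R → length R ≤ length R′ + y → (w : V → ℕ) →
    ∃ λ T → length T ≡ r × Chain T × T ⊑ R′ × r * ∑ R′ w ≤ length R′ * ∑ T w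
  robust-pick g y R rob R′ R′⊑ len w = Greedy.robust-chain S S-self S-compl N-irr R′ b few′ w l τ g τ≤b pairs ≤-refl lb< 8rb
    where
    open Robust rob
    m m′ b τ : ℕ
    m  = length R
    m′ = length R′
    -- The largest `b` that the slack `g` allows; it bounds every non-neighbourhood in `R′`, by
    -- `few`.
    b  = (8 * m′ + g) / (8 * suc l)
    τ  = 10 ^ suc l * g

    8rb : 8 * (suc l * b) ≤ 8 * m′ + g
    8rb = ≤-trans (≤-reflexive (trans (sym (*-assoc 8 (suc l) b)) (*-comm (8 * suc l) b))) (m/n*n≤m (8 * m′ + g) (8 * suc l))

    below : ∀ k → 8 * (suc l * k) ≤ 8 * m′ + g → k ≤ b
    below k h = ≤-trans (≤-reflexive (sym (m*n/n≡m k (8 * suc l)))) (/-monoˡ-≤ (8 * suc l)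
      (≤-trans (≤-reflexive (trans (*-comm k (8 * suc l)) (*-assoc 8 (suc l) k))) h))

    few′ : ∀ v τ → v ∈ R′ → # (S (v , τ)) R′ ≤ b
    few′ v τ v∈ = below _ (go (suc l * # (S (v , τ)) R) (≤-trans (*-monoʳ-≤ 8 (*-monoʳ-≤ (suc l) (∑-⊑ R′⊑))) ≤-refl)
      (few v τ (∈-⊑ R′⊑ v∈)))
      where
      go : ∀ {a} f → a ≤ 8 * f → 8 * f + 8 * y ≤ 8 * m + g → a ≤ 8 * m′ + g
      go {a} f h₁ h₂ = lin 0 (h₁ ⊕ h₂ ⊕ 8 ⊗ len) (arr a f y m m′ g)
        where
        arr : ∀ a f y m m′ g → a + (8 * f + (8 * m + g) + 8 * (m′ + y)) + 0 ≡ 8 * m′ + g + (a + (8 * f + 8 * y) + 8 * m)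
        arr = solve-∀

    m′-big : r * τ ≤ m′
    m′-big = +-cancelʳ-≤ y _ _ (≤-trans room len)

    0<m′ : 0 < m′
    0<m′ = +-cancelʳ-< y 0 m′ (<-≤-trans big len)

    g≤τ : g ≤ τ
    g≤τ = ≤-trans (≤-reflexive (sym (*-identityˡ g))) (*-monoˡ-≤ g (m^n>0 10 (suc l)))

    τ≤b : τ ≤ b
    τ≤b = below τ (≤-trans (*-monoʳ-≤ 8 m′-big) (m≤m+n _ g))

    lb< : l * b < m′
    lb< = *-cancelˡ-< (8 * suc l) _ _ (begin-strict
      8 * suc l * (l * b)
        ≡⟨ arr₁ l b ⟩
      l * (8 * (suc l * b))
        ≤⟨ *-monoʳ-≤ l 8rb ⟩
      l * (8 * m′ + g)
        ≡⟨ arr₂ l m′ g ⟩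
      8 * l * m′ + l * g
        ≤⟨ +-monoʳ-≤ (8 * l * m′) (≤-trans (*-mono-≤ (n≤1+n l) g≤τ) m′-big) ⟩
      8 * l * m′ + m′
        <⟨ m<m+n (8 * l * m′ + m′) {7 * m′} (≤-trans 0<m′ (m≤m+n m′ (6 * m′))) ⟩
      8 * l * m′ + m′ + 7 * m′
        ≡⟨ arr₃ l m′ ⟩
      8 * suc l * m′ ∎)
      where
      open ≤-Reasoning
      arr₁ : ∀ l b → 8 * suc l * (l * b) ≡ l * (8 * (suc l * b))
      arr₁ = solve-∀
      arr₂ : ∀ l m g → l * (8 * m + g) ≡ 8 * l * m + l * g
      arr₂ = solve-∀
      arr₃ : ∀ l m → 8 * l * m + m + 7 * m ≡ 8 * suc l * m
      arr₃ = solve-∀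

    pairs : ∀ v → v ∈ R′ → (B : List V) → B ⊑ R′ → (∀ {x} → x ∈ B → S (v , true) x ≡ true) →
      b ≤ length B + τ → ∃ λ x → ∃ λ y → x ∈ B × y ∈ B × M x y ≡ true
    pairs v v∈ B (C , perm) B⊂S many-B = e-pos i B
      (+-cancelʳ-< (2 * (τ * m) + 2 * (y * m)) 0 (e i B)
        (<-≤-trans (many v (∈-⊑ R′⊑ v∈)) (≤-trans (e-remove′ i R (proj₁ R′⊑) R′ (↭-trans (proj₂ R′⊑) (++-comm R′ _)))
          (≤-trans (+-monoˡ-≤ (length (proj₁ R′⊑) * (2 * m)) (e-remove i R′ C B (↭-trans perm (++-comm B C))))
            (final (e i B) (# (S i) C) (length (proj₁ R′⊑)) SC≤ m′≤ U≤)))))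
      where
      i : V × Bool
      i = (v , true)
      m′≤ : m′ ≤ m
      m′≤ = length-⊑ R′⊑
      U≤ : length (proj₁ R′⊑) ≤ y
      U≤ = +-cancelˡ-≤ m′ _ _ (≤-trans (≤-reflexive (sym (trans (↭-length (proj₂ R′⊑)) (length-++ R′)))) len)
      SB : length B ≤ # (S i) B
      SB = ≤-trans (≤-reflexive (length-∑ B)) (∑-mono B (λ m → ≤-reflexive (sym (cong ⟦_⟧ (B⊂S m)))))
      SC≤ : # (S i) C ≤ τ
      SC≤ = +-cancelˡ-≤ (length B) _ _ (≤-trans (+-monoˡ-≤ _ SB) (≤-trans (≤-reflexive
        (sym (trans (∑-↭ perm) (∑-++ B C)))) (≤-trans (few′ v true v∈) many-B)))
      final : ∀ eB sC u → sC ≤ τ → m′ ≤ m → u ≤ y →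
        eB + sC * (2 * m′) + u * (2 * m) ≤ eB + (2 * (τ * m) + 2 * (y * m))
      final eB sC u h₁ h₂ h₃ = ≤-trans (≤-reflexive (+-assoc eB _ _)) (+-monoʳ-≤ eB
        (≤-trans (*-mono-≤ h₁ (*-monoʳ-≤ 2 h₂)) (≤-reflexive (arr τ m)) ⊕
         ≤-trans (*-monoˡ-≤ (2 * m) h₃) (≤-reflexive (arr y m))))
        where
        arr : ∀ a m → a * (2 * m) ≡ 2 * (a * m)
        arr = solve-∀

  Tiling : List (List V) → Set
  Tiling = All (λ T → length T ≡ r × Chain T)

  record Result (s Λ : ℕ) (R : List V) : Set where
    field
      tiles       : List (List V)
      trash R″    : List V
      tiling      : Tiling tiles
      count       : length tiles ≡ s
      partition   : R ↭ concat tiles ++ (trash ++ R″)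
      small-trash : length trash ≤ 8 * (Λ * (Λ * Λ))
      few-after   : ∀ v τ → v ∈ R″ → length R * # (S (v , τ)) R″ + (r * s) * # (S (v , τ)) R ≤ length R * # (S (v , τ)) R + 2 * ((r * s) * (r * s))
      many-after  : ∀ v → v ∈ R″ → length R * e (v , true) R ≤
        length R * e (v , true) R″ + length R * (8 * (Λ * (Λ * Λ)) * (2 * length R)) + 2 * ((r * s) * e (v , true) R) + 2 * ((2 * length R) * ((r * s) * (r * s)))

  bools : List Bool
  bools = true ∷ false ∷ []

  module Round (g s Λ : ℕ) (R : List V) (0<s : 0 < s) (m≤Λs : length R ≤ Λ * s) (rob : Robust g (r * s) R) where

    m D y : ℕ
    m = length R
    D = 2 * m
    y = r * s

    0<D : 0 < D
    0<D = ≤-trans (≤-<-trans z≤n (Robust.big rob)) (m≤m+n m (m + 0))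

    J : Set
    J = V × (Bool × Bool)

    Js : List J
    Js = cartesianProduct R (cartesianProduct bools bools)

    -- An epoch only guarantees that enough of a test is used up. That is what is wanted for the
    -- size of a non-neighbourhood; for pairs the loss must be bounded from above, so the complement
    -- of the degree is tested. The factor `D` gives both kinds the same range.
    test : J → V → ℕ
    test (v , τ , false) x = D * ⟦ S (v , τ) x ⟧
    test (v , τ , true)  x = D ∸ F.deg (v , τ) R x

    test≤D : ∀ j x → test j x ≤ D
    test≤D (v , τ , false) x = ≤-trans (*-monoʳ-≤ D (⟦⟧≤1 (S (v , τ) x))) (≤-reflexive (*-identityʳ D))
    test≤D (v , τ , true)  x = m∸n≤m D (F.deg (v , τ) R x)

    ∑Js : (f : J → ℕ) → ∑ Js f ≡ ∑ R (λ v → f (v , true , true) + (f (v , true , false) + (f (v , false , true) + (f (v , false , false) + 0))))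
    ∑Js f = ∑-product R (cartesianProduct bools bools)

    lenJs : length Js ≡ m * 4
    lenJs = trans (length-∑ Js) (trans (∑Js (λ _ → 1)) (∑-const 4 R))

    open Epoch Chain r s D R (λ R′ R′⊑ len w → robust-pick g y R rob R′ R′⊑ len w) Js test test≤D
      using (Balanced; epoch; length-concat)

    Λ³ : ℕ
    Λ³ = 8 * (Λ * (Λ * Λ))

    -- The potential is at most of order `s * m ^ 3 * D ^ 2` and a failed test contributes the order
    -- of `s ^ 4 * D ^ 2`. The quotient has the order of `(m / s) ^ 3`, which is bounded because a
    -- round covers a fixed proportion of `m`.
    few-bad : ∀ β → β * ((D * (y * y)) * (D * (y * y))) ≤ s * (length Js * (2 * ((m * r * D) * (m * r * D)))) → β ≤ Λ³
    few-bad β h = *-cancelʳ-≤ β Λ³ K {{>-nonZero 0<K}} (begin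
      β * K
        ≤⟨ *-monoʳ-≤ β (m≤m*n K (r * r)) ⟩
      β * (K * (r * r))
        ≡⟨ few-bad-lhs β D r s ⟩
      β * ((D * (y * y)) * (D * (y * y)))
        ≤⟨ h ⟩
      s * (length Js * (2 * ((m * r * D) * (m * r * D))))
        ≡⟨ trans (cong (λ z → s * (z * (2 * ((m * r * D) * (m * r * D))))) lenJs) (few-bad-mid s m r D) ⟩
      8 * (m * (m * m)) * (s * ((D * D) * (r * r)))
        ≤⟨ *-monoˡ-≤ (s * ((D * D) * (r * r))) (*-monoʳ-≤ 8 (*-mono-≤ m≤Λs (*-mono-≤ m≤Λs m≤Λs))) ⟩
      8 * ((Λ * s) * ((Λ * s) * (Λ * s))) * (s * ((D * D) * (r * r)))
        ≡⟨ few-bad-rhs Λ s D r ⟩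
      Λ³ * K ∎)
      where
      open ≤-Reasoning
      K : ℕ
      K = ((D * r) * (D * r)) * ((s * s) * (s * s))
      0<* : ∀ {a b} → 0 < a → 0 < b → 0 < a * b
      0<* {suc a} {suc b} _ _ = s≤s z≤n
      0<K : 0 < K
      0<K = 0<* (0<* (0<* 0<D (s≤s z≤n)) (0<* 0<D (s≤s z≤n))) (0<* (0<* 0<s 0<s) (0<* 0<s 0<s))
    -- The reserve `y * D` subtracted from the target costs `D * (y * y)`, as much as the tolerance
    -- of the epoch; hence the factor 2.
    spent : ∀ A h → s * (r * (A ∸ y * D)) ≤ m * h + D * (y * y) → y * A ≤ m * h + 2 * (D * (y * y))
    spent A h = go (A ∸ y * D) (m≤n+m∸n A (y * D))
      where
      go : ∀ t → A ≤ y * D + t → s * (r * t) ≤ m * h + D * (y * y) → y * A ≤ m * h + 2 * (D * (y * y))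
      go t h₁ h₂ = ≤-trans (*-monoʳ-≤ y h₁) (≤-trans (≤-reflexive (arr r s D t)) (≤-trans (+-monoˡ-≤ _ h₂)
        (≤-reflexive (arr′ (m * h) (D * (y * y))))))
        where
        arr : ∀ r s D t → r * s * (r * s * D + t) ≡ s * (r * t) + D * ((r * s) * (r * s))
        arr = solve-∀
        arr′ : ∀ a b → a + b + b ≡ a + 2 * b
        arr′ = solve-∀

    module Outcome (ts : List (List V)) (R′ : List V) (len-ts : length ts ≡ s) (tiles : Tiling ts)
      (perm : R ↭ concat ts ++ R′) (bad : J → Bool)
      (few : # bad Js * ((D * (y * y)) * (D * (y * y))) ≤ s * (length Js * (2 * ((m * r * D) * (m * r * D)))))
      (good : ∀ j → bad j ≡ false → s * (r * (∑ R (test j) ∸ y * D)) ≤ m * ∑ (concat ts) (test j) + D * (y * y)) where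

      U : List V
      U = concat ts

      badV : V → Bool
      badV v = bad (v , true , true) ∨ (bad (v , true , false) ∨ (bad (v , false , true) ∨ bad (v , false , false)))

      trash R″ : List V
      trash = filterᵇ badV R′
      R″ = filterᵇ (not ∘ badV) R′

      goodV : ∀ {v} → v ∈ R″ → ∀ τ κ → bad (v , τ , κ) ≡ false
      goodV {v} v∈ = none (λ τ κ → bad (v , τ , κ)) (not-true (proj₂ (∈-filter⁻ (not ∘ badV) R′ v∈)))
        where
        none : (f : Bool → Bool → Bool) →
          f true true ∨ (f true false ∨ (f false true ∨ f false false)) ≡ false → ∀ τ κ → f τ κ ≡ false
        none f h true  true  = proj₁ (∨-false h)
        none f h true  false = proj₁ (∨-false (proj₂ (∨-false {f true true} h)))
        none f h false true  = proj₁ (∨-false (proj₂ (∨-false {f true false} (proj₂ (∨-false {f true true} h)))))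
        none f h false false = proj₂ (∨-false {f false true} (proj₂ (∨-false {f true false} (proj₂ (∨-false {f true true} h)))))

      badV≤ : ∀ v → ⟦ badV v ⟧ ≤ ⟦ bad (v , true , true) ⟧ + (⟦ bad (v , true , false) ⟧ + (⟦ bad (v , false , true) ⟧ + (⟦ bad (v , false , false) ⟧ + 0)))
      badV≤ v = ≤-trans (⟦∨⟧ (bad (v , true , true)) _) (+-monoʳ-≤ ⟦ bad (v , true , true) ⟧
        (≤-trans (⟦∨⟧ (bad (v , true , false)) _) (+-monoʳ-≤ ⟦ bad (v , true , false) ⟧
          (≤-trans (⟦∨⟧ (bad (v , false , true)) _) (+-monoʳ-≤ ⟦ bad (v , false , true) ⟧
            (≤-reflexive (sym (+-identityʳ _))))))))

      R′⊑R : R′ ⊑ R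
      R′⊑R = U , ↭-trans perm (++-comm U R′)

      trash≤bad : length trash ≤ # bad Js
      trash≤bad = ≤-trans (≤-reflexive (#-filter badV R′)) (≤-trans (∑-⊑ R′⊑R)
        (≤-trans (∑-mono R (λ {v} _ → badV≤ v)) (≤-reflexive (sym (∑Js (λ j → ⟦ bad j ⟧))))))

      trash≤ : length trash ≤ Λ³
      trash≤ = few-bad (length trash) (≤-trans (*-monoˡ-≤ ((D * (y * y)) * (D * (y * y))) trash≤bad) few)

      few-after : ∀ v τ → v ∈ R″ → m * # (S (v , τ)) R″ + y * # (S (v , τ)) R ≤ m * # (S (v , τ)) R + 2 * (y * y)
      few-after v τ v∈ = sparse-after (# (S i) R) (# (S i) U) (# (S i) R′) (# (S i) R″) y m
        (≤-reflexive (sym (trans (∑-↭ perm) (∑-++ U R′))))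
        (∑-⊑ (trash , ↭-trans (split-filter badV R′) (++-comm trash R″)))
        (*-cancelˡ-≤ D {{>-nonZero 0<D}} (subst₂ _≤_
          (trans (cong (y *_) (∑-* D R _)) (swp y D (# (S i) R)))
          (trans (cong (λ z → m * z + 2 * (D * (y * y))) (∑-* D U _)) (fct m D (# (S i) U) (y * y)))
          (spent (∑ R (test j)) (∑ U (test j)) (good j (goodV v∈ τ false)))))
        where
        i : V × Bool
        i = (v , τ)
        j : J
        j = (v , τ , false)
        swp : ∀ y D f → y * (D * f) ≡ D * (y * f)
        swp = solve-∀
        fct : ∀ m D h z → m * (D * h) + 2 * (D * z) ≡ D * (m * h + 2 * z)
        fct = solve-∀
      many-after : ∀ v → v ∈ R″ → m * e (v , true) R ≤
        m * e (v , true) R″ + m * (Λ³ * D) + 2 * (y * e (v , true) R) + 2 * (D * (y * y))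
      many-after v v∈ = dense-after m y D (∑ R (test j)) (∑ U (test j)) (∑ U (F.deg i R)) (e i R) (e i R′) (e i R″) (Λ³ * D)
        (spent (∑ R (test j)) (∑ U (test j)) (good j (goodV v∈ true true)))
        (≤-reflexive (trans (sym (∑-const D R)) (trans (∑-cong R split) (trans (∑-+ R _ _) (cong (∑ R (test j) +_) (F.deg-sum i R))))))
        (≤-reflexive (trans (trans (sym (∑-+ U _ _)) (trans (∑-cong U (λ x → sym (split x))) (∑-const D U)))
          (cong (_* D) (trans (length-concat tiles) (cong (r *_) len-ts)))))
        (F.form-remove i R U R′ perm)
        (≤-trans (e-remove′ i R′ trash R″ (split-filter badV R′)) (+-monoʳ-≤ (e i R″) (*-mono-≤ trash≤ (*-monoʳ-≤ 2 (length-⊑ R′⊑R)))))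
        where
        i : V × Bool
        i = (v , true)
        j : J
        j = (v , true , true)
        split : ∀ x → D ≡ test j x + F.deg i R x
        split x = sym (m∸n+n≡m (deg≤2 i R x))
      result : Result s Λ R
      result = record
        { tiles = ts ; trash = trash ; R″ = R″ ; tiling = tiles ; count = len-ts
        ; partition = ↭-trans perm (++⁺ˡ U (split-filter badV R′))
        ; small-trash = trash≤
        ; few-after = few-after
        ; many-after = many-after }

    round : Result s Λ R
    round = from (epoch (D * (y * y)))
      where
      from : Balanced (D * (y * y)) → Result s Λ R
      from (ts , R′ , (len-ts , tiles) , perm , bad , few , good) = Outcome.result ts R′ len-ts tiles perm bad few good

  -- The factor `suc c / c` and the density `1 / e₁` stay fixed from the start; `D₁` and `D₂`
  -- collect the errors of the rounds.
  record Inv (c e₁ D₁ D₂ : ℕ) (R : List V) : Set where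
    field
      sparse : ∀ v τ → v ∈ R → c * (r * # (S (v , τ)) R) ≤ suc c * length R + D₁
      dense  : ∀ v → v ∈ R → length R * length R ≤ e₁ * e (v , true) R + D₂

  record Fits (c e₁ D₁ D₂ y m g : ℕ) : Set where
    field
      few-fits  : 8 * m + 8 * D₁ + 8 * (c * y) ≤ c * g
      many-fits : e₁ * (2 * ((10 ^ r * g) * m) + 2 * (y * m)) + D₂ < m * m
      room-fits : r * (10 ^ r * g) + y ≤ m
      2y<m      : 2 * y < m

  inv⇒robust : ∀ {c e₁ D₁ D₂ y g R} → 0 < c → Inv c e₁ D₁ D₂ R → Fits c e₁ D₁ D₂ y (length R) g → Robust g y R
  inv⇒robust {c} {e₁} {D₁} {D₂} {y} {g} {R} 0<c inv fits = record
    { few  = λ v τ v∈ → *-cancelˡ-≤ c {{>-nonZero 0<c}}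
        (few-from-sparse c (length R) D₁ y g (r * # (S (v , τ)) R) (sparse v τ v∈) few-fits)
    ; many = λ v v∈ → *-cancelˡ-< e₁ _ _ (+-cancelʳ-< D₂ _ _ (<-≤-trans many-fits (dense v v∈)))
    ; room = room-fits
    ; big  = ≤-<-trans (m≤m+n y (y + 0)) 2y<m }
    where
    open Inv inv
    open Fits fits
  module Iterate (c e₁ D₁* D₂* s Λ K n E₁ ε E₂ : ℕ) (0<s : 0 < s) (0<c : 0 < c)
    (n≤Λs : n ≤ Λ * s)
    (fits : ∀ m → K < m → m ≤ n → ∃ (Fits c e₁ D₁* D₂* (r * s) m))
    (E₁≥ : suc c * (8 * (Λ * (Λ * Λ))) + ε ≤ E₁)
    (ε≥ : 2 * (c * (r * ((r * s) * (r * s)))) ≤ K * ε)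
    (E₂≥ : 2 * (e₁ * (n * (8 * (Λ * (Λ * Λ))))) + 4 * (e₁ * ((r * s) * (r * s))) + (r * s) * (r * s) ≤ E₂) where

    y β : ℕ
    y = r * s
    β = 8 * (Λ * (Λ * Λ))

    weaken : ∀ {D₁ D₂ m g} → D₁ ≤ D₁* → D₂ ≤ D₂* → Fits c e₁ D₁* D₂* y m g → Fits c e₁ D₁ D₂ y m g
    weaken {m = m} h₁ h₂ f = record
      { few-fits  = ≤-trans (+-monoˡ-≤ _ (+-monoʳ-≤ (8 * m) (*-monoʳ-≤ 8 h₁))) (Fits.few-fits f)
      ; many-fits = ≤-<-trans (+-monoʳ-≤ _ h₂) (Fits.many-fits f)
      ; room-fits = Fits.room-fits f
      ; 2y<m      = Fits.2y<m f }

    length-tiling : ∀ {ts} → Tiling ts → length (concat ts) ≡ r * length ts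
    length-tiling All.[] = sym (*-zeroʳ r)
    length-tiling {T ∷ ts} ((eq , _) All.∷ h) = trans (length-++ T)
      (trans (cong₂ _+_ eq (length-tiling h)) (sym (*-suc r (length ts))))

    module Advance (R : List V) (D₁ D₂ g : ℕ) (m≤n : length R ≤ n) (K<m : K < length R)
      (inv : Inv c e₁ D₁ D₂ R) (fit : Fits c e₁ D₁* D₂* y (length R) g) (Q : Result s Λ R) where

      open Result Q public

      m m″ : ℕ
      m = length R
      m″ = length R″

      lenR : m ≡ y + (length trash + m″)
      lenR = trans (↭-length partition) (trans (length-++ (concat tiles))
        (cong₂ _+_ (trans (length-tiling tiling) (cong (r *_) count)) (length-++ trash)))

      m″≤ : m″ + y ≤ m
      m″≤ = ≤-trans (≤-reflexive (+-comm m″ y)) (≤-trans (+-monoʳ-≤ y (m≤n+m m″ _)) (≤-reflexive (sym lenR)))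

      R″⊑R : R″ ⊑ R
      R″⊑R = concat tiles ++ trash , ↭-trans partition
        (↭-trans (↭-reflexive (sym (++-assoc (concat tiles) trash R″))) (++-comm _ R″))

      0<m : 0 < m
      0<m = ≤-<-trans z≤n K<m

      inv″ : Inv c e₁ (D₁ + E₁) (D₂ + E₂) R″
      inv″ = record
        { sparse = λ v τ v∈ → *-cancelˡ-≤ m {{>-nonZero 0<m}}
            (sparse-round c r m m″ (length trash) y D₁ E₁ ε K (# (S (v , τ)) R) (# (S (v , τ)) R″) β
              lenR small-trash (<⇒≤ K<m) (Inv.sparse inv v τ (∈-⊑ R″⊑R v∈)) (few-after v τ v∈) E₁≥ ε≥)
        ; dense = λ v v∈ → *-cancelˡ-≤ m {{>-nonZero 0<m}}
            (dense-round e₁ m m″ n y D₂ E₂ (e (v , true) R) (e (v , true) R″) β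
              (<⇒≤ (Fits.2y<m fit)) m″≤ m≤n (Inv.dense inv v (∈-⊑ R″⊑R v∈)) (many-after v v∈) E₂≥) }

    Goal : ℕ → List V → Set
    Goal fuel R = ∃ λ ts → ∃ λ rest → Tiling ts × R ↭ concat ts ++ rest × length rest ≤ K + fuel * β

    prepend : ∀ {fuel R} (Q : Result s Λ R) → Goal fuel (Result.R″ Q) → Goal (suc fuel) R
    prepend {fuel} Q (ts , rest , tiling′ , perm , len) =
      tiles ++ ts , trash ++ rest , Allₚ.++⁺ tiling tiling′ ,
      ↭-trans partition (↭-trans (++⁺ˡ (concat tiles) (++⁺ˡ trash perm))
        (reorder (concat tiles) trash (concat ts) rest (concat-++ tiles ts))) ,
      ≤-trans (≤-reflexive (length-++ trash)) (≤-trans (small-trash ⊕ len) (≤-reflexive (rot K β (fuel * β))))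
      where
      open Result Q
      rot : ∀ K β f → β + (K + f) ≡ K + (β + f)
      rot = solve-∀
      reorder : ∀ (as bs cs ds : List V) {ac} → as ++ cs ≡ ac → as ++ (bs ++ (cs ++ ds)) ↭ ac ++ (bs ++ ds)
      reorder as bs cs ds refl = ↭-trans (++⁺ˡ as (↭-trans (↭-reflexive (sym (++-assoc bs cs ds)))
        (↭-trans (++⁺ʳ ds (++-comm bs cs)) (↭-reflexive (++-assoc cs bs ds)))))
        (↭-reflexive (sym (++-assoc as cs (bs ++ ds))))

    -- The errors of all rounds to come are reserved in advance, so the bounds `D₁*` and `D₂*`, for
    -- which `fits` is known, hold in every round. Each round uses one unit of fuel and removes at
    -- least `y` vertices.
    iterate : ∀ fuel D₁ D₂ R → Inv c e₁ D₁ D₂ R → length R ≤ n → length R ≤ K + fuel * y →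
      D₁ + fuel * E₁ ≤ D₁* → D₂ + fuel * E₂ ≤ D₂* → Goal fuel R
    iterate fuel D₁ D₂ R inv m≤n m≤ hD₁ hD₂ with length R ≤? K
    ... | yes small = [] , R , All.[] , ↭-refl , ≤-trans small (m≤m+n K (fuel * β))
    iterate zero D₁ D₂ R inv m≤n m≤ hD₁ hD₂ | no ¬small =
      ⊥-elim (¬small (≤-trans m≤ (≤-reflexive (+-identityʳ K))))
    iterate (suc fuel) D₁ D₂ R inv m≤n m≤ hD₁ hD₂ | no ¬small = next (fits (length R) (≰⇒> ¬small) m≤n)
      where
      rot : ∀ K y f → K + (y + f) ≡ K + f + y
      rot = solve-∀

      go : ∀ g → Fits c e₁ D₁* D₂* y (length R) g → Result s Λ R → Goal (suc fuel) R
      go g fit Q = prepend {fuel} Q (iterate fuel (D₁ + E₁) (D₂ + E₂) R″ inv″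
        (≤-trans (m+n≤o⇒m≤o m″ m″≤) m≤n)
        (+-cancelʳ-≤ y _ _ (≤-trans m″≤ (≤-trans m≤ (≤-reflexive (rot K y (fuel * y))))))
        (≤-trans (≤-reflexive (+-assoc D₁ E₁ _)) hD₁) (≤-trans (≤-reflexive (+-assoc D₂ E₂ _)) hD₂))
        where open Advance R D₁ D₂ g m≤n (≰⇒> ¬small) inv fit Q

      next : ∃ (Fits c e₁ D₁* D₂* y (length R)) → Goal (suc fuel) R
      next (g , fit) = go g fit (Round.round g s Λ R 0<s (≤-trans m≤n n≤Λs) (inv⇒robust 0<c inv
        (weaken (≤-trans (m≤m+n D₁ _) hD₁) (≤-trans (m≤m+n D₂ _) hD₂) fit)))

-- Absorption

Tup : Set → ℕ → Set
Tup X zero    = ⊤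
Tup X (suc m) = X × Tup X m

tups : List X → ∀ m → List (Tup X m)
tups xs zero    = tt ∷ []
tups xs (suc m) = cartesianProduct xs (tups xs m)

∑-tups : (xs : List X) (m : ℕ) {f : Tup X (suc m) → ℕ} →
  ∑ (tups xs (suc m)) f ≡ ∑ xs (λ x → ∑ (tups xs m) (λ t → f (x , t)))
∑-tups xs m = ∑-product xs (tups xs m)

length-product : (xs : List X) (ys : List Y) → length (cartesianProduct xs ys) ≡ length xs * length ys
length-product xs ys = trans (length-∑ (cartesianProduct xs ys)) (trans (∑-product xs ys)
  (trans (∑-cong xs (λ _ → sym (length-∑ ys))) (∑-const (length ys) xs)))

length-tups : (xs : List X) (m : ℕ) → length (tups xs m) ≡ length xs ^ m
length-tups xs zero    = refl
length-tups xs (suc m) = trans (length-product xs (tups xs m)) (cong (length xs *_) (length-tups xs m))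

flat : (X → List Y) → ∀ {m} → Tup X m → List Y
flat f {zero}  _        = []
flat f {suc m} (x , xs) = f x ++ flat f xs

⟦∧⟧ : ∀ a b → ⟦ a ∧ b ⟧ ≡ ⟦ a ⟧ * ⟦ b ⟧
⟦∧⟧ true  b = sym (+-identityʳ ⟦ b ⟧)
⟦∧⟧ false b = refl

⟦∧-not⟧ : ∀ a b → ⟦ a ⟧ ≤ ⟦ a ∧ b ⟧ + ⟦ not b ⟧
⟦∧-not⟧ false b     = z≤n
⟦∧-not⟧ true  true  = ≤-refl
⟦∧-not⟧ true  false = ≤-refl

#-∧ : (p q : X → Bool) (xs : List X) → # p xs ≤ # (λ x → p x ∧ q x) xs + # (not ∘ q) xs
#-∧ p q xs = ≤-trans (∑-mono xs (λ {x} _ → ⟦∧-not⟧ (p x) (q x))) (≤-reflexive (∑-+ xs _ _))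

#-true : (xs : List X) → # (λ _ → true) xs ≡ length xs
#-true xs = sym (length-∑ xs)

∑-∈ : (xs : List X) {f : X → ℕ} {x : X} → x ∈ xs → f x ≤ ∑ xs f
∑-∈ (x ∷ xs) {f} (here refl) = m≤m+n (f x) _
∑-∈ (y ∷ xs) {f} (there h)   = ≤-trans (∑-∈ xs h) (m≤n+m _ (f y))

concat-map-↭ : (f : X → List Y) {xs ys : List X} → xs ↭ ys → concat (map f xs) ↭ concat (map f ys)
concat-map-↭ f Perm.refl  = ↭-refl
concat-map-↭ f (prep x p) = ++⁺ˡ (f x) (concat-map-↭ f p)
concat-map-↭ f (swap {xs} {ys} x y p) = ↭-trans (↭-reflexive (sym (++-assoc (f x) (f y) _)))
  (↭-trans (++⁺ (++-comm (f x) (f y)) (concat-map-↭ f p)) (↭-reflexive (++-assoc (f y) (f x) _)))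
concat-map-↭ f (Perm.trans p q) = ↭-trans (concat-map-↭ f p) (concat-map-↭ f q)

^-distribʳ-* : ∀ t a b → (a * b) ^ t ≡ a ^ t * b ^ t
^-distribʳ-* zero    a b = refl
^-distribʳ-* (suc t) a b = trans (cong ((a * b) *_) (^-distribʳ-* t a b)) (arr a b (a ^ t) (b ^ t))
  where
  arr : ∀ a b c d → (a * b) * (c * d) ≡ (a * c) * (b * d)
  arr = solve-∀

module Absorb {V : Set} (N : V × Bool → V → Bool) (eqb : V → V → Bool)
  (eqb-sound : ∀ v w → eqb v w ≡ false → v ≢ w)
  (Vs : List V) (complete : ∀ v → v ∈ Vs) (once : ∀ w → # (λ v → eqb v w) Vs ≤ 1) (ρ k e₁ : ℕ)
  (n≡rk : length Vs ≡ (3 + ρ) * k) (notN : ∀ i → # (not ∘ N i) Vs ≤ k) where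

  open Chains N

  n r : ℕ
  n = length Vs
  r = 3 + ρ

  Tiling : List (List V) → Set
  Tiling = All (λ T → length T ≡ r × Chain T)

  toL : ∀ {m} → Tup V m → List V
  toL = flat [_]

  length-toL : ∀ {m} (t : Tup V m) → length (toL t) ≡ m
  length-toL {zero}  _       = refl
  length-toL {suc m} (v , t) = cong suc (length-toL t)

  -- Chains inside `C` in a form that can be counted: each vertex restricts `C` to its
  -- neighbourhood, and only the last two vertices rely on the density of pairs in a set of size
  -- `k`.
  cone : ∀ m → (V → Bool) → Tup V (2 + m) → Bool
  cone zero    C (a , b , _) = C a ∧ (C b ∧ M a b)
  cone (suc m) C (v , vs)    = C v ∧ cone m (λ x → C x ∧ N (v , true) x) vs

  cone-sound : ∀ m C vs → cone m C vs ≡ true → Chain (toL vs) × All (λ v → C v ≡ true) (toL vs)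
  cone-sound zero C (a , b , _) h =
    let Ca , h₁ = ∧-true h
        Cb , Mab = ∧-true h₁
        τ , Nab = M⇒N Mab
    in cons τ (Nab All.∷ All.[]) (cons true All.[] nil) , Ca All.∷ Cb All.∷ All.[]
  cone-sound (suc m) C (v , vs) h =
    let Cv , h₁ = ∧-true h
        ch , all = cone-sound m _ vs h₁
    in cons true (All.map (λ z → proj₂ (∧-true z)) all) ch , Cv All.∷ All.map (λ z → proj₁ (∧-true z)) all

  conns : ∀ {j} → Tup V j → Tup V j → Tup (Tup V (2 + ρ)) j → Bool
  conns {zero}  _        _        _        = true
  conns {suc j} (q , qs) (t , ts) (c , cs) = cone ρ (λ x → N (q , true) x ∧ N (t , true) x) c ∧ conns qs ts cs

  -- The component (t , cs) consists of a tile t and, for each i, a set cs i that forms a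
  -- tile with t i; it absorbs Q if every cs i also forms a tile with Q i.
  Absorber : Set
  Absorber = Tup V r × Tup (Tup V (2 + ρ)) r

  As : List Absorber
  As = cartesianProduct (tups Vs r) (tups (tups Vs (2 + ρ)) r)

  Qs : List (Tup V r)
  Qs = tups Vs r

  absorbs : Tup V r → Absorber → Bool
  absorbs Q (t , cs) = cone (1 + ρ) (λ _ → true) t ∧ conns Q t cs

  vertices : Absorber → List V
  vertices (t , cs) = toL t ++ flat toL cs

  conns-tiling : ∀ {j} (qs ts : Tup V j) cs → conns qs ts cs ≡ true →
    (∃ λ us → Tiling us × concat us ↭ toL qs ++ flat toL cs) × (∃ λ us → Tiling us × concat us ↭ toL ts ++ flat toL cs)
  conns-tiling {zero}  _ _ _ _ = ([] , All.[] , ↭-refl) , ([] , All.[] , ↭-refl)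
  conns-tiling {suc j} (q , qs) (t , ts) (c , cs) h =
    let h₁ , h₂ = ∧-true h
        ch , all = cone-sound ρ _ c h₁
        (us , tu , pu) , (ws , tw , pw) = conns-tiling qs ts cs h₂
    in ((q ∷ toL c) ∷ us , (cong suc (length-toL c) , cons true (All.map (λ z → proj₁ (∧-true z)) all) ch) All.∷ tu ,
          prep q (rearrange (toL c) (toL qs) (flat toL cs) pu))
     , ((t ∷ toL c) ∷ ws , (cong suc (length-toL c) , cons true (All.map (λ z → proj₂ (∧-true z)) all) ch) All.∷ tw ,
          prep t (rearrange (toL c) (toL ts) (flat toL cs) pw))
    where
    rearrange : ∀ (as bs cs : List V) {us} → us ↭ bs ++ cs → as ++ us ↭ bs ++ (as ++ cs)
    rearrange as bs cs p = ↭-trans (++⁺ˡ as p) (↭-trans (↭-reflexive (sym (++-assoc as bs cs)))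
      (↭-trans (++⁺ʳ cs (++-comm as bs)) (↭-reflexive (++-assoc bs as cs))))

  tile-alone : ∀ Q A → absorbs Q A ≡ true → ∃ λ us → Tiling us × concat us ↭ vertices A
  tile-alone Q (t , cs) h = proj₂ (conns-tiling Q t cs (proj₂ (∧-true {cone (1 + ρ) (λ _ → true) t} h)))

  tile-with : ∀ Q A → absorbs Q A ≡ true → ∃ λ us → Tiling us × concat us ↭ toL Q ++ vertices A
  tile-with Q (t , cs) h =
    let h₁ , h₂ = ∧-true {cone (1 + ρ) (λ _ → true) t} h
        (us , tu , pu) , _ = conns-tiling Q t cs h₂
    in toL t ∷ us , (length-toL t , proj₁ (cone-sound (1 + ρ) _ t h₁)) All.∷ tu ,
       ↭-trans (++⁺ˡ (toL t) pu) (↭-trans (↭-reflexive (sym (++-assoc (toL t) (toL Q) _)))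
         (↭-trans (++⁺ʳ (flat toL cs) (++-comm (toL t) (toL Q))) (↭-reflexive (++-assoc (toL Q) (toL t) _))))

  used : List Absorber → List V
  used F = concat (map vertices F)

  Valid : Absorber → Set
  Valid A = ∃ λ Q → absorbs Q A ≡ true

  groups : List (Tup V r) → List V
  groups L = concat (map toL L)

  tile-used : ∀ {F} → All Valid F → ∃ λ us → Tiling us × concat us ↭ used F
  tile-used All.[] = [] , All.[] , ↭-refl
  tile-used {A ∷ F} ((Q , h) All.∷ hs) =
    let us , tu , pu = tile-alone Q A h
        ws , tw , pw = tile-used hs
    in us ++ ws , Allₚ.++⁺ tu tw , ↭-trans (↭-reflexive (sym (concat-++ us ws))) (++⁺ pu pw)

  -- Serving one tuple removes one absorber, which costs any other tuple at most one of its own.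
  -- Absorbers can thus be assigned in any order if each tuple has as many as there are tuples;
  -- those never called upon tile themselves.
  absorb-all : ∀ L F → All Valid F → (∀ Q → length L ≤ # (absorbs Q) F) →
    ∃ λ us → Tiling us × concat us ↭ groups L ++ used F
  absorb-all []      F valid many = tile-used valid
  absorb-all (Q ∷ L) F valid many =
    let A , A∈ , h₀ = ∑-pos F _ (≤-trans (s≤s z≤n) (many Q))
        h = ⟦⟧-pos h₀
        F′ , p = ∈-split A∈
        us , tu , pu = tile-with Q A h
        ws , tw , pw = absorb-all L F′ (All.tail (All-resp-↭ p valid)) (λ Q′ → s≤s⁻¹ (≤-trans (many Q′)
          (≤-trans (≤-reflexive (∑-↭ p)) (+-monoˡ-≤ _ (⟦⟧≤1 (absorbs Q′ A))))))
    in us ++ ws , Allₚ.++⁺ tu tw ,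
       ↭-trans (↭-reflexive (sym (concat-++ us ws))) (↭-trans (++⁺ pu pw)
         (↭-trans (regroup (toL Q) (vertices A) (groups L) (used F′)) (++⁺ˡ (toL Q ++ groups L) (↭-sym (concat-map-↭ vertices p)))))
    where
    regroup : ∀ (as bs cs ds : List V) → (as ++ bs) ++ (cs ++ ds) ↭ (as ++ cs) ++ (bs ++ ds)
    regroup as bs cs ds = ↭-trans (↭-reflexive (++-assoc as bs (cs ++ ds))) (↭-trans (++⁺ˡ as
      (↭-trans (↭-reflexive (sym (++-assoc bs cs ds))) (↭-trans (++⁺ʳ ds (++-comm bs cs)) (↭-reflexive (++-assoc cs bs ds)))))
      (↭-reflexive (sym (++-assoc as cs (bs ++ ds)))))

  module Counting (edges : ∀ C → k ≤ # C Vs → n * n ≤ e₁ * ∑ Vs (λ a → ∑ Vs (λ b → ⟦ C a ∧ (C b ∧ M a b) ⟧))) where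

    -- A vertex can be chosen in at least `k = n / r` ways, hence a factor `r`, and shrinks `C` by
    -- at most `k`. So `k` vertices remain for the final pair.
    cone-count : ∀ m C → suc m * k ≤ # C Vs → n ^ (2 + m) ≤ (r ^ m * e₁) * # (cone m C) (tups Vs (2 + m))
    cone-count zero C h = begin
      n * (n * 1)
        ≡⟨ cong (n *_) (*-identityʳ n) ⟩
      n * n
        ≤⟨ edges C (subst (_≤ # C Vs) (+-identityʳ k) h) ⟩
      e₁ * ∑ Vs (λ a → ∑ Vs (λ b → ⟦ C a ∧ (C b ∧ M a b) ⟧))
        ≡⟨ cong₂ _*_ (sym (+-identityʳ e₁)) (sym (trans (∑-tups Vs 1) (∑-cong Vs (λ a →
             trans (∑-tups Vs 0) (∑-cong Vs (λ b → +-identityʳ _)))))) ⟩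
      (1 * e₁) * # (cone 0 C) (tups Vs 2) ∎
      where open ≤-Reasoning
    cone-count (suc m) C h = begin
      n * n ^ (2 + m)
        ≡⟨ cong (_* n ^ (2 + m)) n≡rk ⟩
      r * k * n ^ (2 + m)
        ≤⟨ *-monoˡ-≤ (n ^ (2 + m)) (*-monoʳ-≤ r (m+n≤o⇒m≤o k h)) ⟩
      r * # C Vs * n ^ (2 + m)
        ≡⟨ trans (*-assoc r (# C Vs) (n ^ (2 + m))) (cong (r *_) (sym (∑-*ʳ (n ^ (2 + m)) Vs (λ v → ⟦ C v ⟧)))) ⟩
      r * ∑ Vs (λ v → ⟦ C v ⟧ * n ^ (2 + m))
        ≤⟨ *-monoʳ-≤ r (∑-mono Vs (λ {v} _ → *-monoʳ-≤ ⟦ C v ⟧ (cone-count m (next v) (shrink v)))) ⟩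
      r * ∑ Vs (λ v → ⟦ C v ⟧ * ((r ^ m * e₁) * # (cone m (next v)) (tups Vs (2 + m))))
        ≡⟨ cong (r *_) (trans (∑-cong Vs (λ v → arr ⟦ C v ⟧ (r ^ m * e₁) _)) (∑-* (r ^ m * e₁) Vs _)) ⟩
      r * ((r ^ m * e₁) * ∑ Vs (λ v → ⟦ C v ⟧ * # (cone m (next v)) (tups Vs (2 + m))))
        ≡⟨ arr₂ r (r ^ m) e₁ _ ⟩
      (r * r ^ m * e₁) * ∑ Vs (λ v → ⟦ C v ⟧ * # (cone m (next v)) (tups Vs (2 + m)))
        ≡⟨ cong ((r * r ^ m * e₁) *_) (sym (trans (∑-tups Vs (2 + m)) (∑-cong Vs (λ v →
             trans (∑-cong (tups Vs (2 + m)) (λ t → ⟦∧⟧ (C v) _)) (∑-* ⟦ C v ⟧ (tups Vs (2 + m)) _))))) ⟩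
      (r ^ suc m * e₁) * # (cone (suc m) C) (tups Vs (3 + m)) ∎
      where
      open ≤-Reasoning
      next : V → V → Bool
      next v x = C x ∧ N (v , true) x
      shrink : ∀ v → suc m * k ≤ # (next v) Vs
      shrink v = +-cancelʳ-≤ k _ _ (≤-trans (≤-reflexive (+-comm (suc m * k) k)) (≤-trans h
        (≤-trans (#-∧ C (N (v , true)) Vs) (+-monoʳ-≤ _ (notN (v , true))))))
      arr : ∀ a b c → a * (b * c) ≡ b * (a * c)
      arr = solve-∀
      arr₂ : ∀ r p e x → r * ((p * e) * x) ≡ (r * p * e) * x
      arr₂ = solve-∀

    conn-count : ∀ q t → n ^ (2 + ρ) ≤ (r ^ ρ * e₁) * # (cone ρ (λ x → N (q , true) x ∧ N (t , true) x)) (tups Vs (2 + ρ))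
    conn-count q t = cone-count ρ _ (+-cancelʳ-≤ (k + k) _ _ (begin
      suc ρ * k + (k + k)
        ≡⟨ arr ρ k ⟩
      (3 + ρ) * k
        ≡⟨ sym n≡rk ⟩
      n
        ≡⟨ sym (#-true Vs) ⟩
      # (λ _ → true) Vs
        ≤⟨ #-∧ (λ _ → true) (N (q , true)) Vs ⟩
      # (N (q , true)) Vs + # (not ∘ N (q , true)) Vs
        ≤⟨ #-∧ (N (q , true)) (N (t , true)) Vs ⊕ notN (q , true) ⟩
      # (λ x → N (q , true) x ∧ N (t , true) x) Vs + # (not ∘ N (t , true)) Vs + k
        ≤⟨ +-monoˡ-≤ k (+-monoʳ-≤ _ (notN (t , true))) ⟩
      # (λ x → N (q , true) x ∧ N (t , true) x) Vs + k + k
        ≡⟨ +-assoc _ k k ⟩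
      # (λ x → N (q , true) x ∧ N (t , true) x) Vs + (k + k) ∎))
      where
      open ≤-Reasoning
      arr : ∀ ρ k → suc ρ * k + (k + k) ≡ (3 + ρ) * k
      arr = solve-∀

    cₛ cₜ q₀ : ℕ
    cₛ = r ^ ρ * e₁
    cₜ = r ^ (1 + ρ) * e₁
    q₀ = cₜ * cₛ ^ r

    interchange* : ∀ a b c d → (a * b) * (c * d) ≡ (a * c) * (b * d)
    interchange* = solve-∀

    conns-count : ∀ {j} (qs ts : Tup V j) → (n ^ (2 + ρ)) ^ j ≤ cₛ ^ j * # (conns qs ts) (tups (tups Vs (2 + ρ)) j)
    conns-count {zero}  _        _        = ≤-refl
    conns-count {suc j} (q , qs) (t , ts) = begin
      n ^ (2 + ρ) * (n ^ (2 + ρ)) ^ j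
        ≤⟨ *-mono-≤ (conn-count q t) (conns-count qs ts) ⟩
      (cₛ * # p Ss) * (cₛ ^ j * # (conns qs ts) (tups Ss j))
        ≡⟨ interchange* cₛ (# p Ss) (cₛ ^ j) _ ⟩
      cₛ ^ suc j * (# p Ss * # (conns qs ts) (tups Ss j))
        ≡⟨ cong (cₛ ^ suc j *_) (sym (trans (∑-tups Ss j) (trans (∑-cong Ss (λ c →
             trans (∑-cong (tups Ss j) (λ cs → ⟦∧⟧ (p c) _)) (∑-* ⟦ p c ⟧ (tups Ss j) _))) (∑-*ʳ _ Ss _)))) ⟩
      cₛ ^ suc j * # (conns (q , qs) (t , ts)) (tups Ss (suc j)) ∎
      where
      open ≤-Reasoning
      Ss : List (Tup V (2 + ρ))
      Ss = tups Vs (2 + ρ)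
      p : Tup V (2 + ρ) → Bool
      p = cone ρ (λ x → N (q , true) x ∧ N (t , true) x)

    length-As : length As ≡ n ^ r * (n ^ (2 + ρ)) ^ r
    length-As = trans (length-product (tups Vs r) _) (cong₂ _*_ (length-tups Vs r)
      (trans (length-tups (tups Vs (2 + ρ)) r) (cong (_^ r) (length-tups Vs (2 + ρ)))))

    absorbs-count : ∀ Q → length As ≤ q₀ * # (absorbs Q) As
    absorbs-count Q = begin
      length As
        ≡⟨ length-As ⟩
      n ^ r * (n ^ (2 + ρ)) ^ r
        ≤⟨ *-monoˡ-≤ _ (cone-count (1 + ρ) (λ _ → true) all) ⟩
      (cₜ * # (cone (1 + ρ) (λ _ → true)) (tups Vs r)) * (n ^ (2 + ρ)) ^ r
        ≡⟨ trans (*-assoc cₜ _ _) (cong (cₜ *_) (sym (∑-*ʳ _ (tups Vs r) _))) ⟩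
      cₜ * ∑ (tups Vs r) (λ t → ⟦ cone (1 + ρ) (λ _ → true) t ⟧ * (n ^ (2 + ρ)) ^ r)
        ≤⟨ *-monoʳ-≤ cₜ (∑-mono (tups Vs r) (λ {t} _ → *-monoʳ-≤ ⟦ cone (1 + ρ) (λ _ → true) t ⟧ (conns-count Q t))) ⟩
      cₜ * ∑ (tups Vs r) (λ t → ⟦ cone (1 + ρ) (λ _ → true) t ⟧ * (cₛ ^ r * # (conns Q t) Ts))
        ≡⟨ cong (cₜ *_) (trans (∑-cong (tups Vs r) (λ t → arr ⟦ cone (1 + ρ) (λ _ → true) t ⟧ (cₛ ^ r) (# (conns Q t) Ts)))
             (∑-* (cₛ ^ r) (tups Vs r) _)) ⟩
      cₜ * (cₛ ^ r * ∑ (tups Vs r) (λ t → ⟦ cone (1 + ρ) (λ _ → true) t ⟧ * # (conns Q t) Ts))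
        ≡⟨ sym (*-assoc cₜ (cₛ ^ r) _) ⟩
      q₀ * ∑ (tups Vs r) (λ t → ⟦ cone (1 + ρ) (λ _ → true) t ⟧ * # (conns Q t) Ts)
        ≡⟨ cong (q₀ *_) (sym (trans (∑-product (tups Vs r) Ts) (∑-cong (tups Vs r) (λ t →
             trans (∑-cong Ts (λ cs → ⟦∧⟧ (cone (1 + ρ) (λ _ → true) t) _)) (∑-* ⟦ cone (1 + ρ) (λ _ → true) t ⟧ Ts _))))) ⟩
      q₀ * # (absorbs Q) As ∎
      where
      open ≤-Reasoning
      Ts : List (Tup (Tup V (2 + ρ)) r)
      Ts = tups (tups Vs (2 + ρ)) r
      all : (2 + ρ) * k ≤ # (λ _ → true) Vs
      all = ≤-trans (m≤n+m ((2 + ρ) * k) k) (≤-reflexive (trans (sym n≡rk) (sym (#-true Vs))))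
      arr : ∀ a b c → a * (b * c) ≡ b * (a * c)
      arr = solve-∀

  -- Choosing disjoint absorbers

  take-tuple : ∀ m (L : List V) → m ≤ length L → ∃ λ (Q : Tup V m) → ∃ λ L′ → L ≡ toL Q ++ L′
  take-tuple zero    L       _       = tt , L , refl
  take-tuple (suc m) (v ∷ L) (s≤s h) = let Q , L′ , eq = take-tuple m L h in (v , Q) , L′ , cong (v ∷_) eq

  chunk : ∀ j (L : List V) → length L ≡ j * r → ∃ λ Qs → groups Qs ≡ L × length Qs ≡ j
  chunk zero    []      _  = [] , refl , refl
  chunk (suc j) L       eq = split (take-tuple r L (≤-trans (m≤m+n r (j * r)) (≤-reflexive (sym eq)))) eq
    where
    split : ∀ {L} → (∃ λ (Q : Tup V r) → ∃ λ L′ → L ≡ toL Q ++ L′) → length L ≡ suc j * r →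
      ∃ λ Qs → groups Qs ≡ L × length Qs ≡ suc j
    split (Q , L′ , refl) eq =
      let Qs , eq₁ , eq₂ = chunk j L′ (+-cancelˡ-≡ r _ _ (trans (cong (_+ length L′) (sym (length-toL Q)))
            (trans (sym (length-++ (toL Q))) eq)))
      in Q ∷ Qs , cong (toL Q ++_) eq₁ , cong suc eq₂

  mem : V → List V → Bool
  mem v []      = false
  mem v (w ∷ W) = eqb v w ∨ mem v W

  mem-∉ : ∀ v W → mem v W ≡ false → v ∈ W → ⊥
  mem-∉ v (w ∷ W) h (here refl) = eqb-sound v w (proj₁ (∨-false h)) refl
  mem-∉ v (w ∷ W) h (there m)   = mem-∉ v W (proj₂ (∨-false {eqb v w} h)) m

  #-mem : ∀ W → # (λ v → mem v W) Vs ≤ length W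
  #-mem []      = ≤-reflexive (∑-zero Vs)
  #-mem (w ∷ W) = ≤-trans (∑-mono Vs (λ {v} _ → ⟦∨⟧ (eqb v w) (mem v W)))
    (≤-trans (≤-reflexive (∑-+ Vs _ _)) (once w ⊕ #-mem W))

  fresh : List V → List V → Bool
  fresh W []       = true
  fresh W (v ∷ vs) = not (mem v W) ∧ fresh (v ∷ W) vs

  push : List V → List V → List V
  push []       W = W
  push (v ∷ vs) W = push vs (v ∷ W)

  push-↭ : ∀ us W → push us W ↭ us ++ W
  push-↭ []       W = ↭-refl
  push-↭ (u ∷ us) W = ↭-trans (push-↭ us (u ∷ W)) (shift u us W)

  fresh-++ : ∀ W us vs → fresh W (us ++ vs) ≡ fresh W us ∧ fresh (push us W) vs
  fresh-++ W []       vs = refl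
  fresh-++ W (u ∷ us) vs with mem u W
  ... | true  = refl
  ... | false = fresh-++ (u ∷ W) us vs

  fresh-⊑ : ∀ us W → W ⊑ Vs → fresh W us ≡ true → push us W ⊑ Vs
  fresh-⊑ []       W W⊑ h = W⊑
  fresh-⊑ (u ∷ us) W (R , p) h with ∧-true {not (mem u W)} h
  ... | u∉ , h′ with ∈-++⁻ W (∈-resp-↭ p (complete u))
  ...   | inj₁ m = ⊥-elim (mem-∉ u W (not-true u∉) m)
  ...   | inj₂ m = let R′ , p′ = ∈-split m in
    fresh-⊑ us (u ∷ W) (R′ , ↭-trans p (↭-trans (++⁺ˡ W p′) (shift u W R′))) h′

  -- A random member of xs meets W or repeats a vertex with probability at most ℓ(|W|+ℓ)/n.
  Spread : {Z : Set} → List Z → (Z → List V) → ℕ → Set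
  Spread {Z} xs f ℓ = (∀ a → length (f a) ≡ ℓ) ×
    (∀ W → n * # (λ a → not (fresh W (f a))) xs ≤ (ℓ * (length W + ℓ)) * length xs)

  not-∧ : ∀ a b → ⟦ not (a ∧ b) ⟧ ≤ ⟦ not a ⟧ + ⟦ not b ⟧
  not-∧ true  b = ≤-refl
  not-∧ false b = s≤s z≤n

  -- A union bound: the second component must avoid `W` enlarged by the first one. The final
  -- estimate leaves `ℓ * ℓ′` as slack.
  spread-product : {Z Z′ : Set} (xs : List Z) (ys : List Z′) (f : Z → List V) (g : Z′ → List V) (ℓ ℓ′ : ℕ) →
    Spread xs f ℓ → Spread ys g ℓ′ → Spread (cartesianProduct xs ys) (λ { (a , b) → f a ++ g b }) (ℓ + ℓ′)
  spread-product xs ys f g ℓ ℓ′ (lf , hf) (lg , hg) =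
    (λ { (a , b) → trans (length-++ (f a)) (cong₂ _+_ (lf a) (lg b)) }) , bound
    where
    open ≤-Reasoning
    arith : ∀ x y w ℓ ℓ′ → y * ((ℓ * (w + ℓ)) * x) + x * ((ℓ′ * (ℓ + w + ℓ′)) * y) ≤ ((ℓ + ℓ′) * (w + (ℓ + ℓ′))) * (x * y)
    arith x y w ℓ ℓ′ = ≤-trans (m≤m+n _ (ℓ * ℓ′ * (x * y))) (≤-reflexive (arr x y w ℓ ℓ′))
      where
      arr : ∀ x y w ℓ ℓ′ → y * ((ℓ * (w + ℓ)) * x) + x * ((ℓ′ * (ℓ + w + ℓ′)) * y) + ℓ * ℓ′ * (x * y)
        ≡ ((ℓ + ℓ′) * (w + (ℓ + ℓ′))) * (x * y)
      arr = solve-∀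
    pushed : ∀ a W → length (push (f a) W) ≡ ℓ + length W
    pushed a W = trans (↭-length (push-↭ (f a) W)) (trans (length-++ (f a)) (cong (_+ length W) (lf a)))
    bound : ∀ W → n * # (λ { (a , b) → not (fresh W (f a ++ g b)) }) (cartesianProduct xs ys)
      ≤ ((ℓ + ℓ′) * (length W + (ℓ + ℓ′))) * length (cartesianProduct xs ys)
    bound W = begin
      n * # (λ { (a , b) → not (fresh W (f a ++ g b)) }) (cartesianProduct xs ys)
        ≡⟨ cong (n *_) (∑-product xs ys) ⟩
      n * ∑ xs (λ a → ∑ ys (λ b → ⟦ not (fresh W (f a ++ g b)) ⟧))
        ≤⟨ *-monoʳ-≤ n (∑-mono xs (λ {a} _ → ∑-mono ys (λ {b} _ → ≤-trans
             (≤-reflexive (cong (⟦_⟧ ∘ not) (fresh-++ W (f a) (g b)))) (not-∧ (fresh W (f a)) _)))) ⟩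
      n * ∑ xs (λ a → ∑ ys (λ b → ⟦ not (fresh W (f a)) ⟧ + ⟦ not (fresh (push (f a) W) (g b)) ⟧))
        ≡⟨ cong (n *_) (trans (∑-cong xs (λ a → trans (∑-+ ys _ _) (cong (_+ bad a) (∑-const ⟦ not (fresh W (f a)) ⟧ ys)))) (trans (∑-+ xs _ _)
             (cong (_+ ∑ xs bad) (∑-* (length ys) xs _)))) ⟩
      n * (length ys * # (λ a → not (fresh W (f a))) xs + ∑ xs bad)
        ≡⟨ trans (*-distribˡ-+ n _ _) (cong₂ _+_ (swp n (length ys) _) (sym (∑-* n xs bad))) ⟩
      length ys * (n * # (λ a → not (fresh W (f a))) xs) + ∑ xs (λ a → n * bad a)
        ≤⟨ *-monoʳ-≤ (length ys) (hf W) ⊕ ∑-≤-const xs (λ {a} _ → ≤-trans (hg (push (f a) W))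
             (≤-reflexive (cong (λ z → (ℓ′ * (z + ℓ′)) * length ys) (pushed a W)))) ⟩
      length ys * ((ℓ * (length W + ℓ)) * length xs) + length xs * ((ℓ′ * (ℓ + length W + ℓ′)) * length ys)
        ≤⟨ arith (length xs) (length ys) (length W) ℓ ℓ′ ⟩
      ((ℓ + ℓ′) * (length W + (ℓ + ℓ′))) * (length xs * length ys)
        ≡⟨ cong (((ℓ + ℓ′) * (length W + (ℓ + ℓ′))) *_) (sym (length-product xs ys)) ⟩
      ((ℓ + ℓ′) * (length W + (ℓ + ℓ′))) * length (cartesianProduct xs ys) ∎
      where
      bad : _ → ℕ
      bad a = ∑ ys (λ b → ⟦ not (fresh (push (f a) W) (g b)) ⟧)
      swp : ∀ a b c → a * (b * c) ≡ b * (a * c)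
      swp = solve-∀

  spread-tups : {Z : Set} (xs : List Z) (f : Z → List V) (ℓ : ℕ) → Spread xs f ℓ → ∀ m → Spread (tups xs m) (flat f) (m * ℓ)
  spread-tups xs f ℓ h zero    = (λ _ → refl) , λ W → ≤-reflexive (*-zeroʳ n)
  spread-tups xs f ℓ h (suc m) = spread-product xs (tups xs m) f (flat f) ℓ (m * ℓ) h (spread-tups xs f ℓ h m)

  spread-Vs : Spread Vs [_] 1
  spread-Vs = (λ _ → refl) , λ W → ≤-trans (*-monoʳ-≤ n (≤-trans (∑-mono Vs (λ {v} _ → le v W)) (#-mem W)))
      (≤-trans (≤-reflexive (*-comm n (length W))) (*-monoˡ-≤ n (≤-trans (m≤m+n (length W) 1) (m≤m+n _ 0))))
    where
    le : ∀ v W → ⟦ not (fresh W (v ∷ [])) ⟧ ≤ ⟦ mem v W ⟧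
    le v W with mem v W
    ... | true  = ≤-refl
    ... | false = z≤n

  ℓ : ℕ
  ℓ = r * 1 + r * ((2 + ρ) * 1)

  spread-As : Spread As vertices ℓ
  spread-As = spread-product (tups Vs r) _ toL (flat toL) (r * 1) (r * ((2 + ρ) * 1))
    (spread-tups Vs [_] 1 spread-Vs r)
    (spread-tups (tups Vs (2 + ρ)) toL ((2 + ρ) * 1) (spread-tups Vs [_] 1 spread-Vs (2 + ρ)) r)

  length-used : ∀ F → length (used F) ≡ ℓ * length F
  length-used []      = sym (*-zeroʳ ℓ)
  length-used (A ∷ F) = trans (length-++ (vertices A)) (trans (cong₂ _+_ (proj₁ spread-As A) (length-used F)) (sym (*-suc ℓ (length F))))

  module Select (q₀ : ℕ) (0<n : 0 < n) (count : ∀ Q → length As ≤ q₀ * # (absorbs Q) As) where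

    p q : ℕ
    -- Chosen so that `(p + q) / q = 2 - 1 / q`, the factor by which the total weight grows when it
    -- would double without a hit.
    p = 2 * q₀ ∸ 1
    q = 2 * q₀

    -- A proportion `1 / q₀` absorbs `Q`, and at most half of that proportion fails to be fresh.
    fresh-count : ∀ W Q → q * (ℓ * (length W + ℓ)) ≤ n →
      length As ≤ q * # (λ A → absorbs Q A ∧ fresh W (vertices A)) As
    fresh-count W Q small = go (length As) (# (absorbs Q) As) (# (λ A → absorbs Q A ∧ fresh W (vertices A)) As)
      (# (λ A → not (fresh W (vertices A))) As)
      (count Q) (#-∧ (absorbs Q) (λ A → fresh W (vertices A)) As) (proj₂ spread-As W)
      where
      go : ∀ a b c d → a ≤ q₀ * b → b ≤ c + d → n * d ≤ (ℓ * (length W + ℓ)) * a → a ≤ (2 * q₀) * c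
      go a b c d h₁ h₂ h₃ = few (*-cancelˡ-≤ n {{>-nonZero 0<n}} (≤-trans (≤-reflexive (swp n q₀ d))
          (≤-trans (*-monoʳ-≤ (2 * q₀) h₃) (≤-trans (≤-reflexive (sym (*-assoc (2 * q₀) _ a))) (*-monoˡ-≤ a small)))))
        where
        swp : ∀ n q₀ d → n * ((2 * q₀) * d) ≡ (2 * q₀) * (n * d)
        swp = solve-∀
        few : (2 * q₀) * d ≤ a → a ≤ (2 * q₀) * c
        few h = lin 0 (2 ⊗ h₁ ⊕ (2 * q₀) ⊗ h₂ ⊕ h) (arr a b c d q₀)
          where
          arr : ∀ a b c d q₀ → a + (2 * (q₀ * b) + (2 * q₀) * (c + d) + a) + 0
            ≡ (2 * q₀) * c + (2 * a + (2 * q₀) * b + (2 * q₀) * d)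
          arr = solve-∀

    -- The total weight shrinks by a fixed factor with every choice, because on average a
    -- fresh absorber halves the weight of a fixed proportion of the tuples.
    weight : List Absorber → Tup V r → ℕ
    weight []      Q = 1
    weight (A ∷ F) Q = (if absorbs Q A then 1 else 2) * weight F Q

    Φ : List Absorber → ℕ
    Φ F = ∑ Qs (weight F)

    0<weight : ∀ F Q → 0 < weight F Q
    0<weight []      Q = s≤s z≤n
    0<weight (A ∷ F) Q with absorbs Q A
    ... | true  = ≤-trans (0<weight F Q) (m≤m+n _ 0)
    ... | false = ≤-trans (0<weight F Q) (m≤m+n _ _)

    weight-count : ∀ F Q → weight F Q * 2 ^ # (absorbs Q) F ≡ 2 ^ length F
    weight-count []      Q = refl
    weight-count (A ∷ F) Q with absorbs Q A
    ... | true  = trans (arr (weight F Q) (2 ^ # (absorbs Q) F)) (cong (2 *_) (weight-count F Q))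
      where
      arr : ∀ a b → 1 * a * (2 * b) ≡ 2 * (a * b)
      arr = solve-∀
    ... | false = trans (*-assoc 2 (weight F Q) _) (cong (2 *_) (weight-count F Q))

    0<Qs : 0 < length Qs
    0<Qs = subst (0 <_) (sym (length-tups Vs r)) (m^n>0 n {{>-nonZero 0<n}} r)

    0<Φ : ∀ F → 0 < Φ F
    0<Φ F = ≤-trans 0<Qs (≤-trans (≤-reflexive (length-∑ Qs)) (∑-mono Qs (λ {Q} _ → 0<weight F Q)))

    hit : List Absorber → List V → Absorber → ℕ
    hit F W A = ∑ Qs (λ Q → weight F Q * ⟦ absorbs Q A ∧ fresh W (vertices A) ⟧)

    choose : ∀ F W → q * (ℓ * (length W + ℓ)) ≤ n → ∃ λ A → Φ F ≤ q * hit F W A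
    choose F W small =
      let A , _ , h = ∑-exists As (λ _ → Φ F) (λ A → q * hit F W A) 0<As total in A , h
      where
      open ≤-Reasoning
      instance
        n≢0 : NonZero n
        n≢0 = >-nonZero 0<n
      0<As : 0 < length As
      0<As = subst (0 <_) (sym (trans (length-product (tups Vs r) _) (cong₂ _*_ (length-tups Vs r)
        (trans (length-tups (tups Vs (2 + ρ)) r) (cong (_^ r) (length-tups Vs (2 + ρ)))))))
        (>-nonZero⁻¹ _ {{m*n≢0 (n ^ r) ((n ^ (2 + ρ)) ^ r) {{m^n≢0 n r}} {{m^n≢0 (n ^ (2 + ρ)) r {{m^n≢0 n (2 + ρ)}}}}}})
      total : ∑ As (λ _ → Φ F) ≤ ∑ As (λ A → q * hit F W A)
      total = begin
        ∑ As (λ _ → Φ F)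
          ≡⟨ trans (∑-const (Φ F) As) (trans (*-comm (length As) (Φ F)) (sym (∑-*ʳ (length As) Qs (weight F)))) ⟩
        ∑ Qs (λ Q → weight F Q * length As)
          ≤⟨ ∑-mono Qs (λ {Q} _ → *-monoʳ-≤ (weight F Q) (fresh-count W Q small)) ⟩
        ∑ Qs (λ Q → weight F Q * (q * # (λ A → absorbs Q A ∧ fresh W (vertices A)) As))
          ≡⟨ trans (∑-cong Qs (λ Q → swp (weight F Q) q _)) (∑-* q Qs _) ⟩
        q * ∑ Qs (λ Q → weight F Q * # (λ A → absorbs Q A ∧ fresh W (vertices A)) As)
          ≡⟨ cong (q *_) (trans (∑-cong Qs (λ Q → sym (∑-* (weight F Q) As _))) (∑-swap Qs As _)) ⟩
        q * ∑ As (λ A → hit F W A)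
          ≡⟨ sym (∑-* q As _) ⟩
        ∑ As (λ A → q * hit F W A) ∎
        where
        swp : ∀ a b c → a * (b * c) ≡ b * (a * c)
        swp = solve-∀

    Chosen : ℕ → Set
    Chosen t = ∃ λ F → length F ≡ t × All Valid F × used F ⊑ Vs × q ^ t * Φ F ≤ (p + q) ^ t * length Qs

    add : ∀ {t} F W A → (2 * q₀ ≡ suc p) → length F ≡ t → All Valid F → used F ⊑ Vs →
      W ≡ used F → q ^ t * Φ F ≤ (p + q) ^ t * length Qs → Φ F ≤ q * hit F W A → Chosen (suc t)
    add {t} F W A q≡ len valid sub refl hΦ h = A ∷ F , cong suc len ,
      (proj₁ valid′ , proj₁ (∧-true (proj₂ valid′))) All.∷ valid , sub′ , hΦ′
      where
      0<q*hit : 0 < q * hit F W A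
      0<q*hit = <-≤-trans (0<Φ F) h
      0<hit : 0 < hit F W A
      0<hit = *-cancelˡ-< q 0 (hit F W A) (subst (_< q * hit F W A) (sym (*-zeroʳ q)) 0<q*hit)
      -- A positive hit shows at once that the new absorber is of use to some tuple and that it is
      -- disjoint from the old ones.
      valid′ : ∃ λ Q → (absorbs Q A ∧ fresh W (vertices A)) ≡ true
      valid′ = let Q , _ , z = ∑-pos Qs _ 0<hit in Q , ⟦⟧-pos (pos-right (weight F Q) z)
        where
        pos-right : ∀ a {b} → 0 < a * b → 0 < b
        pos-right a {zero}  z = subst (0 <_) (*-zeroʳ a) z
        pos-right a {suc b} z = s≤s z≤n
      sub′ : used (A ∷ F) ⊑ Vs
      sub′ = let R , π = fresh-⊑ (vertices A) (used F) sub (proj₂ (∧-true {absorbs (proj₁ valid′) A} (proj₂ valid′)))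
             in R , ↭-trans π (++⁺ʳ R (push-↭ (vertices A) (used F)))
      halve : ∀ a b w → (if a then 1 else 2) * w + w * ⟦ a ∧ b ⟧ ≤ 2 * w
      halve true  true  w = ≤-reflexive (arr w)
        where
        arr : ∀ w → 1 * w + w * 1 ≡ 2 * w
        arr = solve-∀
      halve true  false w = lin w (≤-refl {0}) (arr w)
        where
        arr : ∀ w → 1 * w + w * 0 + 0 + w ≡ 2 * w + 0
        arr = solve-∀
      halve false b     w = ≤-reflexive (arr w)
        where
        arr : ∀ w → 2 * w + w * 0 ≡ 2 * w
        arr = solve-∀
      drop : Φ (A ∷ F) + hit F W A ≤ 2 * Φ F
      drop = ≤-trans (≤-reflexive (sym (∑-+ Qs _ _))) (≤-trans
        (∑-mono Qs (λ {Q} _ → halve (absorbs Q A) (fresh W (vertices A)) (weight F Q))) (≤-reflexive (∑-* 2 Qs _)))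
      one : q * Φ (A ∷ F) ≤ (p + q) * Φ F
      one = go q p (Φ (A ∷ F)) (hit F W A) (Φ F) q≡ drop h
        where
        go : ∀ q p a h f → q ≡ suc p → a + h ≤ 2 * f → f ≤ q * h → q * a ≤ (p + q) * f
        go _ p a h f refl h₁ h₂ = lin 0 (suc p ⊗ h₁ ⊕ h₂) (arr p a h f)
          where
          arr : ∀ p a h f → suc p * a + (suc p * (2 * f) + suc p * h) + 0 ≡ (p + suc p) * f + (suc p * (a + h) + f)
          arr = solve-∀
      hΦ′ : q ^ suc t * Φ (A ∷ F) ≤ (p + q) ^ suc t * length Qs
      hΦ′ = begin
        q * q ^ t * Φ (A ∷ F)
          ≡⟨ swp q (q ^ t) _ ⟩
        q ^ t * (q * Φ (A ∷ F))
          ≤⟨ *-monoʳ-≤ (q ^ t) one ⟩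
        q ^ t * ((p + q) * Φ F)
          ≡⟨ swp′ (q ^ t) (p + q) _ ⟩
        (p + q) * (q ^ t * Φ F)
          ≤⟨ *-monoʳ-≤ (p + q) hΦ ⟩
        (p + q) * ((p + q) ^ t * length Qs)
          ≡⟨ sym (*-assoc (p + q) _ _) ⟩
        (p + q) ^ suc t * length Qs ∎
        where
        open ≤-Reasoning
        swp : ∀ a b c → a * b * c ≡ b * (a * c)
        swp = solve-∀
        swp′ : ∀ a b c → a * (b * c) ≡ b * (a * c)
        swp′ = solve-∀

    module _ (q≡ : 2 * q₀ ≡ suc p) (t K : ℕ) (small : q * (ℓ * (ℓ * t + ℓ)) ≤ n)
      (gap : ((p + q) ^ t * length Qs) * 2 ^ K < (2 * q) ^ t) where

      select : ∀ j → j ≤ t → Chosen j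
      select zero    _ = [] , refl , All.[] , (Vs , ↭-refl) , ≤-reflexive (cong (_+ 0) (sym (length-∑ Qs)))
      select (suc j) h =
        let F , len , valid , sub , hΦ = select j (<⇒≤ h)
            A , hA = choose F (used F) (≤-trans (*-monoʳ-≤ q (*-monoʳ-≤ ℓ (+-monoˡ-≤ ℓ
              (≤-trans (≤-reflexive (trans (length-used F) (cong (ℓ *_) len))) (*-monoʳ-≤ ℓ (<⇒≤ h)))))) small)
        in add F (used F) A q≡ len valid sub refl hΦ hA

      all-Qs : ∀ {m} (Q : Tup V m) → Q ∈ tups Vs m
      all-Qs {zero}  _       = here refl
      all-Qs {suc m} (v , Q) = ∈-cartesianProduct⁺ (complete v) (all-Qs Q)

      absorbing-family : ∃ λ F → length F ≡ t × All Valid F × used F ⊑ Vs × (∀ Q → K ≤ # (absorbs Q) F)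
      absorbing-family =
        let F , len , valid , sub , hΦ = select t ≤-refl
        in F , len , valid , sub , λ Q → many F len hΦ Q
        where
        many : ∀ F → length F ≡ t → q ^ t * Φ F ≤ (p + q) ^ t * length Qs → ∀ Q → K ≤ # (absorbs Q) F
        many F len hΦ Q with K ≤? # (absorbs Q) F
        ... | yes h = h
        -- A tuple absorbed fewer than `K` times would by itself weigh at least `2 ^ t / 2 ^ K`,
        -- which exceeds the bound on `Φ F`.
        ... | no ¬h = ⊥-elim (<⇒≱ gap (begin
          (2 * q) ^ t
            ≡⟨ ^-distribʳ-* t 2 q ⟩
          2 ^ t * q ^ t
            ≡⟨ cong (λ z → 2 ^ z * q ^ t) (sym len) ⟩
          2 ^ length F * q ^ t
            ≡⟨ cong (_* q ^ t) (sym (weight-count F Q)) ⟩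
          weight F Q * 2 ^ # (absorbs Q) F * q ^ t
            ≤⟨ *-monoˡ-≤ (q ^ t) (*-mono-≤ (∑-∈ Qs (all-Qs Q)) (^-monoʳ-≤ 2 (<⇒≤ (≰⇒> ¬h)))) ⟩
          Φ F * 2 ^ K * q ^ t
            ≡⟨ rot (Φ F) (2 ^ K) (q ^ t) ⟩
          q ^ t * Φ F * 2 ^ K
            ≤⟨ *-monoˡ-≤ (2 ^ K) hΦ ⟩
          ((p + q) ^ t * length Qs) * 2 ^ K ∎))
          where
          open ≤-Reasoning
          rot : ∀ a b c → a * b * c ≡ c * a * b
          rot = solve-∀

      absorption : ∃ λ W → length W ≡ ℓ * t × W ⊑ Vs ×
        (∀ L j → length L ≡ j * r → j ≤ K → ∃ λ us → Tiling us × concat us ↭ L ++ W)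
      absorption = from absorbing-family
        where
        from : (∃ λ F → length F ≡ t × All Valid F × used F ⊑ Vs × (∀ Q → K ≤ # (absorbs Q) F)) → _
        from (F , len , valid , sub , many) = used F , trans (length-used F) (cong (ℓ *_) len) , sub , λ L j lenL j≤K →
          let Qs , eq , lenQs = chunk j L lenL
              us , tiling , perm = absorb-all Qs F valid (λ Q → ≤-trans (≤-reflexive lenQs) (≤-trans j≤K (many Q)))
          in us , tiling , ↭-trans perm (↭-reflexive (cong (_++ used F) eq))

-- Digraphs and chains

sumᶠ≡∑ : ∀ {n} (g : Fin n → X) (f : X → ℕ) → sumᶠ (f ∘ g) ≡ ∑ (tabulate g) f
sumᶠ≡∑ {n = zero}  g f = refl
sumᶠ≡∑ {n = suc n} g f = cong (f (g zero) +_) (sumᶠ≡∑ (g ∘ suc) f)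

sumᶠ-cong : ∀ {n} {f g : Fin n → ℕ} → (∀ x → f x ≡ g x) → sumᶠ f ≡ sumᶠ g
sumᶠ-cong {zero}  h = refl
sumᶠ-cong {suc n} h = cong₂ _+_ (h zero) (sumᶠ-cong (h ∘ suc))

countᶠ≡# : ∀ {n} (p : Fin n → Bool) → countᶠ p ≡ # p (allFin n)
countᶠ≡# p = sumᶠ≡∑ id (λ x → ⟦ p x ⟧)

countᶠ-false : ∀ n → countᶠ {n} (λ _ → false) ≡ 0
countᶠ-false zero    = refl
countᶠ-false (suc n) = countᶠ-false n

countᶠ-true : ∀ n → countᶠ {n} (λ _ → true) ≡ n
countᶠ-true zero    = refl
countᶠ-true (suc n) = cong suc (countᶠ-true n)

eqᶠ : ∀ {n} → Fin n → Fin n → Bool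
eqᶠ v w = does (v Fin.≟ w)

eqᶠ-sound : ∀ {n} (v w : Fin n) → eqᶠ v w ≡ false → v ≢ w
eqᶠ-sound v w h with v Fin.≟ w
... | no ¬p = ¬p

eqᶠ-refl : ∀ {n} (v : Fin n) → eqᶠ v v ≡ true
eqᶠ-refl v with v Fin.≟ v
... | yes _ = refl
... | no ¬p = ⊥-elim (¬p refl)

countᶠ-eq : ∀ {n} (w : Fin n) → countᶠ (λ v → eqᶠ v w) ≤ 1
countᶠ-eq {suc n} zero    = ≤-reflexive (cong suc (countᶠ-false n))
countᶠ-eq {suc n} (suc w) = countᶠ-eq w

pad : ∀ {n} (p : Fin n → Bool) k → countᶠ p ≤ k → k ≤ n →
  ∃ λ q → (∀ x → p x ≡ true → q x ≡ true) × countᶠ q ≡ k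
pad {zero}  p zero    _ _ = p , (λ _ h → h) , refl
pad {suc n} p k h k≤ with p zero in eq
pad {suc n} p (suc k) (s≤s h) (s≤s k≤) | true =
  let q , sup , e = pad (p ∘ suc) k h k≤
  in (λ { zero → true ; (suc x) → q x }) , (λ { zero _ → refl ; (suc x) → sup x }) , cong suc e
... | false with k ≤? n
...   | yes k≤n =
  let q , sup , e = pad (p ∘ suc) k h k≤n
  in (λ { zero → false ; (suc x) → q x }) , (λ { zero z → trans (sym eq) z ; (suc x) → sup x }) , e
...   | no k≰n = (λ _ → true) , (λ _ _ → refl) , trans (countᶠ-true (suc n)) (≤-antisym (≰⇒> k≰n) k≤)

-- From ordered tiles to a packing

module Packing {n : ℕ} (G : Digraph n) where

  V : Set
  V = Fin n

  Once : List V → Set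
  Once xs = ∀ w → # (λ v → eqᶠ v w) xs ≤ 1

  twice : ∀ {v : V} xs ys → v ∈ xs → v ∈ ys → Once (xs ++ ys) → ⊥
  twice {v} xs ys v∈xs v∈ys once = <⇒≱ (≤-refl {2}) (≤-trans (one xs v∈xs ⊕ one ys v∈ys)
    (≤-trans (≤-reflexive (sym (∑-++ xs ys))) (once v)))
    where
    one : ∀ zs → v ∈ zs → 1 ≤ # (λ u → eqᶠ u v) zs
    one zs m = ≤-trans (≤-reflexive (cong ⟦_⟧ (sym (eqᶠ-refl v)))) (∑-∈ zs m)

  Once-++ˡ : ∀ xs ys → Once (xs ++ ys) → Once xs
  Once-++ˡ xs ys once w = ≤-trans (m≤m+n _ _) (≤-trans (≤-reflexive (sym (∑-++ xs ys))) (once w))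

  Once-++ʳ : ∀ xs ys → Once (xs ++ ys) → Once ys
  Once-++ʳ xs ys once w = ≤-trans (m≤n+m _ (# (λ v → eqᶠ v w) xs)) (≤-trans (≤-reflexive (sym (∑-++ xs ys))) (once w))

  Edge : V → V → Set
  Edge x y = adj G x y ≡ true

  nth : ∀ {r} (T : List V) → length T ≡ r → Fin r → V
  nth T refl = lookup T

  nth-∈ : ∀ {r} T (e : length T ≡ r) j → nth T e j ∈ T
  nth-∈ T refl j = ∈-lookup j

  nth-surj : ∀ {r v} T (e : length T ≡ r) → v ∈ T → ∃ λ j → nth T e j ≡ v
  nth-surj T refl m = Any.index m , sym (lookup-index m)

  nth-inj : ∀ {r} T (e : length T ≡ r) → Once T → ∀ j j′ → nth T e j ≡ nth T e j′ → j ≡ j′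
  nth-inj T refl = go T
    where
    go : ∀ T → Once T → ∀ j j′ → lookup T j ≡ lookup T j′ → j ≡ j′
    go (x ∷ T) once zero    zero     h = refl
    go (x ∷ T) once zero    (suc j′) h = ⊥-elim (twice (x ∷ []) T (here refl) (subst (_∈ T) (sym h) (∈-lookup j′)) once)
    go (x ∷ T) once (suc j) zero     h = ⊥-elim (twice (x ∷ []) T (here refl) (subst (_∈ T) h (∈-lookup j)) once)
    go (x ∷ T) once (suc j) (suc j′) h = cong suc (go T (Once-++ʳ (x ∷ []) T once) j j′ h)

  nth-edge : ∀ {r} T (e : length T ≡ r) → AllPairs Edge T → ∀ j j′ → j Fin.< j′ → Edge (nth T e j) (nth T e j′)
  nth-edge T refl = go T
    where
    go : ∀ T → AllPairs Edge T → ∀ j j′ → j Fin.< j′ → Edge (lookup T j) (lookup T j′)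
    go (x ∷ T) (h AllPairs.∷ hs) zero    (suc j′) _       = All.lookup h (∈-lookup j′)
    go (x ∷ T) (h AllPairs.∷ hs) (suc j) (suc j′) (s≤s l) = go T hs j j′ l

  Ordered : ℕ → List V → Set
  Ordered r T = length T ≡ r × AllPairs Edge T

  module _ {r : ℕ} where

    place : ∀ ts → All (Ordered r) ts → Fin (length ts) → Fin r → V
    place (T ∷ ts) ((e , _) All.∷ _) zero    = nth T e
    place (T ∷ ts) (_ All.∷ hs)      (suc i) = place ts hs i

    place-∈ : ∀ ts (h : All (Ordered r) ts) i j → place ts h i j ∈ concat ts
    place-∈ (T ∷ ts) ((e , _) All.∷ _) zero    j = ∈-++⁺ˡ (nth-∈ T e j)
    place-∈ (T ∷ ts) (_ All.∷ hs)      (suc i) j = ∈-++⁺ʳ T (place-∈ ts hs i j)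

    place-inj : ∀ ts (h : All (Ordered r) ts) → Once (concat ts) → ∀ i j i′ j′ →
      place ts h i j ≡ place ts h i′ j′ → i ≡ i′ × j ≡ j′
    place-inj (T ∷ ts) ((e , _) All.∷ hs) once zero j zero j′ eq = refl , nth-inj T e (Once-++ˡ T _ once) j j′ eq
    place-inj (T ∷ ts) ((e , _) All.∷ hs) once zero j (suc i′) j′ eq =
      ⊥-elim (twice T (concat ts) (nth-∈ T e j) (subst (_∈ concat ts) (sym eq) (place-∈ ts hs i′ j′)) once)
    place-inj (T ∷ ts) ((e , _) All.∷ hs) once (suc i) j zero j′ eq =
      ⊥-elim (twice T (concat ts) (nth-∈ T e j′) (subst (_∈ concat ts) eq (place-∈ ts hs i j)) once)
    place-inj (T ∷ ts) (_ All.∷ hs) once (suc i) j (suc i′) j′ eq =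
      let a , b = place-inj ts hs (Once-++ʳ T _ once) i j i′ j′ eq in cong suc a , b

    place-surj : ∀ ts (h : All (Ordered r) ts) v → v ∈ concat ts → ∃ λ i → ∃ λ j → place ts h i j ≡ v
    place-surj (T ∷ ts) ((e , _) All.∷ hs) v m with ∈-++⁻ T m
    ... | inj₁ m′ = zero , nth-surj T e m′
    ... | inj₂ m′ = let i , j , eq = place-surj ts hs v m′ in suc i , j , eq

    place-edge : ∀ ts (h : All (Ordered r) ts) i j j′ → j Fin.< j′ → Edge (place ts h i j) (place ts h i j′)
    place-edge (T ∷ ts) ((e , ap) All.∷ _) zero    = nth-edge T e ap
    place-edge (T ∷ ts) (_ All.∷ hs)       (suc i) = place-edge ts hs i

    packing : ∀ ts → All (Ordered r) ts → concat ts ↭ allFin n → PerfectTPacking r G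
    packing ts h perm = length ts , place ts h ,
      place-inj ts h (λ w → ≤-trans (≤-reflexive (trans (∑-↭ perm) (sym (countᶠ≡# (λ v → eqᶠ v w))))) (countᶠ-eq w)) ,
      (λ v → place-surj ts h v (∈-resp-↭ (↭-sym perm) (∈-allFin v))) ,
      place-edge ts h

-- Typed neighbourhoods in the digraph

module Typed {n : ℕ} (G : Digraph n) (ρ k : ℕ) (n≡rk : n ≡ (3 + ρ) * k)
  (degree : ∀ x → ((2 + ρ) * n ≤ (3 + ρ) * outdeg G x) ⊎ ((2 + ρ) * n ≤ (3 + ρ) * indeg G x))
  (no-edge : ∀ x y → (3 + ρ) * outdeg G x < (2 + ρ) * n → (3 + ρ) * indeg G y < (2 + ρ) * n → adj G x y ≡ false)
  where

  open Packing G

  r : ℕ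
  r = 3 + ρ

  Vs : List V
  Vs = allFin n

  bigOut bigIn : V → Bool
  bigOut x = (2 + ρ) * n ≤ᵇ r * outdeg G x
  bigIn  x = (2 + ρ) * n ≤ᵇ r * indeg G x

  -- A vertex both of whose degrees are large carries two types; any other vertex
  -- uses its large neighbourhood for both.
  N : V × Bool → V → Bool
  N (v , true)  y = if bigOut v then adj G v y else adj G y v
  N (v , false) y = if bigIn v  then adj G y v else adj G v y

  open Chains N public

  one-side : ∀ v τ → (∀ y → N (v , τ) y ≡ adj G v y) ⊎ (∀ y → N (v , τ) y ≡ adj G y v)
  one-side v true with bigOut v
  ... | true  = inj₁ λ _ → refl
  ... | false = inj₂ λ _ → refl
  one-side v false with bigIn v
  ... | true  = inj₂ λ _ → refl
  ... | false = inj₁ λ _ → refl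

  N-irr : ∀ v τ → N (v , τ) v ≡ false
  N-irr v τ with one-side v τ
  ... | inj₁ h = trans (h v) (loopless G v)
  ... | inj₂ h = trans (h v) (loopless G v)

  -- Vertices typed by out-neighbourhoods go to the front, the others to the back.
  chain⇒ordered : ∀ {xs} → Chain xs → ∃ λ ys → ys ↭ xs × AllPairs Edge ys
  chain⇒ordered nil = [] , ↭-refl , AllPairs.[]
  chain⇒ordered (cons {v} {xs} τ all ch) =
    let ys , p , ap = chain⇒ordered ch
        all′ = All-resp-↭ (↭-sym p) all
    in insert ys p ap all′ (one-side v τ)
    where
    insert : ∀ ys → ys ↭ xs → AllPairs Edge ys → All (λ y → N (v , τ) y ≡ true) ys →
      (∀ y → N (v , τ) y ≡ adj G v y) ⊎ (∀ y → N (v , τ) y ≡ adj G y v) → ∃ λ zs → zs ↭ v ∷ xs × AllPairs Edge zs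
    insert ys p ap all′ (inj₁ h) = v ∷ ys , prep v p , All.map (λ {y} z → trans (sym (h y)) z) all′ AllPairs.∷ ap
    insert ys p ap all′ (inj₂ h) = ys ++ v ∷ [] , ↭-trans (++-comm ys (v ∷ [])) (prep v p) ,
      AllPairsₚ.++⁺ ap (All.[] AllPairs.∷ AllPairs.[]) (All.map (λ {y} z → trans (sym (h y)) z All.∷ All.[]) all′)

  tiling⇒packing : ∀ ts → All (λ T → length T ≡ r × Chain T) ts → concat ts ↭ Vs → PerfectTPacking r G
  tiling⇒packing ts h perm =
    let us , hu , pu = order ts h in packing us hu (↭-trans pu perm)
    where
    order : ∀ ts → All (λ T → length T ≡ r × Chain T) ts → ∃ λ us → All (Ordered r) us × concat us ↭ concat ts
    order []       All.[] = [] , All.[] , ↭-refl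
    order (T ∷ ts) ((e , ch) All.∷ hs) =
      let ys , p , ap = chain⇒ordered ch
          us , hu , pu = order ts hs
      in ys ∷ us , (trans (↭-length p) e , ap) All.∷ hu , ++⁺ p pu

  large : ∀ d → (2 + ρ) * n ≤ r * d → n ≤ d + k
  large d h = *-cancelˡ-≤ r (≤-trans (≤-reflexive (+-comm n ((2 + ρ) * n))) (≤-trans (h ⊕ ≤-reflexive n≡rk)
    (≤-reflexive (sym (*-distribˡ-+ r d k)))))

  large-N : ∀ i → n ≤ # (N i) Vs + k
  large-N (v , true) with bigOut v in eq | degree v
  ... | true  | _      = subst (λ z → n ≤ z + k) (countᶠ≡# (adj G v)) (large _ (≤ᵇ⇒≤ _ _ (true⇒T eq)))
  ... | false | inj₂ h = subst (λ z → n ≤ z + k) (countᶠ≡# (λ y → adj G y v)) (large _ h)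
  ... | false | inj₁ h with trans (sym (≤ᵇ-true h)) eq
  ...   | ()
  large-N (v , false) with bigIn v in eq | degree v
  ... | true  | _      = subst (λ z → n ≤ z + k) (countᶠ≡# (λ y → adj G y v)) (large _ (≤ᵇ⇒≤ _ _ (true⇒T eq)))
  ... | false | inj₁ h = subst (λ z → n ≤ z + k) (countᶠ≡# (adj G v)) (large _ h)
  ... | false | inj₂ h with trans (sym (≤ᵇ-true h)) eq
  ...   | ()

  length-Vs : length Vs ≡ n
  length-Vs = length-tabulate id

  #-not : (p : V → Bool) → # p Vs + # (not ∘ p) Vs ≡ n
  #-not p = trans (sym (∑-+ Vs _ _)) (trans (∑-cong Vs (λ v → one (p v))) (trans (sym (length-∑ Vs)) length-Vs))
    where
    one : ∀ b → ⟦ b ⟧ + ⟦ not b ⟧ ≡ 1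
    one true  = refl
    one false = refl

  notN : ∀ i → # (not ∘ N i) Vs ≤ k
  notN i = +-cancelˡ-≤ (# (N i) Vs) _ _ (≤-trans (≤-reflexive (#-not (N i))) (large-N i))

  k≤n : k ≤ n
  k≤n = ≤-trans (m≤m+n k _) (≤-reflexive (sym n≡rk))

  padded : ∀ i → ∃ λ q → (∀ x → not (N i x) ≡ true → q x ≡ true) × countᶠ q ≡ k
  padded i = pad (not ∘ N i) k (≤-trans (≤-reflexive (countᶠ≡# (not ∘ N i))) (notN i)) k≤n

  -- Non-neighbourhoods padded to exactly `k = n / r` vertices: not more, since their size bounds
  -- what a chain vertex excludes, and not fewer, since the density of edges is known only for sets
  -- of that size.
  S : V × Bool → V → Bool
  S i = proj₁ (padded i)

  S-self : ∀ v τ → S (v , τ) v ≡ true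
  S-self v τ = proj₁ (proj₂ (padded (v , τ))) v (cong not (N-irr v τ))

  S-compl : ∀ i y → S i y ≡ false → N i y ≡ true
  S-compl i y h with N i y in eq
  ... | true  = refl
  ... | false with trans (sym h) (proj₁ (proj₂ (padded i)) y (cong not eq))
  ...   | ()

  #S : ∀ i → # (S i) Vs ≡ k
  #S i = trans (sym (countᶠ≡# (S i))) (proj₂ (proj₂ (padded i)))

  -- This is where the absence of edges from vertices of small outdegree to vertices
  -- of small indegree is needed.
  edge⇒M : ∀ x y → adj G x y ≡ true → M x y ≡ true ⊎ M y x ≡ true
  edge⇒M x y h with bigOut x in eq₁ | bigIn y in eq₂
  ... | true  | _     = inj₁ (∨-trueˡ h)
  ... | false | true  = inj₂ (∨-trueʳ {N (y , true) x} h)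
  ... | false | false with trans (sym h) (no-edge x y (small eq₁) (small eq₂))
    where
    small : ∀ {a b} → (a ≤ᵇ b) ≡ false → b < a
    small {a} {b} e with a ≤? b
    ... | no ¬z = ≰⇒> ¬z
    ... | yes z with trans (sym (≤ᵇ-true z)) e
    ...   | ()
  ...   | ()

  eM : (V → Bool) → ℕ
  eM C = ∑ Vs (λ a → ∑ Vs (λ b → ⟦ C a ∧ (C b ∧ M a b) ⟧))

  edges≤eM : ∀ C → edgesIn G C ≤ 2 * eM C
  edges≤eM C = begin
    edgesIn G C
      ≡⟨ trans (sumᶠ-cong (λ x → countᶠ≡# (λ y → C x ∧ C y ∧ adj G x y))) (sumᶠ≡∑ id (λ x → # (λ y → C x ∧ C y ∧ adj G x y) Vs)) ⟩
    ∑ Vs (λ a → ∑ Vs (λ b → ⟦ C a ∧ C b ∧ adj G a b ⟧))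
      ≤⟨ ∑-mono Vs (λ {a} _ → ∑-mono Vs (λ {b} _ → pointwise a b)) ⟩
    ∑ Vs (λ a → ∑ Vs (λ b → ⟦ C a ∧ (C b ∧ M a b) ⟧ + ⟦ C b ∧ (C a ∧ M b a) ⟧))
      ≡⟨ trans (∑-cong Vs (λ a → ∑-+ Vs _ _)) (∑-+ Vs _ _) ⟩
    eM C + ∑ Vs (λ a → ∑ Vs (λ b → ⟦ C b ∧ (C a ∧ M b a) ⟧))
      ≡⟨ cong (eM C +_) (trans (∑-swap Vs Vs (λ a b → ⟦ C b ∧ (C a ∧ M b a) ⟧)) (sym (+-identityʳ (eM C)))) ⟩
    2 * eM C ∎
    where
    open ≤-Reasoning
    pointwise : ∀ a b → ⟦ C a ∧ C b ∧ adj G a b ⟧ ≤ ⟦ C a ∧ (C b ∧ M a b) ⟧ + ⟦ C b ∧ (C a ∧ M b a) ⟧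
    pointwise a b = cover (C a) (C b) (adj G a b) (M a b) (M b a) (edge⇒M a b)
      where
      cover : ∀ c d e m m′ → (e ≡ true → m ≡ true ⊎ m′ ≡ true) → ⟦ c ∧ d ∧ e ⟧ ≤ ⟦ c ∧ (d ∧ m) ⟧ + ⟦ d ∧ (c ∧ m′) ⟧
      cover false d     e     m m′ h = z≤n
      cover true  false e     m m′ h = z≤n
      cover true  true  false m m′ h = z≤n
      cover true  true  true  m m′ h with h refl
      ... | inj₁ refl = s≤s z≤n
      ... | inj₂ refl = m≤n+m 1 ⟦ m ⟧

-- Constants

*-grow : ∀ a {b} → 0 < b → a ≤ a * b
*-grow a h = m≤m*n a _ {{>-nonZero h}}

*-growˡ : ∀ {a} b → 0 < a → b ≤ a * b
*-growˡ {a} b h = m≤n*m b a {{>-nonZero h}}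

*-pos : ∀ {a b} → 0 < a → 0 < b → 0 < a * b
*-pos {a} ha hb = ≤-trans ha (*-grow a hb)

-- The scales of the construction. w is the unit: every round places P w tiles, at most
-- K = P² w vertices may be left over, and n ≤ 2 ω K.
module Scales (E ω w n r G c P Λ β : ℕ) (0<E : 0 < E) (0<ω : 0 < ω) (3≤r : 3 ≤ r)
  (G≡ : G ≡ 4 * (r * (10 ^ r * E))) (c≡ : c ≡ 64 * G) (P≡ : P ≡ 80 * (ω * (c * (r * (r * r)))))
  (Λ≡ : Λ ≡ 2 * (ω * P)) (n≤ : n ≤ 2 * (ω * (P * P * w)))
  (hw₁ : 2 * (Λ * (suc c * β)) ≤ w) (hw₂ : 64 * (ω * (ω * (E * β))) ≤ w) (0<w : 0 < w) where

  K′ y′ D₁* D₂* : ℕ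
  K′ = P * P * w
  y′ = r * (P * w)
  D₁* = Λ * (suc c * β + 2 * (c * (r * (r * (r * w)))))
  D₂* = Λ * (2 * (E * (n * β)) + 4 * (E * (y′ * y′)) + y′ * y′)

  0<r : 0 < r
  0<r = ≤-trans (s≤s z≤n) 3≤r

  0<X : 0 < 10 ^ r
  0<X = m^n>0 10 r

  0<G : 0 < G
  0<G = subst (0 <_) (sym G≡) (*-pos {4} (s≤s z≤n) (*-pos 0<r (*-pos 0<X 0<E)))

  0<c : 0 < c
  0<c = subst (0 <_) (sym c≡) (*-pos {64} (s≤s z≤n) 0<G)

  4rXE≤G : 4 * (r * (10 ^ r * E)) ≤ G
  4rXE≤G = ≤-reflexive (sym G≡)

  G≤c : G ≤ c
  G≤c = subst (G ≤_) (sym c≡) (*-growˡ {64} G (s≤s z≤n))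

  E≤c : E ≤ c
  E≤c = ≤-trans (*-growˡ {10 ^ r} E 0<X) (≤-trans (*-growˡ {r} (10 ^ r * E) 0<r)
    (≤-trans (*-growˡ {4} (r * (10 ^ r * E)) (s≤s z≤n)) (≤-trans 4rXE≤G G≤c)))

  80cr³≤P : 80 * (c * (r * (r * r))) ≤ P
  80cr³≤P = ≤-trans (*-monoʳ-≤ 80 (*-growˡ {ω} (c * (r * (r * r))) 0<ω)) (≤-reflexive (sym P≡))

  cr≤P : 80 * (c * r) ≤ P
  cr≤P = ≤-trans (*-monoʳ-≤ 80 (*-monoʳ-≤ c (*-grow r (*-pos 0<r 0<r)))) 80cr³≤P

  0<P : 0 < P
  0<P = ≤-trans (*-pos {80} (s≤s z≤n) (*-pos 0<c 0<r)) cr≤P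

  w≤K : w ≤ K′
  w≤K = *-growˡ w (*-pos 0<P 0<P)

  n≤Λs : n ≤ Λ * (P * w)
  n≤Λs = ≤-trans n≤ (≤-reflexive (trans (arr ω P w) (cong (_* (P * w)) (sym Λ≡))))
    where
    arr : ∀ ω P w → 2 * (ω * (P * P * w)) ≡ 2 * (ω * P) * (P * w)
    arr = solve-∀

  ε≥ : 2 * (c * (r * (y′ * y′))) ≤ K′ * (2 * (c * (r * (r * (r * w)))))
  ε≥ = ≤-reflexive (arr c r P w)
    where
    arr : ∀ c r P w → 2 * (c * (r * ((r * (P * w)) * (r * (P * w))))) ≡ P * P * w * (2 * (c * (r * (r * (r * w)))))
    arr = solve-∀

  -- There are `Λ = 2 * (ω * P)` rounds, each drifting by a multiple of `w`. The total is linear in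
  -- `P` whereas `K′` is quadratic, so a large multiple of `ω * (c * (r * (r * r)))` suffices for
  -- `P`; the trash is a matter of `w` alone, by `hw₁`.
  D₁*≤K : D₁* ≤ K′
  D₁*≤K = *-cancelˡ-≤ 2 (≤-trans (≤-reflexive (arr₁ Λ (suc c * β) (2 * (c * (r * (r * (r * w)))))))
    (≤-trans (≤-trans hw₁ w≤K ⊕ drift) (≤-reflexive (arr₂ K′))))
    where
    arr₁ : ∀ a b d → 2 * (a * (b + d)) ≡ 2 * (a * b) + 2 * (a * d)
    arr₁ = solve-∀
    arr₂ : ∀ k → k + k ≡ 2 * k
    arr₂ = solve-∀
    arr₃ : ∀ ω P c r w → 2 * (2 * (ω * P) * (2 * (c * (r * (r * (r * w)))))) ≡ 8 * (ω * (c * (r * (r * r)))) * (P * w)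
    arr₃ = solve-∀
    drift : 2 * (Λ * (2 * (c * (r * (r * (r * w)))))) ≤ K′
    drift = ≤-trans (≤-reflexive (trans (cong (λ z → 2 * (z * (2 * (c * (r * (r * (r * w))))))) Λ≡) (arr₃ ω P c r w)))
      (≤-trans (*-monoˡ-≤ (P * w) (≤-trans (*-monoˡ-≤ (ω * (c * (r * (r * r)))) (m≤m+n 8 72)) (≤-reflexive (sym P≡))))
        (≤-reflexive (sym (*-assoc P P w))))

  4D₂*≤K² : 4 * D₂* ≤ K′ * K′
  4D₂*≤K² = *-cancelˡ-≤ 2 (≤-trans (≤-reflexive (arr₁ Λ E n β (y′ * y′)))
    (≤-trans (part₁ ⊕ part₂) (≤-reflexive (arr₂ (K′ * K′)))))
    where
    arr₁ : ∀ Λ E n β z → 2 * (4 * (Λ * (2 * (E * (n * β)) + 4 * (E * z) + z))) ≡ (Λ * (16 * (E * (n * β)))) + (Λ * (8 * (4 * (E * z) + z)))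
    arr₁ = solve-∀
    arr₂ : ∀ k → k + k ≡ 2 * k
    arr₂ = solve-∀
    arr₃ : ∀ ω P E w β → 2 * (ω * P) * (16 * (E * (2 * (ω * (P * P * w)) * β))) ≡ 64 * (ω * (ω * (E * β))) * (P * (P * P * w))
    arr₃ = solve-∀
    arr₄ : ∀ P w → w * (P * (P * P * w)) * P ≡ P * P * w * (P * P * w)
    arr₄ = solve-∀
    part₁ : Λ * (16 * (E * (n * β))) ≤ K′ * K′
    part₁ = ≤-trans (*-mono-≤ (≤-reflexive Λ≡) (*-monoʳ-≤ 16 (*-monoʳ-≤ E (*-monoˡ-≤ β n≤))))
      (≤-trans (≤-reflexive (arr₃ ω P E w β)) (≤-trans (*-monoˡ-≤ (P * (P * P * w)) hw₂)
        (≤-trans (*-grow _ 0<P) (≤-reflexive (arr₄ P w)))))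
    arr₅ : ∀ ω P E r w → 2 * (ω * P) * (8 * (4 * (E * ((r * (P * w)) * (r * (P * w)))) + E * ((r * (P * w)) * (r * (P * w)))))
      ≡ 80 * (ω * (E * (r * r))) * (P * (P * w * (P * w)))
    arr₅ = solve-∀
    arr₆ : ∀ P w → P * (P * (P * w * (P * w))) ≡ P * P * w * (P * P * w)
    arr₆ = solve-∀
    part₂ : Λ * (8 * (4 * (E * (y′ * y′)) + y′ * y′)) ≤ K′ * K′
    part₂ = ≤-trans (*-mono-≤ (≤-reflexive Λ≡) (*-monoʳ-≤ 8 (+-monoʳ-≤ (4 * (E * (y′ * y′))) (*-growˡ (y′ * y′) 0<E))))
      (≤-trans (≤-reflexive (arr₅ ω P E r w)) (≤-trans (*-monoˡ-≤ (P * (P * w * (P * w)))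
        (≤-trans (*-monoʳ-≤ 80 (*-monoʳ-≤ ω (*-mono-≤ E≤c (*-growˡ (r * r) 0<r)))) (≤-reflexive (sym P≡))))
        (≤-reflexive (arr₆ P w))))

  80cy≤K : 80 * (c * y′) ≤ K′
  80cy≤K = ≤-trans (≤-reflexive (arr c r P w)) (≤-trans (*-monoˡ-≤ (P * w) cr≤P) (≤-reflexive (sym (*-assoc P P w))))
    where
    arr : ∀ c r P w → 80 * (c * (r * (P * w))) ≡ 80 * (c * r) * (P * w)
    arr = solve-∀

  cy≤K : c * y′ ≤ K′
  cy≤K = ≤-trans (*-growˡ {80} (c * y′) (s≤s z≤n)) 80cy≤K

  16Ey≤K : 16 * (E * y′) ≤ K′
  16Ey≤K = ≤-trans (*-mono-≤ (m≤m+n 16 64) (*-monoˡ-≤ y′ E≤c)) 80cy≤K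

  ΛΒ≤K : Λ * β ≤ K′
  ΛΒ≤K = ≤-trans (*-monoʳ-≤ Λ (≤-trans (*-growˡ {suc c} β (s≤s z≤n)) (m≤m+n (suc c * β) _))) D₁*≤K

  c≤P : c ≤ P
  c≤P = ≤-trans (*-grow c 0<r) (≤-trans (*-growˡ {80} (c * r) (s≤s z≤n)) cr≤P)

  G≤K : G ≤ K′
  G≤K = ≤-trans G≤c (≤-trans c≤P (≤-trans (*-grow P 0<P) (*-grow (P * P) 0<w)))

  module _ (m : ℕ) (K<m : K′ < m) where

    instance
      G≢0 : NonZero G
      G≢0 = >-nonZero 0<G

    g : ℕ
    -- The size of `G` keeps `10 ^ r * g` below `m / (4 * r * E)`, little enough for `many-fits` and
    -- `room-fits`. In turn `c = 64 * G` makes `c * g` at least `32 * m`, more than the `24 * m`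
    -- that `few-fits` calls for.
    g = m / G

    K≤m : K′ ≤ m
    K≤m = <⇒≤ K<m

    Gg≤m : G * g ≤ m
    Gg≤m = ≤-trans (≤-reflexive (*-comm G g)) (m/n*n≤m m G)

    m≤2Gg : m ≤ 2 * (G * g)
    m≤2Gg = go g (≤-trans (≤-reflexive (m≡m%n+[m/n]*n m G)) (+-monoˡ-≤ (g * G) (<⇒≤ (m%n<n m G))))
      where
      go : ∀ j → m ≤ G + j * G → m ≤ 2 * (G * j)
      go zero    h = ⊥-elim (<⇒≱ (≤-<-trans G≤K K<m) (≤-trans h (≤-reflexive (+-identityʳ G))))
      go (suc j) h = ≤-trans h (≤-trans (+-monoˡ-≤ (suc j * G) (m≤m+n G (j * G))) (≤-reflexive (arr G (suc j))))
        where
        arr : ∀ G j → j * G + j * G ≡ 2 * (G * j)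
        arr = solve-∀

    few-fits : 8 * m + 8 * D₁* + 8 * (c * y′) ≤ c * g
    few-fits = ≤-trans (+-monoʳ-≤ (8 * m) (8 ⊗ ≤-trans D₁*≤K K≤m) ⊕ 8 ⊗ ≤-trans cy≤K K≤m)
      (≤-trans (lin (8 * m) (32 ⊗ m≤2Gg) (arr m (G * g))) (≤-reflexive (sym (trans (cong (_* g) c≡) (*-assoc 64 G g)))))
      where
      arr : ∀ m z → 8 * m + 8 * m + 8 * m + 32 * (2 * z) + 8 * m ≡ 64 * z + 32 * m
      arr = solve-∀

    4rXEg≤m : 4 * (r * (10 ^ r * E)) * g ≤ m
    4rXEg≤m = ≤-trans (*-monoˡ-≤ g 4rXE≤G) Gg≤m

    many-fits : E * (2 * ((10 ^ r * g) * m) + 2 * (y′ * m)) + D₂* < m * m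
    many-fits = *-cancelˡ-< 8 _ _ (≤-<-trans bound strict)
      where
      h₁ : 4 * (E * (10 ^ r * g)) ≤ m
      h₁ = ≤-trans (*-growˡ {r} (4 * (E * (10 ^ r * g))) 0<r) (≤-trans (≤-reflexive (arr r E (10 ^ r) g)) 4rXEg≤m)
        where
        arr : ∀ r E X g → r * (4 * (E * (X * g))) ≡ 4 * (r * (X * E)) * g
        arr = solve-∀
      bound : 8 * (E * (2 * ((10 ^ r * g) * m) + 2 * (y′ * m)) + D₂*) ≤ 7 * (m * m)
      bound = lin 0 ((4 * m) ⊗ h₁ ⊕ m ⊗ ≤-trans 16Ey≤K K≤m ⊕ 2 ⊗ ≤-trans 4D₂*≤K² (*-mono-≤ K≤m K≤m))
        (arr E (10 ^ r) g m y′ D₂*)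
        where
        arr : ∀ E X g m y D → 8 * (E * (2 * ((X * g) * m) + 2 * (y * m)) + D) + (4 * m * m + m * m + 2 * (m * m)) + 0
          ≡ 7 * (m * m) + (4 * m * (4 * (E * (X * g))) + m * (16 * (E * y)) + 2 * (4 * D))
        arr = solve-∀
      strict : 7 * (m * m) < 8 * (m * m)
      strict = *-monoˡ-< (m * m) {{>-nonZero (*-pos 0<m 0<m)}} (≤-refl {8})
        where
        0<m : 0 < m
        0<m = ≤-<-trans z≤n K<m

    16y≤m : 16 * y′ ≤ m
    16y≤m = ≤-trans (*-monoʳ-≤ 16 (*-growˡ y′ 0<E)) (≤-trans 16Ey≤K K≤m)

    room-fits : r * (10 ^ r * g) + y′ ≤ m
    room-fits = *-cancelˡ-≤ 16 (lin (11 * m) (4 ⊗ h₁ ⊕ 16y≤m) (arr (r * (10 ^ r * g)) y′ m))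
      where
      h₁ : 4 * (r * (10 ^ r * g)) ≤ m
      h₁ = ≤-trans (*-growˡ {E} (4 * (r * (10 ^ r * g))) 0<E) (≤-trans (≤-reflexive (arr E r (10 ^ r) g)) 4rXEg≤m)
        where
        arr : ∀ E r X g → E * (4 * (r * (X * g))) ≡ 4 * (r * (X * E)) * g
        arr = solve-∀
      arr : ∀ a y m → 16 * (a + y) + (4 * m + m) + 11 * m ≡ 16 * m + (4 * (4 * a) + 16 * y)
      arr = solve-∀

    2y<m : 2 * y′ < m
    2y<m = *-cancelˡ-< 8 _ _ (≤-<-trans (≤-trans (≤-reflexive (arr y′)) 16y≤m) (m<m+n m {7 * m} (*-pos {7} (s≤s z≤n) (≤-<-trans z≤n K<m))))
      where
      arr : ∀ y → 8 * (2 * y) ≡ 16 * y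
      arr = solve-∀

-- Exponential estimates

bernoulli : ∀ x m → x ^ suc m + suc m * x ^ m ≤ suc x ^ suc m
bernoulli x zero    = ≤-reflexive (arr x)
  where
  arr : ∀ x → x * 1 + 1 * 1 ≡ (1 + x) * 1
  arr = solve-∀
bernoulli x (suc m) = ≤-trans (≤-trans (m≤m+n _ (suc m * x ^ m)) (≤-reflexive (arr x m (x ^ m))))
  (*-monoʳ-≤ (suc x) (bernoulli x m))
  where
  arr : ∀ x m z → x * (x * z) + (2 + m) * (x * z) + (1 + m) * z ≡ (1 + x) * (x * z + (1 + m) * z)
  arr = solve-∀

doubling : ∀ x → 2 * x ^ suc x ≤ suc x ^ suc x
doubling x = ≤-trans (≤-trans (m≤m+n _ (x ^ x)) (≤-reflexive (arr x (x ^ x)))) (bernoulli x x)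
  where
  arr : ∀ x z → 2 * (x * z) + z ≡ x * z + (1 + x) * z
  arr = solve-∀

-- Each block of `suc x` choices gains a factor 2. Of the `2 * K` blocks, half beat `N` and half
-- beat `2 ^ K`.
exponential-gap : ∀ x N K → 0 < x → N < 2 ^ K → (x ^ (suc x * (2 * K)) * N) * 2 ^ K < suc x ^ (suc x * (2 * K))
exponential-gap x N K 0<x N< = begin-strict
  (x ^ (suc x * (2 * K)) * N) * 2 ^ K
    <⟨ *-monoˡ-< (2 ^ K) {{m^n≢0 2 K}} (*-monoʳ-< (x ^ (suc x * (2 * K))) {{m^n≢0 x (suc x * (2 * K)) {{>-nonZero 0<x}}}} N<) ⟩
  (x ^ (suc x * (2 * K)) * 2 ^ K) * 2 ^ K
    ≡⟨ trans (*-assoc (x ^ (suc x * (2 * K))) (2 ^ K) (2 ^ K)) (trans (cong (x ^ (suc x * (2 * K)) *_)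
         (trans (sym (^-distribˡ-+-* 2 K K)) (cong (λ z → 2 ^ (K + z)) (sym (+-identityʳ K))))) (*-comm (x ^ (suc x * (2 * K))) (2 ^ (2 * K)))) ⟩
  2 ^ (2 * K) * x ^ (suc x * (2 * K))
    ≡⟨ cong (2 ^ (2 * K) *_) (sym (^-*-assoc x (suc x) (2 * K))) ⟩
  2 ^ (2 * K) * (x ^ suc x) ^ (2 * K)
    ≡⟨ sym (^-distribʳ-* (2 * K) 2 (x ^ suc x)) ⟩
  (2 * x ^ suc x) ^ (2 * K)
    ≤⟨ ^-monoˡ-≤ (2 * K) (doubling x) ⟩
  (suc x ^ suc x) ^ (2 * K)
    ≡⟨ ^-*-assoc (suc x) (suc x) (2 * K) ⟩
  suc x ^ (suc x * (2 * K)) ∎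
  where open ≤-Reasoning

n<2^n : ∀ n → n < 2 ^ n
n<2^n zero    = s≤s z≤n
n<2^n (suc n) = ≤-trans (s≤s (n<2^n n)) (≤-trans (+-monoˡ-≤ (2 ^ n) (m^n>0 2 n)) (≤-reflexive (cong (2 ^ n +_) (sym (+-identityʳ _)))))

-- With `j = K / (2 * r)`, both `2 * r * b` and `suc j` are at most `2 ^ j`, so `b * K` stays below
-- `2 ^ (j + j)`, whose `r`-th power is at most `2 ^ K`.
power<2^ : ∀ r b K → 0 < r → (2 * r) * ((2 * r) * b) ≤ K → (b * K) ^ r < 2 ^ K
power<2^ r b K 0<r big = <-≤-trans (^-monoˡ-< r {{>-nonZero 0<r}} base) (≤-trans (≤-reflexive (^-*-assoc 2 (j + j) r))
  (^-monoʳ-≤ 2 (≤-trans (≤-reflexive (arr j r)) (m/n*n≤m K (2 * r)))))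
  where
  instance
    2r≢0 : NonZero (2 * r)
    2r≢0 = >-nonZero (*-pos {2} (s≤s z≤n) 0<r)
  j : ℕ
  j = K / (2 * r)
  arr : ∀ j r → (j + j) * r ≡ j * (2 * r)
  arr = solve-∀
  j≥ : (2 * r) * b ≤ j
  j≥ = ≤-trans (≤-reflexive (sym (m*n/n≡m ((2 * r) * b) (2 * r)))) (/-monoˡ-≤ (2 * r)
    (≤-trans (≤-reflexive (*-comm ((2 * r) * b) (2 * r))) big))
  K≤ : K ≤ suc j * (2 * r)
  K≤ = ≤-trans (≤-reflexive (m≡m%n+[m/n]*n K (2 * r))) (+-monoˡ-≤ (j * (2 * r)) (<⇒≤ (m%n<n K (2 * r))))
  base : b * K < 2 ^ (j + j)
  base = begin-strict
    b * K
      ≤⟨ *-monoʳ-≤ b K≤ ⟩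
    b * (suc j * (2 * r))
      ≡⟨ arr′ b j r ⟩
    ((2 * r) * b) * suc j
      <⟨ *-monoˡ-< (suc j) (≤-<-trans j≥ (n<2^n j)) ⟩
    2 ^ j * suc j
      ≤⟨ *-monoʳ-≤ (2 ^ j) (n<2^n j) ⟩
    2 ^ j * 2 ^ j
      ≡⟨ sym (^-distribˡ-+-* 2 j j) ⟩
    2 ^ (j + j) ∎
    where
    open ≤-Reasoning
    arr′ : ∀ b j r → b * ((1 + j) * (2 * r)) ≡ ((2 * r) * b) * (1 + j)
    arr′ = solve-∀

-- Combining absorption and covering

module Assemble {n : ℕ} (𝔾 : Digraph n) (ρ k : ℕ) (n≡rk : n ≡ (3 + ρ) * k)
  (degree : ∀ x → ((2 + ρ) * n ≤ (3 + ρ) * outdeg 𝔾 x) ⊎ ((2 + ρ) * n ≤ (3 + ρ) * indeg 𝔾 x))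
  (no-edge : ∀ x y → (3 + ρ) * outdeg 𝔾 x < (2 + ρ) * n → (3 + ρ) * indeg 𝔾 y < (2 + ρ) * n → adj 𝔾 x y ≡ false)
  (e₀ : ℕ) (0<e₀ : 0 < e₀) (dense : ∀ C → n ≤ (3 + ρ) * size C → n * n ≤ e₀ * edgesIn 𝔾 C)
  (q₀ x : ℕ) (q₀≡ : q₀ ≡ ((3 + ρ) ^ (1 + ρ) * (2 * e₀)) * ((3 + ρ) ^ ρ * (2 * e₀)) ^ (3 + ρ)) (x≡ : 2 * (2 * q₀) ≡ suc x) (0<x : 0 < x)
  (ω w G c P Λ β : ℕ) (0<ω : 0 < ω)
  (G≡ : G ≡ 4 * ((3 + ρ) * (10 ^ (3 + ρ) * (2 * (2 * e₀))))) (c≡ : c ≡ 64 * G)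
  (P≡ : P ≡ 80 * (ω * (c * ((3 + ρ) * ((3 + ρ) * (3 + ρ)))))) (Λ≡ : Λ ≡ 2 * (ω * P)) (β≡ : β ≡ 8 * (Λ * (Λ * Λ)))
  (n≤ : n ≤ 2 * (ω * (P * P * w)))
  (hw₁ : 2 * (Λ * (suc c * β)) ≤ w) (hw₂ : 64 * (ω * (ω * (2 * (2 * e₀) * β))) ≤ w) (0<w : 0 < w)
  (hw₃ : (2 * (3 + ρ)) * ((2 * (3 + ρ)) * (2 * ω)) ≤ w)
  (ℓ U : ℕ) (ℓ≡ : ℓ ≡ (3 + ρ) * 1 + (3 + ρ) * ((2 + ρ) * 1)) (U≡ : U ≡ ℓ * (suc x * (2 * (P * P * w))))
  (U-small : suc c * U ≤ n) (U-small′ : (2 * q₀) * (ℓ * (U + ℓ)) ≤ n)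
  where

  open Packing 𝔾 using (V)
  open Typed 𝔾 ρ k n≡rk degree no-edge

  E e₁ K t : ℕ
  -- One factor 2 because an edge may be represented in `M` in either direction; the second, in `E`,
  -- for pairs lost with the absorbing set.
  e₁ = 2 * e₀
  E  = 2 * e₁
  K  = P * P * w
  t  = suc x * (2 * K)

  0<E : 0 < E
  0<E = *-pos {2} (s≤s z≤n) (*-pos {2} (s≤s z≤n) 0<e₀)

  module Sc = Scales E ω w n r G c P Λ β 0<E 0<ω (s≤s (s≤s (s≤s z≤n))) G≡ c≡ P≡ Λ≡ n≤ hw₁ hw₂ 0<w

  edges : ∀ C → k ≤ # C Vs → length Vs * length Vs ≤ e₁ * eM C
  edges C h = subst (λ z → z * z ≤ e₁ * eM C) (sym length-Vs) (≤-trans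
    (dense C (≤-trans (≤-reflexive n≡rk) (*-monoʳ-≤ r (≤-trans h (≤-reflexive (sym (countᶠ≡# C)))))))
    (≤-trans (*-monoʳ-≤ e₀ (edges≤eM C)) (≤-reflexive (arr e₀ (eM C)))))
    where
    arr : ∀ a b → a * (2 * b) ≡ (2 * a) * b
    arr = solve-∀

  0<K : 0 < K
  0<K = ≤-trans 0<w Sc.w≤K

  0<n : 0 < n
  0<n = ≤-trans 0<U (≤-trans (*-growˡ {suc c} U (s≤s z≤n)) U-small)
    where
    0<U : 0 < U
    0<U = subst (0 <_) (sym U≡) (*-pos (subst (0 <_) (sym ℓ≡) (s≤s z≤n)) (*-pos {suc x} (s≤s z≤n) (*-pos {2} (s≤s z≤n) 0<K)))

  n^r<2^K : n ^ r < 2 ^ K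
  n^r<2^K = ≤-<-trans (^-monoˡ-≤ r (≤-trans n≤ (≤-reflexive (sym (*-assoc 2 ω K)))))
    (power<2^ r (2 * ω) K (s≤s z≤n) (≤-trans hw₃ Sc.w≤K))

  Absorbing : Set
  Absorbing = ∃ λ W → length W ≡ U × W ⊑ Vs ×
    (∀ L j → length L ≡ j * r → j ≤ K → ∃ λ us → All (λ T → length T ≡ r × Chain T) us × concat us ↭ L ++ W)

  absorbing : Absorbing
  absorbing = subst (λ z → ∃ λ W → length W ≡ z × W ⊑ Vs ×
      (∀ L j → length L ≡ j * r → j ≤ K → ∃ λ us → All (λ T → length T ≡ r × Chain T) us × concat us ↭ L ++ W))
    (trans (cong (_* t) (sym ℓ≡)) (sym U≡))
    (Absorb.Select.absorption N eqᶠ eqᶠ-sound Vs ∈-allFin once ρ k e₁ length≡ notN q₀ (subst (0 <_) (sym length-Vs) 0<n)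
      (λ Q → subst (λ z → length (Absorb.As N eqᶠ eqᶠ-sound Vs ∈-allFin once ρ k e₁ length≡ notN) ≤
          z * # (Absorb.absorbs N eqᶠ eqᶠ-sound Vs ∈-allFin once ρ k e₁ length≡ notN Q) (Absorb.As N eqᶠ eqᶠ-sound Vs ∈-allFin once ρ k e₁ length≡ notN))
        (sym q₀≡) (Absorb.Counting.absorbs-count N eqᶠ eqᶠ-sound Vs ∈-allFin once ρ k e₁ length≡ notN edges Q))
      q≡ t K
      (≤-trans (≤-reflexive (cong₂ (λ z z′ → (2 * q₀) * (z * (z′ + z))) (sym ℓ≡) (trans (cong (_* t) (sym ℓ≡)) (sym U≡))))
        (≤-trans U-small′ (≤-reflexive (sym length-Vs))))
      (subst₂ _<_ (cong (_* 2 ^ K) (cong₂ _*_ (cong (_^ t) (sym p+q≡)) (sym (trans (length-tups Vs r) (cong (_^ r) length-Vs)))))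
        (cong (_^ t) (sym x≡)) (exponential-gap x (n ^ r) K 0<x n^r<2^K)))
    where
    length≡ : length Vs ≡ (3 + ρ) * k
    length≡ = trans length-Vs n≡rk
    once : ∀ u → # (λ v → eqᶠ v u) Vs ≤ 1
    once u = ≤-trans (≤-reflexive (sym (countᶠ≡# (λ v → eqᶠ v u)))) (countᶠ-eq u)
    q≡ : 2 * q₀ ≡ suc (2 * q₀ ∸ 1)
    q≡ = go (2 * q₀) x≡
      where
      go : ∀ z → 2 * z ≡ suc x → z ≡ suc (z ∸ 1)
      go (suc z) _ = refl
    p+q≡ : (2 * q₀ ∸ 1) + 2 * q₀ ≡ x
    p+q≡ = suc-injective (trans (cong (_+ 2 * q₀) (sym q≡)) (trans (cong (2 * q₀ +_) (sym (+-identityʳ (2 * q₀)))) x≡))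

  Tiling : List (List V) → Set
  Tiling = All (λ T → length T ≡ r × Chain T)

  e : V × Bool → List V → ℕ
  e = Rounds.e N S S-self S-compl N-irr (2 + ρ)

  -- The absorbing set may miss a non-neighbourhood altogether, which then keeps `k` vertices. As
  -- `U` is at most `n / suc c`, the excess is covered by the factor `suc c / c`.
  sparse-start : ∀ c r f k m U → f ≤ k → r * k ≤ m + U → suc c * U ≤ m + U → c * (r * f) ≤ suc c * m + 0
  sparse-start c r f k m U h₁ h₂ h₃ = lin 0 ((c * r) ⊗ h₁ ⊕ c ⊗ h₂ ⊕ h₃) (arr c r f k m U)
    where
    arr : ∀ c r f k m U → c * (r * f) + (c * r * k + c * (m + U) + (m + U)) + 0
      ≡ (1 + c) * m + 0 + (c * r * f + c * (r * k) + (1 + c) * U)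
    arr = solve-∀

  dense-start : ∀ e₁ a b m U n → m ≤ n → n * n ≤ e₁ * a → a ≤ b + U * (2 * n) → 4 * (e₁ * U) ≤ n → m * m ≤ 2 * e₁ * b + 0
  dense-start e₁ a b m U n h₁ h₂ h₃ h₄ = ≤-trans (*-mono-≤ h₁ h₁)
    (lin 0 (2 ⊗ h₂ ⊕ (2 * e₁) ⊗ h₃ ⊕ n ⊗ h₄) (arr e₁ a b U n))
    where
    arr : ∀ e₁ a b U n → n * n + (2 * (e₁ * a) + 2 * e₁ * (b + U * (2 * n)) + n * n) + 0
      ≡ 2 * e₁ * b + 0 + (2 * (n * n) + 2 * e₁ * a + n * (4 * (e₁ * U)))
    arr = solve-∀

  module Cover (W : List V) (lenU : length W ≡ U) (R₀ : List V) (perm : Vs ↭ W ++ R₀) where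

    len : length R₀ + U ≡ n
    len = trans (+-comm (length R₀) U) (trans (cong (_+ length R₀) (sym lenU)) (trans (sym (length-++ W))
      (trans (sym (↭-length perm)) length-Vs)))

    R₀≤n : length R₀ ≤ n
    R₀≤n = m+n≤o⇒m≤o (length R₀) (≤-reflexive len)

    4eU≤n : 4 * (e₁ * U) ≤ n
    4eU≤n = ≤-trans (≤-reflexive (arr e₁ U)) (≤-trans (*-monoˡ-≤ U 2E≤c) (≤-trans (m≤n+m (c * U) U) U-small))
      where
      arr : ∀ e U → 4 * (e * U) ≡ (2 * (2 * e)) * U
      arr = solve-∀
      2E≤c : 2 * E ≤ c
      2E≤c = ≤-trans (*-mono-≤ {2} {64} (m≤m+n 2 62) E≤G) (≤-reflexive (sym c≡))
        where
        E≤G : E ≤ G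
        E≤G = ≤-trans (*-growˡ {10 ^ r} E Sc.0<X) (≤-trans (*-growˡ {r} (10 ^ r * E) (s≤s z≤n))
          (≤-trans (*-growˡ {4} (r * (10 ^ r * E)) (s≤s z≤n)) Sc.4rXE≤G))

    start : Rounds.Inv N S S-self S-compl N-irr (2 + ρ) c E 0 0 R₀
    start = record
      { sparse = λ v τ _ → sparse-start c r (# (S (v , τ)) R₀) k (length R₀) U
          (≤-trans (∑-⊑ (W , ↭-trans perm (++-comm W R₀))) (≤-reflexive (#S (v , τ))))
          (≤-reflexive (trans (sym n≡rk) (sym len))) (≤-trans U-small (≤-reflexive (sym len)))
      ; dense = λ v _ → dense-start e₁ (e (v , true) Vs) (e (v , true) R₀) (length R₀) U n R₀≤n
          (≤-trans (≤-reflexive (cong (λ z → z * z) (sym length-Vs))) (edges (S (v , true)) (≤-reflexive (sym (#S (v , true))))))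
          (≤-trans (Rounds.e-remove′ N S S-self S-compl N-irr (2 + ρ) (v , true) Vs W R₀ perm) (≤-reflexive
            (cong₂ (λ z z′ → e (v , true) R₀ + z * (2 * z′)) lenU length-Vs)))
          4eU≤n }

    ε E₂ : ℕ
    ε  = 2 * (c * (r * (r * (r * w))))
    E₂ = 2 * (E * (n * β)) + 4 * (E * (Sc.y′ * Sc.y′)) + Sc.y′ * Sc.y′

    fits : ∀ m → K < m → m ≤ n → ∃ (Rounds.Fits N S S-self S-compl N-irr (2 + ρ) c E Sc.D₁* Sc.D₂* (r * (P * w)) m)
    fits m K<m _ = Sc.g m K<m , record
      { few-fits = Sc.few-fits m K<m ; many-fits = Sc.many-fits m K<m ; room-fits = Sc.room-fits m K<m ; 2y<m = Sc.2y<m m K<m }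

    covering : ∃ λ ts → ∃ λ rest → Tiling ts × R₀ ↭ concat ts ++ rest × length rest ≤ K + Λ * (8 * (Λ * (Λ * Λ)))
    covering = Rounds.Iterate.iterate N S S-self S-compl N-irr (2 + ρ) c E Sc.D₁* Sc.D₂* (P * w) Λ K n (suc c * β + ε) ε E₂ (*-pos Sc.0<P 0<w) Sc.0<c Sc.n≤Λs
      fits
      (≤-reflexive (cong (λ z → suc c * z + ε) (sym β≡))) Sc.ε≥
      (≤-reflexive (cong (λ z → 2 * (E * (n * z)) + 4 * (E * (Sc.y′ * Sc.y′)) + Sc.y′ * Sc.y′) (sym β≡)))
       Λ 0 0 R₀ start R₀≤n
      (≤-trans R₀≤n (≤-trans Sc.n≤Λs (≤-trans (*-monoʳ-≤ Λ (*-growˡ {r} (P * w) (s≤s z≤n))) (m≤n+m (Λ * Sc.y′) K))))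
      ≤-refl ≤-refl

  length-tiling : ∀ {ts} → Tiling ts → length (concat ts) ≡ r * length ts
  length-tiling All.[] = sym (*-zeroʳ r)
  length-tiling {T ∷ ts} ((eq , _) All.∷ h) = trans (length-++ T)
    (trans (cong₂ _+_ eq (length-tiling h)) (sym (*-suc r (length ts))))

  finish : ∀ W → length W ≡ U → (∀ L j → length L ≡ j * r → j ≤ K → ∃ λ us → Tiling us × concat us ↭ L ++ W) →
    ∀ R₀ → Vs ↭ W ++ R₀ → ∀ ts rest → Tiling ts → R₀ ↭ concat ts ++ rest → length rest ≤ K + Λ * β → PerfectTPacking r 𝔾
  finish W lenW absorb R₀ perm ts rest tiling perm′ small = from (absorb rest j lenRest j≤K)
    where
    open Perm.PermutationReasoning
    from : (∃ λ us → Tiling us × concat us ↭ rest ++ W) → PerfectTPacking r 𝔾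
    from (us , tu , pu) = tiling⇒packing (us ++ ts) (Allₚ.++⁺ tu tiling) (begin
      concat (us ++ ts)           ≡⟨ sym (concat-++ us ts) ⟩
      concat us ++ concat ts      ↭⟨ ++⁺ʳ (concat ts) (↭-trans pu (++-comm rest W)) ⟩
      (W ++ rest) ++ concat ts    ≡⟨ ++-assoc W rest (concat ts) ⟩
      W ++ (rest ++ concat ts)    ↭⟨ ++⁺ˡ W (↭-trans (++-comm rest (concat ts)) (↭-sym perm′)) ⟩
      W ++ R₀                     ↭⟨ ↭-sym perm ⟩
      Vs ∎)
    j a : ℕ
    -- The absorbing set has `r * r * t` vertices and the tiles `r * length ts`, so `r * a` counts
    -- both; hence the remainder is divisible by `r`.
    a = (1 + (2 + ρ) * 1) * t + length ts
    j = k ∸ a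
    total : r * k ≡ r * a + length rest
    total = trans (sym n≡rk) (trans (sym length-Vs) (trans (↭-length perm) (trans (length-++ W)
      (trans (cong₂ _+_ (trans lenW (trans U≡ (cong (_* t) ℓ≡))) (trans (↭-length perm′) (trans (length-++ (concat ts))
        (cong (_+ length rest) (length-tiling tiling))))) (arr r ((2 + ρ) * 1) t (length ts) (length rest))))))
      where
      arr : ∀ r z t u v → (r * 1 + r * z) * t + (r * u + v) ≡ r * ((1 + z) * t + u) + v
      arr = solve-∀
    lenRest : length rest ≡ j * r
    lenRest = trans (sym (m+n∸m≡n (r * a) (length rest))) (trans (cong (_∸ r * a) (sym total))
      (trans (sym (*-distribˡ-∸ r k a)) (*-comm r j)))
    -- At most `2 * K` vertices remain, and a group has at least two.
    j≤K : j ≤ K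
    j≤K = *-cancelʳ-≤ j K 2 (≤-trans (*-monoʳ-≤ j (m≤m+n 2 (1 + ρ))) (≤-trans (≤-reflexive (sym lenRest))
      (≤-trans small (≤-trans (+-monoʳ-≤ K Sc.ΛΒ≤K) (≤-reflexive (dbl K))))))
      where
      dbl : ∀ k → k + k ≡ k * 2
      dbl = solve-∀

  perfect-packing : PerfectTPacking r 𝔾
  perfect-packing = from absorbing
    where
    from : Absorbing → PerfectTPacking r 𝔾
    from (W , lenW , (R₀ , perm) , absorb) = conclude (Cover.covering W lenW R₀ perm)
      where
      conclude : (∃ λ ts → ∃ λ rest → Tiling ts × R₀ ↭ concat ts ++ rest × length rest ≤ K + Λ * (8 * (Λ * (Λ * Λ)))) → PerfectTPacking r 𝔾
      conclude (ts , rest , tiling , perm′ , small) = finish W lenW absorb R₀ perm ts rest tiling perm′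
        (≤-trans small (≤-reflexive (cong (λ z → K + Λ * z) (sym β≡))))

-- The sparse alternative

module _ {n : ℕ} (𝔾 : Digraph n) (r e₀ : ℕ) where

  Sparse : (Fin n → Bool) → Set
  Sparse C = n ≤ r * size C × e₀ * edgesIn 𝔾 C ≤ n * n

  -- Decided by searching the finitely many subsets. The subsets searched are vectors, so a
  -- predicate is tabulated before it is compared with them.
  sparse-or-dense : (∃ Sparse) ⊎ (∀ C → n ≤ r * size C → n * n ≤ e₀ * edgesIn 𝔾 C)
  sparse-or-dense with anySubset? (λ s → (n ≤? r * size (Vec.lookup s)) ×-dec (e₀ * edgesIn 𝔾 (Vec.lookup s) ≤? n * n))
  ... | yes (s , h) = inj₁ (Vec.lookup s , h)
  ... | no none = inj₂ λ C h → <⇒≤ (≰⇒> λ few → none (Vec.tabulate C ,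
        ≤-trans h (≤-reflexive (cong (r *_) (sumᶠ-cong (λ v → cong ⟦_⟧ (sym (lookup∘tabulate C v)))))) ,
        ≤-trans (≤-reflexive (cong (e₀ *_) (sumᶠ-cong (λ v → sumᶠ-cong (λ u →
          cong₂ (λ a b → ⟦ a ∧ b ∧ adj 𝔾 v u ⟧) (lookup∘tabulate C v) (lookup∘tabulate C u)))))) few))

toℚᵘ-toℚ : ∀ m → ℚ.toℚᵘ (toℚ m) ℚᵘ.≃ mkℚᵘ (ℤ.+ m) 0
toℚᵘ-toℚ m = ℚₚ.toℚᵘ-fromℚᵘ (mkℚᵘ (ℤ.+ m) 0)

-- A positive rational is at least the reciprocal of its denominator.
reciprocal : ∀ γ → 0ℚ ℚ.< γ → ∃ λ e₀ → 0 < e₀ × (∀ a b → e₀ * a ≤ b → toℚ a ℚ.≤ γ ℚ.* toℚ b)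
reciprocal (mkℚ (ℤ.+ zero) d _) (ℚ.*<* (ℤ.+<+ ()))
reciprocal γ@(mkℚ ℤ.+[1+ p ] d _) _ = suc d , s≤s z≤n , λ a b h → ℚₚ.toℚᵘ-cancel-≤ (begin
  ℚ.toℚᵘ (toℚ a)
    ≃⟨ toℚᵘ-toℚ a ⟩
  mkℚᵘ (ℤ.+ a) 0
    ≤⟨ *≤* (bound a b h) ⟩
  mkℚᵘ ℤ.+[1+ p ] d ℚᵘ.* mkℚᵘ (ℤ.+ b) 0
    ≃⟨ ℚᵘₚ.*-congˡ {mkℚᵘ ℤ.+[1+ p ] d} (ℚᵘₚ.≃-sym (toℚᵘ-toℚ b)) ⟩
  ℚ.toℚᵘ γ ℚᵘ.* ℚ.toℚᵘ (toℚ b)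
    ≃⟨ ℚᵘₚ.≃-sym (ℚₚ.toℚᵘ-homo-* γ (toℚ b)) ⟩
  ℚ.toℚᵘ (γ ℚ.* toℚ b) ∎)
  where
  open ℚᵘₚ.≤-Reasoning
  bound : ∀ a b → suc d * a ≤ b → (ℤ.+ a) ℤ.* (ℤ.+ (suc d * 1)) ℤ.≤ (ℤ.+[1+ p ] ℤ.* ℤ.+ b) ℤ.* (ℤ.+ 1)
  bound a b h = subst₂ ℤ._≤_ (ℤₚ.pos-* a (suc d * 1))
    (trans (ℤₚ.pos-* (suc p * b) 1) (cong (ℤ._* ℤ.+ 1) (ℤₚ.pos-* (suc p) b)))
    (ℤ.+≤+ (≤-trans (≤-reflexive (arr a (suc d))) (≤-trans h (≤-trans (m≤m+n b (p * b)) (≤-reflexive (sym (*-identityʳ (suc p * b))))))))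
    where
    arr : ∀ a d → a * (d * 1) ≡ d * a
    arr = solve-∀

-- Choice of the constants

module Conclude (ρ e₀ : ℕ) (0<e₀ : 0 < e₀) (q₀ x : ℕ)
  (q₀≡ : q₀ ≡ ((3 + ρ) ^ (1 + ρ) * (2 * e₀)) * ((3 + ρ) ^ ρ * (2 * e₀)) ^ (3 + ρ)) (x≡ : 2 * (2 * q₀) ≡ suc x) (0<x : 0 < x)
  (ℓ G c A ω P Λ β W : ℕ) (ℓ≡ : ℓ ≡ (3 + ρ) * 1 + (3 + ρ) * ((2 + ρ) * 1))
  (G≡ : G ≡ 4 * ((3 + ρ) * (10 ^ (3 + ρ) * (2 * (2 * e₀))))) (c≡ : c ≡ 64 * G)
  (A≡ : A ≡ ℓ * (suc x * 2)) (ω≡ : ω ≡ suc ((suc c + 4 * (q₀ * ℓ)) * A))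
  (P≡ : P ≡ 80 * (ω * (c * ((3 + ρ) * ((3 + ρ) * (3 + ρ)))))) (0<P : 0 < P) (Λ≡ : Λ ≡ 2 * (ω * P)) (β≡ : β ≡ 8 * (Λ * (Λ * Λ)))
  (W≡ : W ≡ suc (2 * (Λ * (suc c * β)) + (64 * (ω * (ω * (2 * (2 * e₀) * β))) + (2 * (3 + ρ)) * ((2 * (3 + ρ)) * (2 * ω))))) where

  r B : ℕ
  r = 3 + ρ
  B = ω * (P * P)

  n₀ : ℕ
  -- The unit will be `w = n / B`, so this makes `w` at least `W`, and `W` is the sum of all lower
  -- bounds required of `w`.
  n₀ = W * B

  0<ω : 0 < ω
  0<ω = subst (0 <_) (sym ω≡) (s≤s z≤n)

  dichotomy : ∀ n → n₀ ≤ n → ∀ k → n ≡ k * r → (𝔾 : Digraph n) →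
    (∀ v → ((2 + ρ) * n ≤ r * outdeg 𝔾 v) ⊎ ((2 + ρ) * n ≤ r * indeg 𝔾 v)) →
    (∀ u v → r * outdeg 𝔾 u < (2 + ρ) * n → r * indeg 𝔾 v < (2 + ρ) * n → adj 𝔾 u v ≡ false) →
    PerfectTPacking r 𝔾 ⊎ ∃ (Sparse 𝔾 r e₀)
  dichotomy n n₀≤n k n≡ 𝔾 degree no-edge = conclude (sparse-or-dense 𝔾 r e₀)
    where
    instance
      B≢0 : NonZero B
      B≢0 = >-nonZero (*-pos 0<ω (*-pos 0<P 0<P))

    w K U : ℕ
    w = n / B
    K = P * P * w
    U = ℓ * (suc x * (2 * K))

    W≤w : W ≤ w
    W≤w = ≤-trans (≤-reflexive (sym (m*n/n≡m W B))) (/-monoˡ-≤ B n₀≤n)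

    part : ∀ a b d {z} → z ≡ suc (a + (b + d)) → z ≤ w → a ≤ w × b ≤ w × d ≤ w × 0 < w
    part a b d refl h = ≤-trans (≤-trans (m≤m+n a (b + d)) (n≤1+n _)) h ,
      ≤-trans (≤-trans (≤-trans (m≤m+n b d) (m≤n+m (b + d) a)) (n≤1+n _)) h ,
      ≤-trans (≤-trans (≤-trans (m≤n+m d b) (m≤n+m (b + d) a)) (n≤1+n _)) h , ≤-trans (s≤s z≤n) h

    bounds : 2 * (Λ * (suc c * β)) ≤ w × 64 * (ω * (ω * (2 * (2 * e₀) * β))) ≤ w ×
      (2 * (3 + ρ)) * ((2 * (3 + ρ)) * (2 * ω)) ≤ w × 0 < w
    bounds = part _ _ _ W≡ W≤w

    0<w : 0 < w
    0<w = proj₂ (proj₂ (proj₂ bounds))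

    n≤ : n ≤ 2 * (ω * (P * P * w))
    n≤ = ≤-trans (≤-reflexive (m≡m%n+[m/n]*n n B)) (≤-trans (+-monoˡ-≤ (w * B) (≤-trans (<⇒≤ (m%n<n n B)) (*-growˡ {w} B 0<w)))
      (≤-reflexive (arr ω P w)))
      where
      arr : ∀ ω P w → w * (ω * (P * P)) + w * (ω * (P * P)) ≡ 2 * (ω * (P * P * w))
      arr = solve-∀

    ωK≤n : ω * K ≤ n
    ωK≤n = ≤-trans (≤-reflexive (arr ω P w)) (m/n*n≤m n B)
      where
      arr : ∀ ω P w → ω * (P * P * w) ≡ w * (ω * (P * P))
      arr = solve-∀

    U≡AK : U ≡ A * K
    U≡AK = trans (arr ℓ (suc x) K) (cong (_* K) (sym A≡))
      where
      arr : ∀ ℓ z K → ℓ * (z * (2 * K)) ≡ ℓ * (z * 2) * K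
      arr = solve-∀

    U≤n : (suc c + 4 * (q₀ * ℓ)) * U ≤ n
    U≤n = ≤-trans (≤-reflexive (trans (cong ((suc c + 4 * (q₀ * ℓ)) *_) U≡AK) (sym (*-assoc (suc c + 4 * (q₀ * ℓ)) A K))))
      (≤-trans (*-monoˡ-≤ K (≤-trans (n≤1+n ((suc c + 4 * (q₀ * ℓ)) * A)) (≤-reflexive (sym ω≡)))) ωK≤n)

    ℓ≤U : ℓ ≤ U
    ℓ≤U = *-grow ℓ (*-pos {suc x} (s≤s z≤n) (*-pos {2} (s≤s z≤n) (*-pos (*-pos 0<P 0<P) 0<w)))

    U-small′ : (2 * q₀) * (ℓ * (U + ℓ)) ≤ n
    U-small′ = ≤-trans (*-monoʳ-≤ (2 * q₀) (*-monoʳ-≤ ℓ (+-monoʳ-≤ U ℓ≤U)))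
      (≤-trans (≤-reflexive (arr q₀ ℓ U)) (≤-trans (*-monoˡ-≤ U (m≤n+m (4 * (q₀ * ℓ)) (suc c))) U≤n))
      where
      arr : ∀ q ℓ U → (2 * q) * (ℓ * (U + U)) ≡ 4 * (q * ℓ) * U
      arr = solve-∀

    conclude : (∃ (Sparse 𝔾 r e₀)) ⊎ (∀ C → n ≤ r * size C → n * n ≤ e₀ * edgesIn 𝔾 C) →
      PerfectTPacking r 𝔾 ⊎ ∃ (Sparse 𝔾 r e₀)
    conclude (inj₁ sparse) = inj₂ sparse
    conclude (inj₂ dense) = inj₁ (Assemble.perfect-packing 𝔾 ρ k (trans n≡ (*-comm k r)) degree no-edge e₀ 0<e₀ dense
      q₀ x q₀≡ x≡ 0<x ω w G c P Λ β 0<ω G≡ c≡ P≡ Λ≡ β≡ n≤ (proj₁ bounds) (proj₁ (proj₂ bounds)) 0<w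
      (proj₁ (proj₂ (proj₂ bounds))) ℓ U ℓ≡ refl (≤-trans (*-monoˡ-≤ U (m≤m+n (suc c) _)) U≤n) U-small′)

packing-or-sparse : ∀ ρ e₀ → 0 < e₀ → Σ ℕ λ n₀ → ∀ n → n₀ ≤ n → ∀ k → n ≡ k * (3 + ρ) → (𝔾 : Digraph n) →
  (∀ v → ((2 + ρ) * n ≤ (3 + ρ) * outdeg 𝔾 v) ⊎ ((2 + ρ) * n ≤ (3 + ρ) * indeg 𝔾 v)) →
  (∀ u v → (3 + ρ) * outdeg 𝔾 u < (2 + ρ) * n → (3 + ρ) * indeg 𝔾 v < (2 + ρ) * n → adj 𝔾 u v ≡ false) →
  PerfectTPacking (3 + ρ) 𝔾 ⊎ ∃ (Sparse 𝔾 (3 + ρ) e₀)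
packing-or-sparse ρ e₀ 0<e₀ =
  choose (((3 + ρ) ^ (1 + ρ) * (2 * e₀)) * ((3 + ρ) ^ ρ * (2 * e₀)) ^ (3 + ρ)) refl
    (4 * ((3 + ρ) * (10 ^ (3 + ρ) * (2 * (2 * e₀))))) refl
  where
  Goal : ℕ → Set
  Goal n₀ = ∀ n → n₀ ≤ n → ∀ k → n ≡ k * (3 + ρ) → (𝔾 : Digraph n) →
    (∀ v → ((2 + ρ) * n ≤ (3 + ρ) * outdeg 𝔾 v) ⊎ ((2 + ρ) * n ≤ (3 + ρ) * indeg 𝔾 v)) →
    (∀ u v → (3 + ρ) * outdeg 𝔾 u < (2 + ρ) * n → (3 + ρ) * indeg 𝔾 v < (2 + ρ) * n → adj 𝔾 u v ≡ false) →
    PerfectTPacking (3 + ρ) 𝔾 ⊎ ∃ (Sparse 𝔾 (3 + ρ) e₀)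

  0<2e₀ : 0 < 2 * e₀
  0<2e₀ = *-pos {2} (s≤s z≤n) 0<e₀

  predecessor : ∀ q → 0 < q → ∃ λ x → 2 * (2 * q) ≡ suc x × 0 < x
  predecessor (suc q) _ = 3 + 4 * q , arr q , s≤s z≤n
    where
    arr : ∀ q → 2 * (2 * (1 + q)) ≡ 4 + 4 * q
    arr = solve-∀

  choose : ∀ q₀ → q₀ ≡ ((3 + ρ) ^ (1 + ρ) * (2 * e₀)) * ((3 + ρ) ^ ρ * (2 * e₀)) ^ (3 + ρ) →
    ∀ G → G ≡ 4 * ((3 + ρ) * (10 ^ (3 + ρ) * (2 * (2 * e₀)))) → Σ ℕ Goal
  choose q₀ q₀≡ G G≡ =
    let x , x≡ , 0<x = predecessor q₀ 0<q₀
        ℓ = (3 + ρ) * 1 + (3 + ρ) * ((2 + ρ) * 1)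
        c = 64 * G
        A = ℓ * (suc x * 2)
        -- The absorbers occupy `A * K` vertices and n is at least `ω * K`. Their proportion is thus
        -- below `1 / suc c`, as the covering requires, and below `1 / (4 * q₀ * ℓ)`, so that fresh
        -- absorbers never run out.
        ω = suc ((suc c + 4 * (q₀ * ℓ)) * A)
        P = 80 * (ω * (c * ((3 + ρ) * ((3 + ρ) * (3 + ρ)))))
        Λ = 2 * (ω * P)
        β = 8 * (Λ * (Λ * Λ))
    in package x x≡ 0<x ℓ refl c refl A refl ω refl P refl Λ refl β refl _ refl
    where
    0<q₀ : 0 < q₀
    0<q₀ = subst (0 <_) (sym q₀≡) (*-pos (*-pos (m^n>0 (3 + ρ) (1 + ρ)) 0<2e₀)
      (m^n>0 ((3 + ρ) ^ ρ * (2 * e₀)) {{>-nonZero (*-pos (m^n>0 (3 + ρ) ρ) 0<2e₀)}} (3 + ρ)))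

    0<G : 0 < G
    0<G = subst (0 <_) (sym G≡) (*-pos {4} (s≤s z≤n) (*-pos {3 + ρ} (s≤s z≤n)
      (*-pos (m^n>0 10 (3 + ρ)) (*-pos {2} (s≤s z≤n) 0<2e₀))))

    package : ∀ x → 2 * (2 * q₀) ≡ suc x → 0 < x → ∀ ℓ → ℓ ≡ (3 + ρ) * 1 + (3 + ρ) * ((2 + ρ) * 1) →
      ∀ c → c ≡ 64 * G → ∀ A → A ≡ ℓ * (suc x * 2) → ∀ ω → ω ≡ suc ((suc c + 4 * (q₀ * ℓ)) * A) →
      ∀ P → P ≡ 80 * (ω * (c * ((3 + ρ) * ((3 + ρ) * (3 + ρ))))) → ∀ Λ → Λ ≡ 2 * (ω * P) → ∀ β → β ≡ 8 * (Λ * (Λ * Λ)) →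
      ∀ W → W ≡ suc (2 * (Λ * (suc c * β)) + (64 * (ω * (ω * (2 * (2 * e₀) * β))) + (2 * (3 + ρ)) * ((2 * (3 + ρ)) * (2 * ω)))) →
      Σ ℕ Goal
    package x x≡ 0<x ℓ ℓ≡ c c≡ A A≡ ω ω≡ P P≡ Λ Λ≡ β β≡ W W≡ = n₀ , dichotomy
      where
      0<P : 0 < P
      0<P = subst (0 <_) (sym P≡) (*-pos {80} (s≤s z≤n) (*-pos (subst (0 <_) (sym ω≡) (s≤s z≤n))
        (*-pos (subst (0 <_) (sym c≡) (*-pos {64} (s≤s z≤n) 0<G)) (*-pos {3 + ρ} {(3 + ρ) * (3 + ρ)} (s≤s z≤n) (*-pos {3 + ρ} {3 + ρ} (s≤s z≤n) (s≤s z≤n))))))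
      open Conclude ρ e₀ 0<e₀ q₀ x q₀≡ x≡ 0<x ℓ G c A ω P Λ β W ℓ≡ G≡ c≡ A≡ ω≡ P≡ 0<P Λ≡ β≡ W≡

theorem5p7 : (γ : ℚ) → 0ℚ ℚ.< γ → (r : ℕ) → 3 ≤ r →
    Σ ℕ λ n₀ → ∀ (n : ℕ) → n₀ ≤ n → r ∣ n → (G : Digraph n) →
    (∀ x → ((r ∸ 1) * n ≤ r * outdeg G x) ⊎ ((r ∸ 1) * n ≤ r * indeg G x)) →
    (∀ x y → r * outdeg G x < (r ∸ 1) * n → r * indeg G y < (r ∸ 1) * n →
    adj G x y ≡ false) →
    PerfectTPacking r G
    ⊎ (Σ (Fin n → Bool) λ S → (n ≤ r * size S) × γ-Independent γ G S)
theorem5p7 γ 0<γ (suc (suc (suc ρ))) (s≤s (s≤s (s≤s z≤n))) =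
  let e₀ , 0<e₀ , small = reciprocal γ 0<γ
      n₀ , prove = packing-or-sparse ρ e₀ 0<e₀
  in n₀ , λ { n n₀≤n (divides k n≡) G degree no-edge →
       weaken e₀ small n G (prove n n₀≤n k n≡ G degree no-edge) }
  where
  weaken : ∀ e₀ → (∀ a b → e₀ * a ≤ b → toℚ a ℚ.≤ γ ℚ.* toℚ b) → ∀ n (G : Digraph n) →
    PerfectTPacking (3 + ρ) G ⊎ ∃ (Sparse G (3 + ρ) e₀) →
    PerfectTPacking (3 + ρ) G ⊎ (Σ (Fin n → Bool) λ S → (n ≤ (3 + ρ) * size S) × γ-Independent γ G S)
  weaken e₀ small n G (inj₁ packing)          = inj₁ packing
  weaken e₀ small n G (inj₂ (S , large , few)) = inj₂ (S , large , small (edgesIn G S) (n * n) few)
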